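{- Let $q_n\in(0,1]$, $n=1,2,\dots$, with $q_n\to0$ as $n\to\infty$, and for each $n$ consider $q_n$-proportion Bulgarian solitaire. The limit shape $\phi$ of stable configurations (under the standard scaling in which the diagram has height $1$ and area $1$) depends on the asymptotic behavior of $nq_n^2$ as follows. (a) If $nq_n^2\to0$, the limit shape exists and is triangular: with height $1$ and downward slope $1/2$, i.e. $\phi(x)=\max(1-x/2,\,0)$. (b) If $nq_n^2\to\infty$, the limit shape exists and is exponential: $\phi(x)=e^{ -x}$. (c) If $nq_n^2\to C$ with $0<C<\infty$, define $z>0$ by the equation $$2C=\frac{z^2+\lceil z\rceil^2}{\lceil z\rceil}-\sum_{i=0}^{\lceil z\rceil-1}\frac{1}{\lceil z\rceil-i},$$ put $Z=\lceil z\rceil$, $A_0=\frac{z}{C}\cdot\frac{1+z-Z}{Z}$, and $A_k=\frac{z}{C}\cdot\frac{1}{Z-k}$ for $1\le k\le Z-1$. Then the limit shape exists and is the continuous piecewise linear function $\phi$ that starts at height $1$ at $x=0$, consists of $Z$ consecutive linear sections numbered $0,1,\dots,Z-1$ from left to right, where section $i$ has width $A_i$ and downward slope $\frac{C(Z-i)}{z^2}$ (so that height $0$ is reached at $x=A_0+\dots+A_{Z-1}$), and is $0$ thereafter.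
   Context: A configuration of $n$ cards is an integer partition $\lambda=(\lambda_1\ge\lambda_2\ge\cdots\ge\lambda_\ell>0)$ of $n$, extended by $\lambda_i=0$ for $i>\ell$. In a move of $q$-proportion Bulgarian solitaire ($q\in(0,1]$), $\lceil qh\rceil$ cards are picked from each nonempty pile of size $h$, all picked cards together form one new pile, and the resulting piles are sorted in weakly decreasing order (empty piles being discarded). A configuration is stable if a move leaves it unchanged; for each number of cards there is at most one stable configuration, and there is always one with a single card. For a partition $\lambda$ of $m$, the downscaled diagram-boundary function is $\partial\lambda(x)=\frac{1}{\lambda_1}\lambda_{\lfloor xm/\lambda_1\rfloor+1}$ for $x\ge0$. For each $n$, let $n^*(n)$ be the largest $n'\le n$ for which a stable configuration of $q_n$-proportion Bulgarian solitaire with $n'$ cards exists, and let $\lambda^{(n^*(n))}$ be that stable configuration. A function $\phi$ is the limit shape of stable configurations if $\partial\lambda^{(n^*(n))}(x)\to\phi(x)$ as $n\to\infty$ for all $x>0$. -}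

module Defs where

open import Algebra.Bundles using (CommutativeRing; Semiring)
import Algebra.Construct.NaturalChoice.Max as Max
import Algebra.Definitions.RawSemiring as RawSemiringDefs
import Algebra.Properties.AbelianGroup as AbelianGroupProperties
import Algebra.Properties.CommutativeMonoid.Sum as Summation
import Algebra.Properties.Ring as RingProperties
open import Axiom.ExcludedMiddle using (ExcludedMiddle)
open import Data.Empty using (⊥; ⊥-elim)
open import Data.Fin.Base using (toℕ)
open import Data.List.Base using (List; []; _∷_; filter; map)
open import Data.List.Relation.Binary.Permutation.Propositional.Properties using (↭-empty-inv)
open import Data.List.Relation.Unary.All using (All; [])
open import Data.List.Relation.Unary.Linked using (Linked; [])
import Data.List.Sort as Sort
open import Data.Nat.Base as ℕ using (ℕ; zero; suc; _∸_; _!)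
open import Data.Nat.ListAction using (sum)
import Data.Nat.Properties as ℕ
open import Data.Product.Base using (∃; _×_; _,_; proj₁; proj₂)
open import Data.Sum.Base using (inj₁; inj₂)
open import Level using (0ℓ)
open import Relation.Binary.Bundles using (TotalOrder)
import Relation.Binary.Construct.Flip.EqAndOrd as Flip
import Relation.Binary.Construct.NonStrictToStrict as Strict
open import Relation.Binary.PropositionalEquality.Core using (_≡_; refl)
open import Relation.Binary.Structures using (IsTotalOrder)
open import Relation.Nullary.Decidable.Core using (yes; no)
open import Relation.Nullary.Negation.Core using (¬_)

-- The real numbers are characterised, up to unique isomorphism, as a
-- Dedekind-complete ordered field.  The equality is a setoid equality, so
-- that Dedekind cuts or Cauchy sequences form an instance classically.

record CompleteOrderedField : Set₁ where
  infix  4 _≤_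
  infix  8 _⁻¹
  field
    commutativeRing : CommutativeRing 0ℓ 0ℓ
  open CommutativeRing commutativeRing public hiding (refl; sym; trans; reflexive; zero)
  field
    _≤_          : Carrier → Carrier → Set
    isTotalOrder : IsTotalOrder _≈_ _≤_
    0≉1          : ¬ 0# ≈ 1#
    -- Total for convenience; 0# ⁻¹ is unconstrained.
    _⁻¹          : Carrier → Carrier
    *-inverseʳ   : ∀ {x} → ¬ x ≈ 0# → x * x ⁻¹ ≈ 1#
    +-monoˡ-≤    : ∀ {x y} z → x ≤ y → x + z ≤ y + z
    *-nonneg     : ∀ {x y} → 0# ≤ x → 0# ≤ y → 0# ≤ x * y
    complete     : (S : Carrier → Set) → ∃ S →
                   (∃ λ b → ∀ x → S x → x ≤ b) →
                   ∃ λ s → (∀ x → S x → x ≤ s) ×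
                           (∀ b → (∀ x → S x → x ≤ b) → s ≤ b)

  totalOrder : TotalOrder 0ℓ 0ℓ 0ℓ
  totalOrder = record { isTotalOrder = isTotalOrder }

  open Strict _≈_ _≤_ public using (_<_)
  open Max totalOrder public using (_⊔_)
  open RawSemiringDefs (Semiring.rawSemiring semiring) public using (_^_) renaming (_×_ to _·_)
  open Summation +-commutativeMonoid public using (sum-syntax)

  infixl 7 _/_
  _/_ : Carrier → Carrier → Carrier
  x / y = x * y ⁻¹

  ∣_∣ : Carrier → Carrier
  ∣ x ∣ = x ⊔ (- x)

  fromℕ : ℕ → Carrier
  fromℕ n = n · 1#

  infix 4 _⟶_ _⟶∞

  _⟶_ : (ℕ → Carrier) → Carrier → Set
  s ⟶ L = ∀ ε → 0# < ε → ∃ λ N → ∀ n → N ℕ.≤ n → ∣ s n - L ∣ < ε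

  _⟶∞ : (ℕ → Carrier) → Set
  s ⟶∞ = ∀ M → ∃ λ N → ∀ n → N ℕ.≤ n → M < s n

module ClassicalReals (lem : ExcludedMiddle 0ℓ) (ℝ : CompleteOrderedField) where
  open CompleteOrderedField ℝ
  private
    module ≤ = IsTotalOrder isTotalOrder
    module R = CommutativeRing commutativeRing
    module G = AbelianGroupProperties R.+-abelianGroup
    module RP = RingProperties R.ring

    ≤-congˡ : ∀ {x y z} → x ≈ y → z ≤ x → z ≤ y
    ≤-congˡ p q = ≤.trans q (≤.reflexive p)

    ≤-congʳ : ∀ {x y z} → x ≈ y → x ≤ z → y ≤ z
    ≤-congʳ p q = ≤.trans (≤.reflexive (R.sym p)) q

    1≰0 : ¬ 1# ≤ 0#
    1≰0 1≤0 = 0≉1 (≤.antisym 0≤1 1≤0)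
      where
      0≤-1 : 0# ≤ - 1#
      0≤-1 = ≤-congˡ (+-identityˡ (- 1#)) (≤-congʳ (-‿inverseʳ 1#) (+-monoˡ-≤ (- 1#) 1≤0))
      0≤1 : 0# ≤ 1#
      0≤1 = ≤-congˡ (R.trans (RP.-1*x≈-x (- 1#)) (G.⁻¹-involutive 1#)) (*-nonneg 0≤-1 0≤-1)

    s≰s-1 : ∀ s → ¬ s ≤ s - 1#
    s≰s-1 s p = 1≰0 (≤-congˡ (-‿inverseʳ (s - 1#))
                       (≤-congʳ eq (+-monoˡ-≤ (- (s - 1#)) p)))
      where
      eq : s + - (s - 1#) ≈ 1#
      eq = R.trans (+-congˡ (R.trans (R.sym (G.⁻¹-∙-comm s (- 1#)))
                                     (+-congˡ (G.⁻¹-involutive 1#))))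
          (R.trans (R.sym (+-assoc s (- s) 1#))
          (R.trans (+-congʳ (-‿inverseʳ s)) (+-identityˡ 1#)))

    suc-shift : ∀ {x s} → 1# + x ≤ s → x ≤ s - 1#
    suc-shift {x} p = ≤-congʳ eq (+-monoˡ-≤ (- 1#) p)
      where
      eq : (1# + x) + - 1# ≈ x
      eq = R.trans (+-congʳ (+-comm 1# x))
          (R.trans (+-assoc x 1# (- 1#))
          (R.trans (+-congˡ (-‿inverseʳ 1#)) (+-identityʳ x)))

  archimedean : ∀ x → ∃ λ k → x ≤ fromℕ k
  archimedean x with lem {∃ λ k → x ≤ fromℕ k}
  ... | yes p = p
  ... | no ¬p = ⊥-elim (noSup (complete S (fromℕ 0 , 0 , R.refl) (x , bounded)))
    where
    S : Carrier → Set
    S y = ∃ λ k → y ≈ fromℕ k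

    bounded : ∀ y → S y → y ≤ x
    bounded y (k , y≈k) with ≤.total y x
    ... | inj₁ y≤x = y≤x
    ... | inj₂ x≤y = ⊥-elim (¬p (k , ≤-congˡ y≈k x≤y))

    noSup : (∃ λ s → (∀ y → S y → y ≤ s) × (∀ b → (∀ y → S y → y ≤ b) → s ≤ b)) → ⊥
    noSup (s , ub , least) = s≰s-1 s (least (s - 1#) λ where
      y (k , y≈k) → ≤-congʳ (R.sym y≈k) (suc-shift (ub (fromℕ (suc k)) (suc k , R.refl))))

  -- The least i ≥ j with P i, searched for up to the bound j + f.
  leastFrom : (P : ℕ → Set) (j f : ℕ) → ℕ
  leastFrom P j zero    = j
  leastFrom P j (suc f) with lem {P j}
  ... | yes _ = j
  ... | no  _ = leastFrom P (suc j) f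

  least : (P : ℕ → Set) → ∃ P → ℕ
  least P (k , _) = leastFrom P 0 k

  -- Ceiling and floor of a nonnegative real (both are 0 on negative reals).

  ⌈_⌉ : Carrier → ℕ
  ⌈ x ⌉ = least (λ k → x ≤ fromℕ k) (archimedean x)

  ⌊_⌋ : Carrier → ℕ
  ⌊ x ⌋ = least (λ k → x < fromℕ (suc k)) (k , x<1+k)
    where
    k = proj₁ (archimedean x)
    x≤k = proj₂ (archimedean x)
    k-shift : fromℕ (suc k) ≤ fromℕ k → fromℕ k ≤ fromℕ k - 1#
    k-shift = suc-shift
    x<1+k : x < fromℕ (suc k)
    x<1+k with ≤.total x (fromℕ (suc k))
    ... | inj₁ p = p , λ e → s≰s-1 (fromℕ k) (k-shift (≤-congʳ e x≤k))
    ... | inj₂ p = ⊥-elim (s≰s-1 (fromℕ k) (k-shift (≤.trans p x≤k)))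

  -- The limit of a sequence, with the value 0# if it diverges.

  lim : (ℕ → Carrier) → Carrier
  lim s with lem {∃ λ L → s ⟶ L}
  ... | yes (L , _) = L
  ... | no  _       = 0#

  exp : Carrier → Carrier
  exp x = lim (λ N → ∑[ k < N ] (x ^ toℕ k / fromℕ (toℕ k !)))

record Partition (n : ℕ) : Set where
  field
    parts    : List ℕ
    sorted   : Linked ℕ._≥_ parts
    positive : All (0 ℕ.<_) parts
    total    : sum parts ≡ n

open Partition public

-- Indexed from 0: part λ i is λ_{i+1}.

part : List ℕ → ℕ → ℕ
part []       _         = 0
part (x ∷ _)  zero      = x
part (_ ∷ xs) (suc i) = part xs i

module Decreasing = Sort (Flip.decTotalOrder ℕ.≤-decTotalOrder)

module Solitaire (lem : ExcludedMiddle 0ℓ) (ℝ : CompleteOrderedField) where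
  open CompleteOrderedField ℝ public
  open ClassicalReals lem ℝ public

  picked : Carrier → ℕ → ℕ
  picked q h = ⌈ q * fromℕ h ⌉

  move : Carrier → List ℕ → List ℕ
  move q hs = Decreasing.sort
    (filter (0 ℕ.<?_) (sum (map (picked q) hs) ∷ map (λ h → h ∸ picked q h) hs))

  Stable : Carrier → ℕ → Set
  Stable q n = ∃ λ (p : Partition n) → move q (parts p) ≡ parts p

  emptyStable : ∀ q → Stable q 0
  emptyStable q = record { parts = [] ; sorted = [] ; positive = [] ; total = refl }
                , ↭-empty-inv (Decreasing.sort-↭ [])

  -- The number n* of cards, the largest n' ≤ n admitting a stable
  -- configuration, together with such a configuration of n* cards.  The empty
  -- configuration only serves to start the search: for 0# < q ≤ 1# the
  -- configuration with a single card is stable, so n* ≥ 1 whenever n ≥ 1.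

  largestStable : (q : Carrier) → ℕ → ∃ (Stable q)
  largestStable q zero = 0 , emptyStable q
  largestStable q (suc n) with lem {Stable q (suc n)}
  ... | yes c = suc n , c
  ... | no  _ = largestStable q n

  ∂ : ∀ {n} → Partition n → Carrier → Carrier
  ∂ {n} p x = fromℕ (part (parts p) ⌊ x * fromℕ n / λ₁ ⌋) / λ₁
    where λ₁ = fromℕ (part (parts p) 0)

  IsLimitShape : (ℕ → Carrier) → (Carrier → Carrier) → Set
  IsLimitShape q φ = ∀ x → 0# < x →
    (λ n → ∂ (proj₁ (proj₂ (largestStable (q n) n))) x) ⟶ φ x

  triangle : Carrier → Carrier
  triangle x = (1# - x / fromℕ 2) ⊔ 0#

  SatisfiesScaleEquation : Carrier → Carrier → Set
  SatisfiesScaleEquation C z =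
    0# < z ×
    fromℕ 2 * C ≈ (z ^ 2 + fromℕ Z ^ 2) / fromℕ Z - (∑[ i < Z ] (1# / fromℕ (Z ∸ toℕ i)))
    where Z = ⌈ z ⌉

  module Sections (C z : Carrier) where
    Z : ℕ
    Z = ⌈ z ⌉

    width : ℕ → Carrier
    width 0           = z / C * ((1# + z - fromℕ Z) / fromℕ Z)
    width k@(suc _) = z / C * (1# / fromℕ (Z ∸ k))

    slope : ℕ → Carrier
    slope i = C * fromℕ (Z ∸ i) / z ^ 2

    -- The left end of section i.
    start : ℕ → Carrier
    start i = ∑[ j < i ] width (toℕ j)

    -- Continuity of φ on x ≥ 0 is contained in the sections being closed
    -- intervals that share their endpoints.
    record IsPiecewiseLinear (φ : Carrier → Carrier) : Set where
      field
        height-at-0 : φ 0# ≈ 1#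
        on-section  : ∀ i → i ℕ.< Z → ∀ x → start i ≤ x → x ≤ start (suc i) →
                      φ x ≈ φ (start i) - slope i * (x - start i)
        afterwards  : ∀ x → start Z ≤ x → φ x ≈ 0#

module Submission where

-- A stable configuration is determined by its largest pile m: the next pile is always
-- f λᵢ = λᵢ ∸ ⌈ q λᵢ ⌉.  If N is its number of cards and ℓ its number of piles, then
-- ℓ (ℓ + 1) ≤ 2 N, q N ≤ m ≤ q N + ℓ, and raising m by one adds at most ℓ + 1 cards, so
-- n* ≤ n ≤ n* + ℓ and N q² and n q² have the same limit.
-- (a) q m ≤ N q² + ℓ q becomes at most 1, and then every pile loses exactly one card.
-- (b) q N / m → 1, and q λᵢ differs from (1 - q)ⁱ q m by at most 1, while q m → ∞.
-- (c) The scaled heights y = q λᵢ follow y ↦ y - q ⌈ y ⌉.  The time τ y = ∫₀ʸ ds / ⌈ s ⌉ and the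
-- area A y = ∫₀ʸ s ds / ⌈ s ⌉ change in each step by q and q y, up to errors that telescope.
-- Hence A (q m) → C, where A z = C is the scale equation, and τ (q λᵢ) → τ z - C x / z; both
-- potentials are strictly increasing and therefore invertible.

open import Defs
open import Algebra.Bundles using (CommutativeRing)
import Algebra.Construct.NaturalChoice.Max as Max
import Algebra.Construct.NaturalChoice.MaxOp as MaxOp
import Algebra.Properties.AbelianGroup as AbelianGroupProperties
import Algebra.Properties.Ring as RingProperties
import Algebra.Properties.Semiring.Mult as Mult
import Algebra.Solver.Ring as RingSolver
open import Algebra.Solver.Ring.AlmostCommutativeRing
  using (fromCommutativeRing; _-Raw-AlmostCommutative⟶_)
open import Axiom.ExcludedMiddle using (ExcludedMiddle)
open import Data.Empty using (⊥; ⊥-elim)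
open import Data.Fin.Base using (toℕ)
open import Data.Integer.Base as ℤ using (ℤ; +_; -[1+_])
import Data.Integer.Properties as ℤ
open import Data.List.Base using (List; []; _∷_; filter; map; length)
open import Data.List.Membership.Propositional using (_∈_)
open import Data.List.Membership.Propositional.Properties using (∈-filter⁻; ∈-map⁻)
import Data.List.Properties as List
open import Data.List.Relation.Binary.Permutation.Propositional using (_↭_; ↭⇒↭ₛ)
open import Data.List.Relation.Binary.Permutation.Propositional.Properties using (∈-resp-↭)
open import Data.List.Relation.Binary.Pointwise using (Pointwise-≡⇒≡)
open import Data.List.Relation.Unary.All as All using (All; []; _∷_)
open import Data.List.Relation.Unary.Any using (here; there)
open import Data.List.Relation.Unary.Linked as Linked using (Linked; []; [-]; _∷_)
import Data.List.Relation.Unary.Linked.Properties as Linked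
import Data.List.Relation.Unary.Sorted.TotalOrder.Properties as Sorted
open import Data.Maybe.Base using (Maybe)
import Data.Maybe.Base as Maybe
open import Data.Nat.Base as ℕ using (ℕ; zero; suc; _∸_; _!)
open import Data.Nat.Induction using (<-rec)
open import Data.Nat.ListAction using (sum)
import Data.Nat.Properties as ℕ
open import Data.Product using (∃; ∃!; _×_; _,_; proj₁; proj₂)
import Data.Sign.Base as Sign
open import Data.Sum.Base using (_⊎_; inj₁; inj₂)
open import Function.Base using (_∘_)
open import Level using (0ℓ)
open import Relation.Binary.Bundles using (DecTotalOrder)
import Relation.Binary.Construct.Flip.EqAndOrd as Flip
open import Relation.Binary.PropositionalEquality.Core as ≡ using (_≡_; refl)
open import Relation.Binary.Structures using (IsTotalOrder)
open import Relation.Nullary.Decidable.Core using (yes; no; dec⇒maybe)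
open import Relation.Nullary.Negation.Core using (¬_)

-- Why stability leaves no freedom: a remainder is smaller than the pile it comes from, hence
-- smaller than λ₁, so λ₁ can only be the new pile. As ⌈ q h ⌉ grows by 0 or 1 with each card, `f`
-- is monotone and keeps the remainders in order.
--
-- The obstacle in (c) is that about 1 / q steps are made while the speed ⌈ y ⌉ jumps at integers,
-- so a direct comparison with a limiting trajectory would compound errors. In the coordinates τ and
-- A errors only add up: a step inside a section is off by O(q²), a step across an integer by O(q),
-- and boundedly many integers are crossed. Monotonicity and Lipschitz constant 1 then replace
-- calculus: values are inverted by suprema, and limits are pulled back through the potentials.
--
-- In (b) the heights q m are unbounded and another device is needed: q h + 1 shrinks at most by the
-- factor 1 - q per step. Since `exp` is a limit with a default value, convergence of its series has
-- to be proved; it comes out of the binomial expansion of (1 - q) ^ k with an explicit remainder.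

-- Combinatorics of stable configurations for an abstract picking rule

module StableConfigurations (c : ℕ → ℕ)
  (c-≤    : ∀ h → c h ℕ.≤ h)
  (c-pos  : ∀ h → 0 ℕ.< h → 0 ℕ.< c h)
  (c-mono : ∀ h → c h ℕ.≤ c (suc h))
  (c-suc  : ∀ h → c (suc h) ℕ.≤ suc (c h))
  where

  f : ℕ → ℕ
  f h = h ∸ c h

  f+c : ∀ h → f h ℕ.+ c h ≡ h
  f+c h = ℕ.m∸n+n≡m (c-≤ h)

  f-< : ∀ h → 0 ℕ.< h → f h ℕ.< h
  f-< h 0<h = ≡.subst (f h ℕ.<_) (f+c h) (ℕ.m<m+n (f h) (c-pos h 0<h))

  f-≤ : ∀ h → f h ℕ.≤ h
  f-≤ h = ℕ.m∸n≤m h (c h)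

  f-0 : f 0 ≡ 0
  f-0 = ℕ.0∸n≡0 (c 0)

  f-suc-≥ : ∀ h → f h ℕ.≤ f (suc h)
  f-suc-≥ h = ℕ.∸-monoʳ-≤ (suc h) (c-suc h)

  f-suc-≤ : ∀ h → f (suc h) ℕ.≤ suc (f h)
  f-suc-≤ h = ≡.subst (f (suc h) ℕ.≤_) (ℕ.+-∸-assoc 1 (c-≤ h)) (ℕ.∸-monoʳ-≤ (suc h) (c-mono h))

  f-suc : ∀ h → f (suc h) ≡ f h ⊎ f (suc h) ≡ suc (f h)
  f-suc h with ℕ.m≤n⇒m<n∨m≡n (f-suc-≤ h)
  ... | inj₁ (ℕ.s≤s p) = inj₁ (ℕ.≤-antisym p (f-suc-≥ h))
  ... | inj₂ p = inj₂ p

  f-mono : ∀ {g h} → g ℕ.≤ h → f g ℕ.≤ f h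
  f-mono {g} {zero} ℕ.z≤n = ℕ.≤-refl
  f-mono {g} {suc h} p with ℕ.m≤n⇒m<n∨m≡n p
  ... | inj₁ (ℕ.s≤s q) = ℕ.≤-trans (f-mono q) (f-suc-≥ h)
  ... | inj₂ refl = ℕ.≤-refl

  -- Induction along the piles, well-founded because `f` lowers every positive height. Most facts
  -- about `stable` follow by it, one pile per step.
  f-rec : (P : ℕ → Set) → P 0 → (∀ h → P (f (suc h)) → P (suc h)) → ∀ m → P m
  f-rec P p₀ step = <-rec P go
    where
    go : ∀ m → (∀ {k} → k ℕ.< m → P k) → P m
    go zero    _   = p₀
    go (suc h) rec = step h (rec (f-< (suc h) (ℕ.s≤s ℕ.z≤n)))

  -- Iterating `f` is not structurally recursive, so fuel is passed along. Each step lowers the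
  -- height by at least one, so fuel m suffices from height m; `chain-fuel` makes any surplus
  -- harmless.
  chain : ℕ → ℕ → List ℕ
  chain zero       _       = []
  chain (suc fuel) zero    = []
  chain (suc fuel) (suc h) = suc h ∷ chain fuel (f (suc h))

  chain-fuel : ∀ {F F′} m → m ℕ.≤ F → m ℕ.≤ F′ → chain F m ≡ chain F′ m
  chain-fuel {zero}  {zero}   zero    p q = refl
  chain-fuel {zero}  {suc F′} zero    p q = refl
  chain-fuel {suc F} {zero}   zero    p q = refl
  chain-fuel {suc F} {suc F′} zero    p q = refl
  chain-fuel {suc F} {suc F′} (suc h) p q = ≡.cong (suc h ∷_)
    (chain-fuel (f (suc h)) (ℕ.≤-pred (ℕ.≤-trans f< p)) (ℕ.≤-pred (ℕ.≤-trans f< q)))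
    where f< = f-< (suc h) (ℕ.s≤s ℕ.z≤n)

  stable : ℕ → List ℕ
  stable m = chain m m

  stable-suc : ∀ h → stable (suc h) ≡ suc h ∷ stable (f (suc h))
  stable-suc h = ≡.cong (suc h ∷_)
    (chain-fuel (f (suc h)) (ℕ.≤-pred (f-< (suc h) (ℕ.s≤s ℕ.z≤n))) ℕ.≤-refl)

  positive? = 0 ℕ.<?_

  picks : List ℕ → ℕ
  picks hs = sum (map c hs)

  after : List ℕ → List ℕ
  after hs = filter positive? (picks hs ∷ map f hs)

  -- Applying `f` to every pile shifts the list by one place: the remainders are the piles from the
  -- second on, followed by a 0 that the filter drops. The new pile m fills the vacant first place.
  after-stable : ∀ m → filter positive? (m ∷ map f (stable m)) ≡ stable m
  after-stable = f-rec _ refl step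
    where
    step : ∀ h → filter positive? (f (suc h) ∷ map f (stable (f (suc h)))) ≡ stable (f (suc h)) →
           filter positive? (suc h ∷ map f (stable (suc h))) ≡ stable (suc h)
    step h ih = ≡.trans (≡.cong (λ l → suc h ∷ filter positive? (map f l)) (stable-suc h))
               (≡.trans (≡.cong (suc h ∷_) ih) (≡.sym (stable-suc h)))

  -- Telescoping: the pick from each pile is its drop to the next one, and the chain ends at 0.
  picks-stable : ∀ m → picks (stable m) ≡ m
  picks-stable = f-rec _ refl λ h ih → ≡.trans (≡.cong picks (stable-suc h))
    (≡.trans (≡.cong (c (suc h) ℕ.+_) ih) (≡.trans (ℕ.+-comm (c (suc h)) _) (f+c (suc h))))

  stable-positive : ∀ m → All (0 ℕ.<_) (stable m)
  stable-positive = f-rec _ [] λ h ih →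
    ≡.subst (All (0 ℕ.<_)) (≡.sym (stable-suc h)) (ℕ.s≤s ℕ.z≤n ∷ ih)

  stable-sorted : ∀ m → Linked ℕ._≥_ (stable m)
  stable-sorted = f-rec _ [] λ h ih →
    ≡.subst (Linked ℕ._≥_) (≡.sym (stable-suc h)) (cons (f (suc h)) (f-≤ (suc h)) ih)
    where
    cons : ∀ {x} m → m ℕ.≤ x → Linked ℕ._≥_ (stable m) → Linked ℕ._≥_ (x ∷ stable m)
    cons zero    p l = [-]
    cons (suc h) p l = p ∷ l

  private
    ≥-order = DecTotalOrder.totalOrder (Flip.decTotalOrder ℕ.≤-decTotalOrder)

  sorted-permutation : ∀ {xs ys} → Linked ℕ._≥_ xs → Linked ℕ._≥_ ys → xs ↭ ys → xs ≡ ys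
  sorted-permutation p q r = Pointwise-≡⇒≡ (Sorted.↗↭↗⇒≋ ≥-order p q (↭⇒↭ₛ r))

  sort-after-stable : ∀ m → Decreasing.sort (after (stable m)) ≡ stable m
  sort-after-stable m = sorted-permutation (Decreasing.sort-↗ _) (stable-sorted m)
    (≡.subst (Decreasing.sort (after (stable m)) ↭_)
      (≡.trans (≡.cong (λ s → filter positive? (s ∷ map f (stable m))) (picks-stable m))
        (after-stable m))
      (Decreasing.sort-↭ _))

  head-max : ∀ {b t} → Linked ℕ._≥_ (b ∷ t) → ∀ {x} → x ∈ b ∷ t → x ℕ.≤ b
  head-max l = All.lookup (Linked.Linked⇒All (λ p q → ℕ.≤-trans q p) ℕ.≤-refl l)

  -- A remainder `f x` is strictly below x, and x is at most the largest pile b.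
  head-not-in-map : ∀ {b t} → Linked ℕ._≥_ (b ∷ t) → All (0 ℕ.<_) (b ∷ t) → ¬ b ∈ map f (b ∷ t)
  head-not-in-map {b} {t} l pos b∈ with ∈-map⁻ f b∈
  ... | x , x∈ , refl = ℕ.<⇒≱ (f-< x (All.lookup pos x∈)) (head-max l x∈)

  -- The equation reproduces itself on the tail: its head is v, and what follows satisfies the same
  -- equation with `f v` in place of v. At v = 0 a nonempty list would have its largest pile among
  -- the remainders.
  stable-unique : ∀ v t → Linked ℕ._≥_ t → All (0 ℕ.<_) t →
                  t ≡ filter positive? (v ∷ map f t) → t ≡ stable v
  stable-unique zero    []      l pos e = refl
  stable-unique zero    (b ∷ t) l pos e = ⊥-elim (head-not-in-map l pos
    (proj₁ (∈-filter⁻ positive? (≡.subst (b ∈_) e (here refl)))))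
  stable-unique (suc h) (b ∷ t) l pos e with List.∷-injective e
  ... | refl , e′ = ≡.trans (≡.cong (suc h ∷_) (stable-unique (f (suc h)) t (Linked.tail l)
    (All.tail pos) e′))
                           (≡.sym (stable-suc h))

  stable-characterised : ∀ hs → Linked ℕ._≥_ hs → All (0 ℕ.<_) hs →
                         Decreasing.sort (after hs) ≡ hs → hs ≡ stable (picks hs)
  stable-characterised []      l pos e = refl
  -- The list is in order before it is sorted, since `f` is monotone and `f b` is at most the new
  -- pile. Hence the permutation given by the sort is an equality, and `stable-unique` applies.
  stable-characterised (b ∷ t) l pos e = stable-unique (picks (b ∷ t)) (b ∷ t) l pos
    (sorted-permutation l (Sorted.filter⁺ ≥-order positive?
      (b≤picks ∷ Linked.map⁺ (Linked.map f-mono l))) perm)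
    where
    perm : b ∷ t ↭ after (b ∷ t)
    perm = ≡.subst (_↭ after (b ∷ t)) e (Decreasing.sort-↭ _)

    b≡picks : b ≡ picks (b ∷ t)
    b≡picks with proj₁ (∈-filter⁻ positive? (∈-resp-↭ perm (here refl)))
    ... | here p = p
    ... | there p = ⊥-elim (head-not-in-map l pos p)

    b≤picks : f b ℕ.≤ picks (b ∷ t)
    b≤picks = ℕ.≤-trans (f-≤ b) (ℕ.≤-reflexive b≡picks)

  N ℓ : ℕ → ℕ
  N m = sum (stable m)
  ℓ m = length (stable m)

  N-suc : ∀ h → N (suc h) ≡ suc h ℕ.+ N (f (suc h))
  N-suc h = ≡.cong sum (stable-suc h)

  ℓ-suc : ∀ h → ℓ (suc h) ≡ suc (ℓ (f (suc h)))
  ℓ-suc h = ≡.cong length (stable-suc h)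

  partition : ∀ m → Partition (N m)
  partition m = record { parts = stable m ; sorted = stable-sorted m ; positive = stable-positive m
    ; total = refl }

  it : ℕ → ℕ → ℕ
  it zero    m = m
  it (suc k) m = it k (f m)

  it-0 : ∀ k → it k 0 ≡ 0
  it-0 zero    = refl
  it-0 (suc k) = ≡.trans (≡.cong (it k) f-0) (it-0 k)

  part-stable : ∀ k m → part (stable m) k ≡ it k m
  part-stable k       zero    = ≡.sym (it-0 k)
  part-stable zero    (suc h) = refl
  part-stable (suc k) (suc h) = ≡.trans (≡.cong (λ l → part l (suc k)) (stable-suc h))
    (part-stable k (f (suc h)))

  ℓ≤ : ∀ m → ℓ m ℕ.≤ m
  ℓ≤ = f-rec _ ℕ.z≤n λ h ih → ≡.subst (ℕ._≤ suc h) (≡.sym (ℓ-suc h))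
    (ℕ.≤-trans (ℕ.s≤s ih) (f-< (suc h) (ℕ.s≤s ℕ.z≤n)))

  -- The piles are distinct positive numbers, so N ≥ 1 + 2 + ... + ℓ. In the induction the top pile
  -- contributes at least the number of piles, by `ℓ≤`.
  ℓ-bound : ∀ m → ℓ m ℕ.* suc (ℓ m) ℕ.≤ 2 ℕ.* N m
  ℓ-bound = f-rec _ ℕ.z≤n λ h ih → ≡.subst₂ ℕ._≤_
    (≡.cong (λ l → l ℕ.* suc l) (≡.sym (ℓ-suc h))) (≡.cong (2 ℕ.*_) (≡.sym (N-suc h)))
    (step (ℓ (f (suc h))) (N (f (suc h))) h (≡.subst (ℕ._≤ suc h) (ℓ-suc h) (ℓ≤ (suc h))) ih)
    where
    open ℕ.≤-Reasoning
    step : ∀ l n h → suc l ℕ.≤ suc h → l ℕ.* suc l ℕ.≤ 2 ℕ.* n →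
           suc l ℕ.* suc (suc l) ℕ.≤ 2 ℕ.* (suc h ℕ.+ n)
    step l n h p q = begin
      suc l ℕ.* suc (suc l)          ≡⟨ ℕ.*-comm (suc l) (2 ℕ.+ l) ⟩
      (2 ℕ.+ l) ℕ.* suc l            ≡⟨ ℕ.*-distribʳ-+ (suc l) 2 l ⟩
      2 ℕ.* suc l ℕ.+ l ℕ.* suc l    ≤⟨ ℕ.+-mono-≤ (ℕ.*-monoʳ-≤ 2 p) q ⟩
      2 ℕ.* suc h ℕ.+ 2 ℕ.* n        ≡⟨ ℕ.*-distribˡ-+ 2 (suc h) n ⟨
      2 ℕ.* (suc h ℕ.+ n)            ∎

  -- Raising the top pile by one raises each later pile by at most one, and may leave one extra pile
  -- with a single card at the end. This bounds the gaps between the totals that admit a stable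
  -- configuration.
  N-step : ∀ m → N m ℕ.< N (suc m) × N (suc m) ℕ.≤ suc (N m ℕ.+ ℓ m)
  N-step = f-rec _ base step
    where
    Goal : ℕ → Set
    Goal m = N m ℕ.< N (suc m) × N (suc m) ℕ.≤ suc (N m ℕ.+ ℓ m)

    base : Goal 0
    base = ℕ.s≤s ℕ.z≤n , ℕ.≤-reflexive refl

    -- The induction hypothesis compares the chains from `f h` and from `f h` + 1. If g = `f h`, the
    -- chains have merged and nothing more is added.
    weak : ∀ h {g} → Goal (f h) → g ≡ f h ⊎ g ≡ suc (f h) →
           N (f h) ℕ.≤ N g × N g ℕ.≤ suc (N (f h) ℕ.+ ℓ (f h))
    weak h (p , q) (inj₁ refl) = ℕ.≤-refl , ℕ.m≤n⇒m≤1+n (ℕ.m≤m+n _ _)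
    weak h (p , q) (inj₂ refl) = ℕ.<⇒≤ p , q

    step : ∀ h → Goal (f (suc h)) → Goal (suc h)
    step h ih with weak (suc h) ih (f-suc (suc h))
    ... | p , q = ≡.subst₂ ℕ._<_ (≡.sym (N-suc h)) (≡.sym (N-suc (suc h)))
      (ℕ.s≤s (ℕ.+-mono-≤ (ℕ.≤-refl {suc h}) p)) ,
      (begin
        N (suc (suc h))                              ≡⟨ N-suc (suc h) ⟩
        suc (suc h) ℕ.+ N (f (suc (suc h)))          ≤⟨ ℕ.+-monoʳ-≤ (suc (suc h)) q ⟩
        suc (suc h) ℕ.+ suc (Nf ℕ.+ ℓf)              ≡⟨ ≡.cong suc
          (≡.cong (suc h ℕ.+_) (≡.sym (ℕ.+-suc Nf ℓf))) ⟩
        suc (suc h ℕ.+ (Nf ℕ.+ suc ℓf))              ≡⟨ ≡.cong suc (ℕ.+-assoc (suc h) Nf (suc ℓf)) ⟨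
        suc (suc h ℕ.+ Nf ℕ.+ suc ℓf)                ≡⟨ ≡.cong₂ (λ a b → suc (a ℕ.+ b)) (N-suc h)
          (ℓ-suc h) ⟨
        suc (N (suc h) ℕ.+ ℓ (suc h))                ∎)
      where
      open ℕ.≤-Reasoning
      Nf = N (f (suc h))
      ℓf = ℓ (f (suc h))

module Development (lem : ExcludedMiddle 0ℓ) (ℝ : CompleteOrderedField) where
  open Solitaire lem ℝ

  module R = CommutativeRing commutativeRing
  module ≤ = IsTotalOrder isTotalOrder
  private
    module G = AbelianGroupProperties R.+-abelianGroup
    module RP = RingProperties R.ring
    module × = Mult R.semiring

  -- The integers inside the field, as coefficients of the ring solver

  fromℤ : ℤ → Carrier
  fromℤ (+ n)    = fromℕ n
  fromℤ -[1+ n ] = - fromℕ (suc n)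

  private
    cancel : ∀ a x y → (a + x) + - (a + y) ≈ x + - y
    cancel a x y = R.trans (+-congˡ (R.trans (R.sym (G.⁻¹-∙-comm a y)) (+-comm (- a) (- y))))
      (R.trans (R.sym (+-assoc (a + x) (- y) (- a)))
      (R.trans (+-congʳ (R.trans (+-assoc a x (- y)) (+-comm a (x + - y))))
      (R.trans (+-assoc (x + - y) a (- a)) (R.trans (+-congˡ (-‿inverseʳ a)) (+-identityʳ _)))))

    -0≈0 : - 0# ≈ 0#
    -0≈0 = R.trans (R.sym (+-identityˡ (- 0#))) (-‿inverseʳ 0#)

  fromℤ-⊖ : ∀ m n → fromℤ (m ℤ.⊖ n) ≈ fromℕ m + - fromℕ n
  fromℤ-⊖ m       zero    = R.sym (R.trans (+-congˡ -0≈0) (+-identityʳ _))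
  fromℤ-⊖ zero    (suc n) = R.sym (+-identityˡ _)
  fromℤ-⊖ (suc m) (suc n) =
    R.trans (R.reflexive (≡.cong fromℤ (ℤ.[1+m]⊖[1+n]≡m⊖n m n)))
    (R.trans (fromℤ-⊖ m n) (R.sym (cancel 1# _ _)))

  fromℤ-+ : ∀ i j → fromℤ (i ℤ.+ j) ≈ fromℤ i + fromℤ j
  fromℤ-+ (+ m)    (+ n)    = ×.×-homo-+ 1# m n
  fromℤ-+ (+ m)    -[1+ n ] = fromℤ-⊖ m (suc n)
  fromℤ-+ -[1+ m ] (+ n)    = R.trans (fromℤ-⊖ n (suc m)) (+-comm _ _)
  fromℤ-+ -[1+ m ] -[1+ n ] =
    R.trans (-‿cong (R.trans (R.reflexive (≡.cong (λ k → fromℕ (suc k)) (≡.sym (ℕ.+-suc m n))))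
                             (×.×-homo-+ 1# (suc m) (suc n))))
            (R.sym (G.⁻¹-∙-comm _ _))

  fromℤ-neg : ∀ i → fromℤ (ℤ.- i) ≈ - fromℤ i
  fromℤ-neg (+ zero)  = R.sym -0≈0
  fromℤ-neg (+ suc n) = R.refl
  fromℤ-neg -[1+ n ]  = R.sym (G.⁻¹-involutive _)

  private
    fromℤ-◃ : ∀ n → fromℤ (Sign.- ℤ.◃ n) ≈ - fromℕ n
    fromℤ-◃ zero    = R.sym -0≈0
    fromℤ-◃ (suc n) = R.refl

    fromℤ-+◃ : ∀ n → fromℤ (Sign.+ ℤ.◃ n) ≈ fromℕ n
    fromℤ-+◃ zero    = R.refl
    fromℤ-+◃ (suc n) = R.refl

  fromℤ-* : ∀ i j → fromℤ (i ℤ.* j) ≈ fromℤ i * fromℤ j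
  fromℤ-* (+ m)    (+ n)    = R.trans (fromℤ-+◃ (m ℕ.* n)) (×.×1-homo-* m n)
  fromℤ-* (+ m)    -[1+ n ] = R.trans (fromℤ-◃ (m ℕ.* suc n))
    (R.trans (-‿cong (×.×1-homo-* m (suc n))) (RP.-‿distribʳ-* _ _))
  fromℤ-* -[1+ m ] (+ n)    = R.trans (fromℤ-◃ (suc m ℕ.* n))
    (R.trans (-‿cong (×.×1-homo-* (suc m) n)) (RP.-‿distribˡ-* _ _))
  fromℤ-* -[1+ m ] -[1+ n ] = R.trans (fromℤ-+◃ (suc m ℕ.* suc n))
    (R.trans (×.×1-homo-* (suc m) (suc n))
    (R.trans (R.sym (G.⁻¹-involutive _))
    (R.trans (-‿cong (RP.-‿distribʳ-* _ _)) (RP.-‿distribˡ-* _ _))))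

  ℤ-morphism : ℤ.+-*-rawRing -Raw-AlmostCommutative⟶ fromCommutativeRing commutativeRing
  ℤ-morphism = record
    { ⟦_⟧    = fromℤ
    ; +-homo = fromℤ-+
    ; *-homo = fromℤ-*
    ; -‿homo = fromℤ-neg
    ; 0-homo = R.refl
    ; 1-homo = +-identityʳ 1#
    }

  ℤ-coeff≟ : ∀ i j → Maybe (fromℤ i ≈ fromℤ j)
  ℤ-coeff≟ i j = Maybe.map (λ { ≡.refl → R.refl }) (dec⇒maybe (i ℤ.≟ j))

  open RingSolver ℤ.+-*-rawRing (fromCommutativeRing commutativeRing) ℤ-morphism ℤ-coeff≟ public
    using (Polynomial; solve; con; _:=_; _:+_; _:*_; _:-_; :-_; _:^_)

  -- con (+ 1) evaluates to 1# + 0#, but :0 :^ 0 to 1#.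
  :0 :1 :2 : ∀ {n} → Polynomial n
  :0 = con (+ 0)
  :1 = :0 :^ 0
  :2 = con (+ 2)

  -- Ordered-field arithmetic and rounding

  infixl 6 _⊕_ _⊞_ _⊕≈_
  infixr 7 _⊛_ _⊛<_ _⊛≈_

  ≤-resp : ∀ {x y u v} → x ≈ u → y ≈ v → x ≤ y → u ≤ v
  ≤-resp p q h = ≤.trans (≤.reflexive (R.sym p)) (≤.trans h (≤.reflexive q))

  <-resp : ∀ {x y u v} → x ≈ u → y ≈ v → x < y → u < v
  <-resp p q (h , h≉) = ≤-resp p q h , λ e → h≉ (R.trans p (R.trans e (R.sym q)))

  _⊕_ : ∀ {x y u v} → x ≤ y → u ≤ v → x + u ≤ y + v
  _⊕_ {x} {y} {u} {v} p q =
    ≤.trans (+-monoˡ-≤ u p) (≤-resp (+-comm u y) (+-comm v y) (+-monoˡ-≤ y q))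

  ≤-shift : ∀ {x y} → x ≤ y → 0# ≤ y - x
  ≤-shift {x} p = ≤-resp (-‿inverseʳ x) R.refl (+-monoˡ-≤ (- x) p)

  ≤-unshift : ∀ {x y} → 0# ≤ y - x → x ≤ y
  ≤-unshift {x} {y} p = ≤-resp (solve 1 (λ x → :0 :+ x := x) R.refl x)
    (solve 2 (λ y x → y :- x :+ x := y) R.refl y x) (+-monoˡ-≤ x p)

  ≰⇒> : ∀ {x y} → ¬ x ≤ y → y < x
  ≰⇒> {x} {y} p with ≤.total x y
  ... | inj₁ q = ⊥-elim (p q)
  ... | inj₂ q = q , λ e → p (≤.reflexive (R.sym e))

  <⇒≱ : ∀ {x y} → x < y → ¬ y ≤ x
  <⇒≱ (p , p≉) q = p≉ (≤.antisym p q)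

  _≤⊎>_ : ∀ x y → x ≤ y ⊎ y < x
  x ≤⊎> y with lem {x ≤ y}
  ... | yes p = inj₁ p
  ... | no p = inj₂ (≰⇒> p)

  ≮⇒≥ : ∀ {x y} → ¬ x < y → y ≤ x
  ≮⇒≥ {x} {y} p with y ≤⊎> x
  ... | inj₁ q = q
  ... | inj₂ q = ⊥-elim (p q)

  0<1 : 0# < 1#
  0<1 = ≰⇒> λ 1≤0 → 0≉1 (≤.antisym
    (≤-resp R.refl (solve 0 ((:0 :- :1) :* (:0 :- :1) := :1) R.refl)
      (*-nonneg (≤-shift 1≤0) (≤-shift 1≤0))) 1≤0)

  fromℕ-nonneg : ∀ n → 0# ≤ fromℕ n
  fromℕ-nonneg zero    = ≤.refl
  fromℕ-nonneg (suc n) = ≤-resp (solve 0 (:0 :+ :0 := :0) R.refl) R.refl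
    (proj₁ 0<1 ⊕ fromℕ-nonneg n)

  *-monoˡ : ∀ {c x y} → 0# ≤ c → x ≤ y → c * x ≤ c * y
  *-monoˡ {c} {x} {y} p q = ≤-unshift (≤-resp R.refl (solve 3
    (λ c y x → c :* (y :- x) := c :* y :- c :* x) R.refl c y x) (*-nonneg p (≤-shift q)))

  _⊛_ : ∀ k {x y} → x ≤ y → fromℕ (suc k) * x ≤ fromℕ (suc k) * y
  k ⊛ p = *-monoˡ (fromℕ-nonneg (suc k)) p

  _⊞_ : ∀ {x y u v} → x < y → u ≤ v → x + u < y + v
  _⊞_ {x} {y} {u} {v} p q = ≰⇒> λ r → <⇒≱ p
    (≤-resp (solve 3 (λ y v u → y :+ v :+ u :- (u :+ v) := y) R.refl y v u)
      (solve 3 (λ x u v → x :+ u :+ v :- (u :+ v) := x) R.refl x u v)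
      (+-monoˡ-≤ (- (u + v)) (r ⊕ q)))

  fromℕ-pos : ∀ n → 0# < fromℕ (suc n)
  fromℕ-pos n = <-resp (solve 0 (:0 :+ :0 := :0) R.refl) R.refl (0<1 ⊞ fromℕ-nonneg n)

  zero-product : ∀ {x y} → x * y ≈ 0# → ¬ x ≈ 0# → y ≈ 0#
  zero-product {x} {y} p x≉0 = R.trans (solve 1 (λ y → y := :1 :* y) R.refl y)
    (R.trans (*-congʳ (R.sym (*-inverseʳ x≉0)))
    (R.trans (solve 3 (λ x i y → x :* i :* y := i :* (x :* y)) R.refl x i y)
      (R.trans (*-congˡ p) (solve 1 (λ i → i :* :0 := :0) R.refl i))))
    where i = x ⁻¹

  <⇒≉ : ∀ {x} → 0# < x → ¬ x ≈ 0#
  <⇒≉ (_ , p) e = p (R.sym e)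

  *-pos : ∀ {x y} → 0# < x → 0# < y → 0# < x * y
  *-pos p q = *-nonneg (proj₁ p) (proj₁ q) , λ e → <⇒≉ q (zero-product (R.sym e) (<⇒≉ p))

  <-shift : ∀ {x y} → x < y → 0# < y - x
  <-shift {x} {y} p = <-resp (solve 1 (λ x → x :+ (:- x) := :0) R.refl x) R.refl
    (p ⊞ ≤.refl {x = - x})

  <-unshift : ∀ {x y} → 0# < y - x → x < y
  <-unshift {x} {y} p = <-resp (solve 1 (λ x → :0 :+ x := x) R.refl x)
    (solve 2 (λ y x → y :- x :+ x := y) R.refl y x) (p ⊞ ≤.refl {x = x})

  *-monoˡ-< : ∀ {c x y} → 0# < c → x < y → c * x < c * y
  *-monoˡ-< {c} {x} {y} p q = <-unshift (<-resp R.refl (solve 3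
    (λ c y x → c :* (y :- x) := c :* y :- c :* x) R.refl c y x) (*-pos p (<-shift q)))

  _⊛<_ : ∀ k {x y} → x < y → fromℕ (suc k) * x < fromℕ (suc k) * y
  k ⊛< p = *-monoˡ-< (fromℕ-pos k) p

  cancel-≤ : ∀ {c x y} → 0# < c → c * x ≤ c * y → x ≤ y
  cancel-≤ p q = ≮⇒≥ λ r → <⇒≱ (*-monoˡ-< p r) q

  cancel-< : ∀ {c x y} → 0# < c → c * x < c * y → x < y
  cancel-< p q = ≰⇒> λ r → <⇒≱ q (*-monoˡ (proj₁ p) r)

  -- Linear arithmetic by certificates: the first argument combines hypotheses, and the
  -- ring identity says that the goal has (a multiple of) the same slack.

  ≤-by : ∀ k {x y a b} → x ≤ y → fromℕ (suc k) * (b - a) ≈ y - x → a ≤ b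
  ≤-by k {a = a} {b} p e = ≤-unshift (cancel-≤ (fromℕ-pos k)
    (≤-resp (solve 1 (λ v1 → :0 := v1 :* :0) R.refl (fromℕ (suc k))) (R.sym e) (≤-shift p)))

  <-by : ∀ k {x y a b} → x < y → fromℕ (suc k) * (b - a) ≈ y - x → a < b
  <-by k {a = a} {b} p e = <-unshift (cancel-< (fromℕ-pos k)
    (<-resp (solve 1 (λ v1 → :0 := v1 :* :0) R.refl (fromℕ (suc k))) (R.sym e) (<-shift p)))

  ≤-via : ∀ {x y a b} → x ≤ y → b - a ≈ y - x → a ≤ b
  ≤-via p e = ≤-unshift (≤-resp R.refl (R.sym e) (≤-shift p))

  <-via : ∀ {x y a b} → x < y → b - a ≈ y - x → a < b
  <-via p e = <-unshift (<-resp R.refl (R.sym e) (<-shift p))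

  ⊥-by : ∀ {x y} → x < y → x ≈ y → ⊥
  ⊥-by (_ , p) e = p e

  cancel-≈ : ∀ {c x y} → 0# < c → c * x ≈ c * y → x ≈ y
  cancel-≈ p e = ≤.antisym (cancel-≤ p (≤.reflexive e)) (cancel-≤ p (≤.reflexive (R.sym e)))

  ≈-by : ∀ k {x y a b} → x ≈ y → fromℕ (suc k) * (b - a) ≈ y - x → a ≈ b
  ≈-by k {x} {y} {a} {b} p e = ≤.antisym (≤-by k (≤.reflexive p) e)
    (≤-by k (≤.reflexive (R.sym p)) (R.trans (solve 3 (λ v1 a b → v1 :* (a :- b) :=
      (:- (v1 :* (b :- a)))) R.refl (fromℕ (suc k)) a b)
      (R.trans (-‿cong e) (solve 2 (λ y x → (:- (y :- x)) := x :- y) R.refl y x))))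

  ≈-via : ∀ {x y a b} → x ≈ y → b - a ≈ y - x → a ≈ b
  ≈-via {a = a} {b} p e = ≈-by 0 p (R.trans (solve 2 (λ b a → (con (+ 1)) :* (b :- a) := b :- a)
    R.refl b a) e)

  _⊕≈_ : ∀ {x y u v} → x ≈ y → u ≈ v → x + u ≈ y + v
  p ⊕≈ q = R.+-cong p q

  _⊛≈_ : ∀ k {x y} → x ≈ y → fromℕ (suc k) * x ≈ fromℕ (suc k) * y
  k ⊛≈ p = R.*-congˡ p

  <-≤-trans : ∀ {x y z} → x < y → y ≤ z → x < z
  <-≤-trans {x} {y} {z} p q = <-via (p ⊞ q) (solve 3 (λ x y z → z :- x := y :+ z :- (x :+ y)) R.refl
    x y z)

  ≤-<-trans : ∀ {x y z} → x ≤ y → y < z → x < z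
  ≤-<-trans {x} {y} {z} p q = <-via (q ⊞ p) (solve 3 (λ x y z → z :- x := z :+ y :- (y :+ x)) R.refl
    x y z)

  <-trans : ∀ {x y z} → x < y → y < z → x < z
  <-trans p q = <-≤-trans p (proj₁ q)

  fromℕ-mono : ∀ {m n} → m ℕ.≤ n → fromℕ m ≤ fromℕ n
  fromℕ-mono {n = n} ℕ.z≤n = fromℕ-nonneg n
  fromℕ-mono (ℕ.s≤s p) = ≤.refl {x = 1#} ⊕ fromℕ-mono p

  fromℕ-mono-< : ∀ {m n} → m ℕ.< n → fromℕ m < fromℕ n
  fromℕ-mono-< {m} {n} p = <-≤-trans (<-via 0<1 (solve 1 (λ v1 → :1 :+ v1 :- v1 := :1 :- :0) R.refl
    (fromℕ m))) (fromℕ-mono p)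

  fromℕ-cancel-≤ : ∀ {m n} → fromℕ m ≤ fromℕ n → m ℕ.≤ n
  fromℕ-cancel-≤ {m} {n} p with m ℕ.≤? n
  ... | yes q = q
  ... | no q = ⊥-elim (<⇒≱ (fromℕ-mono-< (ℕ.≰⇒> q)) p)

  fromℕ-cancel-< : ∀ {m n} → fromℕ m < fromℕ n → m ℕ.< n
  fromℕ-cancel-< {m} {n} p = ℕ.≰⇒> λ q → <⇒≱ p (fromℕ-mono q)

  fromℕ-+ : ∀ m n → fromℕ (m ℕ.+ n) ≈ fromℕ m + fromℕ n
  fromℕ-+ m n = fromℤ-+ (+ m) (+ n)

  fromℕ-* : ∀ m n → fromℕ (m ℕ.* n) ≈ fromℕ m * fromℕ n
  fromℕ-* = Mult.×1-homo-* R.semiring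

  fromℕ-cong : ∀ {m n} → m ≡ n → fromℕ m ≈ fromℕ n
  fromℕ-cong p = R.reflexive (≡.cong fromℕ p)

  fromℕ-∸ : ∀ {m n} → n ℕ.≤ m → fromℕ (m ∸ n) ≈ fromℕ m - fromℕ n
  fromℕ-∸ {m} {n} p = R.trans (solve 2 (λ d k → d := d :+ k :- k) R.refl d k)
    (+-congʳ (R.trans (R.sym (fromℕ-+ (m ∸ n) n)) (fromℕ-cong (ℕ.m∸n+n≡m p))))
    where d = fromℕ (m ∸ n) ; k = fromℕ n

  inv-pos : ∀ {x} → 0# < x → 0# < x ⁻¹
  inv-pos {x} p = cancel-< p (<-resp (solve 1 (λ x → :0 := x :* :0) R.refl x)
    (R.sym (*-inverseʳ (<⇒≉ p))) 0<1)

  inv-cancel : ∀ {x} → 0# < x → x * x ⁻¹ ≈ 1#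
  inv-cancel p = *-inverseʳ (<⇒≉ p)

  /-cancel : ∀ {x y} → 0# < y → x / y * y ≈ x
  /-cancel {x} {y} p = R.trans (solve 3 (λ x v1 y → x :* v1 :* y := x :* (y :* v1)) R.refl x (y ⁻¹)
    y) (R.trans (*-congˡ (inv-cancel p)) (solve 1 (λ x → x :* :1 := x) R.refl x))

  ≈-/ : ∀ {x y z} → 0# < y → z * y ≈ x → z ≈ x / y
  ≈-/ {x} {y} {z} p e = cancel-≈ p (R.trans (solve 2 (λ y z → y :* z := z :* y) R.refl y z)
    (R.trans e (R.trans (R.sym (/-cancel p)) (solve 3 (λ x v1 y → x :* v1 :* y := y :* (x :* v1))
    R.refl x (y ⁻¹) y))))

  /-≤ : ∀ {x y z} → 0# < y → x ≤ z * y → x / y ≤ z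
  /-≤ {x} {y} {z} p q = cancel-≤ p (≤-via (q ⊕ (≤.reflexive (/-cancel {x} p)))
    (solve 4 (λ x z y v1 → y :* z :- y :* v1 := z :* y :+ x :- (x :+ v1 :* y)) R.refl x z y
    (x / y)))

  /-pos : ∀ {x y} → 0# < x → 0# < y → 0# < x / y
  /-pos p q = *-pos p (inv-pos q)

  private
    module MaxProps = MaxOp (Max.maxOperator totalOrder)

  ⊔-ub₁ : ∀ x y → x ≤ x ⊔ y
  ⊔-ub₁ x y = MaxProps.x≤x⊔y x y

  ⊔-ub₂ : ∀ x y → y ≤ x ⊔ y
  ⊔-ub₂ x y = MaxProps.x≤y⊔x x y

  ⊔-lub : ∀ {x y z} → x ≤ z → y ≤ z → x ⊔ y ≤ z
  ⊔-lub p q = MaxProps.⊔-lub p q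

  square-nonneg : ∀ x → 0# ≤ x * x
  square-nonneg x with ≤.total 0# x
  ... | inj₁ p = *-nonneg p p
  ... | inj₂ p = ≤-resp R.refl (solve 1 (λ x → (:0 :- x) :* (:0 :- x) := x :* x) R.refl x)
    (*-nonneg (≤-shift p) (≤-shift p))

  abstract
   half : ∀ {ε} → 0# < ε → ∃ λ δ → 0# < δ × fromℕ 2 * δ ≈ ε
   half {ε} p = ε / fromℕ 2 , /-pos p (fromℕ-pos 1) , R.trans (R.*-comm _ _)
     (/-cancel (fromℕ-pos 1))

  ⌈⌉-ub : ∀ x → x ≤ fromℕ ⌈ x ⌉
  ⌊⌋-ub : ∀ x → x < fromℕ (suc ⌊ x ⌋)

  private
    leastFrom-satisfies : ∀ (P : ℕ → Set) j f → P (j ℕ.+ f) → P (leastFrom P j f)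
    leastFrom-satisfies P j zero    p = ≡.subst P (ℕ.+-identityʳ j) p
    leastFrom-satisfies P j (suc f) p with lem {P j}
    ... | yes q = q
    ... | no  _ = leastFrom-satisfies P (suc j) f (≡.subst P (ℕ.+-suc j f) p)

    leastFrom-least : ∀ (P : ℕ → Set) j f i → j ℕ.≤ i → P i → leastFrom P j f ℕ.≤ i
    leastFrom-least P j zero    i j≤i p = j≤i
    leastFrom-least P j (suc f) i j≤i p with lem {P j}
    ... | yes q = j≤i
    ... | no ¬q = leastFrom-least P (suc j) f i (ℕ.≤∧≢⇒< j≤i λ { ≡.refl → ¬q p }) p

  ⌈⌉-ub x = leastFrom-satisfies (λ k → x ≤ fromℕ k) 0 (proj₁ (archimedean x))
    (proj₂ (archimedean x))

  ⌈⌉-least : ∀ {x} k → x ≤ fromℕ k → ⌈ x ⌉ ℕ.≤ k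
  ⌈⌉-least {x} k p = leastFrom-least (λ k → x ≤ fromℕ k) 0 (proj₁ (archimedean x)) k ℕ.z≤n p

  ⌊⌋-ub x with archimedean x
  ... | k , p = leastFrom-satisfies (λ k → x < fromℕ (suc k)) 0 k
    (<-via (0<1 ⊞ p) (solve 2 (λ x v1 → :1 :+ v1 :- x := :1 :+ v1 :- (:0 :+ x)) R.refl x (fromℕ k)))

  ⌊⌋-least : ∀ {x} k → x < fromℕ (suc k) → ⌊ x ⌋ ℕ.≤ k
  ⌊⌋-least {x} k p = leastFrom-least (λ k → x < fromℕ (suc k)) 0 (proj₁ (archimedean x)) k ℕ.z≤n p

  ⌊⌋-lb : ∀ {x} → 0# ≤ x → fromℕ ⌊ x ⌋ ≤ x
  ⌊⌋-lb {x} p = go ⌊ x ⌋ ≡.refl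
    where
    go : ∀ k → k ≡ ⌊ x ⌋ → fromℕ k ≤ x
    go zero    e = p
    go (suc k) e = ≮⇒≥ λ q → ℕ.1+n≰n (≡.subst (ℕ._≤ k) (≡.sym e) (⌊⌋-least k q))

  ⌈⌉-cong : ∀ {x y} → x ≈ y → ⌈ x ⌉ ≡ ⌈ y ⌉
  ⌈⌉-cong {x} {y} e = ℕ.≤-antisym (⌈⌉-least _ (≤.trans (≤.reflexive e) (⌈⌉-ub y)))
                                   (⌈⌉-least _ (≤.trans (≤.reflexive (R.sym e)) (⌈⌉-ub x)))

  ⌈⌉-mono : ∀ {x y} → x ≤ y → ⌈ x ⌉ ℕ.≤ ⌈ y ⌉
  ⌈⌉-mono {x} {y} p = ⌈⌉-least _ (≤.trans p (⌈⌉-ub y))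

  ⌈⌉-lb : ∀ {x} → 0# ≤ x → fromℕ ⌈ x ⌉ < x + 1#
  ⌈⌉-lb {x} p = go ⌈ x ⌉ ≡.refl
    where
    go : ∀ k → k ≡ ⌈ x ⌉ → fromℕ k < x + 1#
    go zero    e = <-via (0<1 ⊞ p) (solve 1 (λ x → x :+ :1 :- :0 := :1 :+ x :- (:0 :+ :0)) R.refl x)
    go (suc k) e = <-via h (solve 2 (λ v1 x → x :+ :1 :- (:1 :+ v1) := x :- v1) R.refl (fromℕ k) x)
      where
      h : fromℕ k < x
      h = ≰⇒> λ q → ℕ.1+n≰n (≡.subst (ℕ._≤ k) (≡.sym e) (⌈⌉-least k q))

  ⌈⌉-unique : ∀ {x k} → fromℕ k < x → x ≤ fromℕ (suc k) → ⌈ x ⌉ ≡ suc k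
  ⌈⌉-unique {x} {k} p q = ℕ.≤-antisym (⌈⌉-least (suc k) q) (fromℕ-cancel-< (<-≤-trans p (⌈⌉-ub x)))

  ⌈fromℕ⌉ : ∀ k → ⌈ fromℕ k ⌉ ≡ k
  ⌈fromℕ⌉ k = ℕ.≤-antisym (⌈⌉-least k ≤.refl) (fromℕ-cancel-≤ (⌈⌉-ub (fromℕ k)))

  -- Limits

  infix 4 _◁_ _⇝_

  -- An absolute-value bound split into two inequalities, which keeps the maximum of `∣_∣` out of
  -- the linear certificates. Convergence is handled in this form and translated only at the end.
  _◁_ : Carrier → Carrier → Set
  x ◁ a = - a ≤ x × x ≤ a

  ◁-cong : ∀ {x y a} → x ≈ y → x ◁ a → y ◁ a
  ◁-cong e (p , q) = ≤-resp R.refl e p , ≤-resp e R.refl q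

  ◁-mono : ∀ {x a b} → a ≤ b → x ◁ a → x ◁ b
  ◁-mono {x} {a} {b} a≤b (p , q) = (≤-via (a≤b ⊕ p) (solve 3
    (λ a b x → x :- (:- b) := b :+ x :- (a :+ (:- a))) R.refl a b x)) , ≤.trans q a≤b

  ◁-+ : ∀ {x y a b} → x ◁ a → y ◁ b → x + y ◁ a + b
  ◁-+ {x} {y} {a} {b} (p , q) (p′ , q′) = (≤-via (p ⊕ p′)
    (solve 4 (λ a x b y → x :+ y :- (:- (a :+ b)) := x :+ y :- ((:- a) :+ (:- b))) R.refl a x b y))
    , q ⊕ q′

  ◁-- : ∀ {x a} → x ◁ a → - x ◁ a
  ◁-- {x} {a} (p , q) = (≤-via q (solve 2 (λ x a → (:- x) :- (:- a) := a :- x) R.refl x a)) ,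
    (≤-via p (solve 2 (λ a x → a :- (:- x) := x :- (:- a)) R.refl a x))

  *-diff-nonneg : ∀ {a b c d} → a ≤ b → c ≤ d → 0# ≤ (b - a) * (d - c)
  *-diff-nonneg p q = *-nonneg (≤-shift p) (≤-shift q)

  -- Twice a b + x y is (x + a)(y + b) + (a - x)(b - y), and twice a b - x y is (x + a)(b - y) + (a
  -- - x)(y + b); all factors are nonnegative.
  ◁-* : ∀ {x y a b} → x ◁ a → y ◁ b → x * y ◁ a * b
  ◁-* {x} {y} {a} {b} (p , q) (p′ , q′) =
    (≤-by 1 ((*-diff-nonneg p p′) ⊕ (*-diff-nonneg q q′))
      (solve 4 (λ x a y b → (con (+ 2)) :* (x :* y :- (:- (a :* b))) :=
      (x :- (:- a)) :* (y :- (:- b)) :+ (a :- x) :* (b :- y) :- (:0 :+ :0)) R.refl x a y b)) ,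
    (≤-by 1 ((*-diff-nonneg p q′) ⊕ (*-diff-nonneg q p′))
      (solve 4 (λ x a b y → (con (+ 2)) :* (a :* b :- x :* y) :=
      (x :- (:- a)) :* (b :- y) :+ (a :- x) :* (y :- (:- b)) :- (:0 :+ :0)) R.refl x a b y))

  ◁-bound : ∀ x → ∃ λ a → 0# ≤ a × x ◁ a
  ◁-bound x with ≤.total 0# x
  ... | inj₁ p = x , p , (≤-via (1 ⊛ p) (solve 1 (λ x → x :- (:- x) :=
    (con (+ 2)) :* x :- (con (+ 2)) :* :0) R.refl x)) , ≤.refl
  ... | inj₂ p = - x , (≤-via p (solve 1 (λ x → (:- x) :- :0 := :0 :- x) R.refl x)) ,
    (≤-via (≤.reflexive (R.refl {0#})) (solve 1 (λ x → x :- (:- (:- x)) := :0 :- :0) R.refl x)) ,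
    (≤-via (1 ⊛ p) (solve 1 (λ x → (:- x) :- x := (con (+ 2)) :* :0 :- (con (+ 2)) :* x) R.refl x))

  Eventually : (ℕ → Set) → Set
  Eventually P = ∃ λ N → ∀ n → N ℕ.≤ n → P n

  ev-map : ∀ {P Q : ℕ → Set} → (∀ n → P n → Q n) → Eventually P → Eventually Q
  ev-map f (N , p) = N , λ n N≤n → f n (p n N≤n)

  infixr 6 _∩_
  _∩_ : ∀ {P Q : ℕ → Set} → Eventually P → Eventually Q → Eventually (λ n → P n × Q n)
  (M , p) ∩ (N , q) = M ℕ.⊔ N , λ n h → p n (ℕ.m⊔n≤o⇒m≤o M N h) , q n (ℕ.m⊔n≤o⇒n≤o M N h)

  _⇝_ : (ℕ → Carrier) → Carrier → Set
  s ⇝ L = ∀ ε → 0# < ε → Eventually (λ n → s n - L ◁ ε)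

  ⇝⇒⟶ : ∀ {s L} → s ⇝ L → s ⟶ L
  ⇝⇒⟶ {s} {L} h ε ε>0 = ev-map f (h δ δ>0)
    where
    δ = proj₁ (half ε>0)
    δ>0 = proj₁ (proj₂ (half ε>0))
    e = proj₂ (proj₂ (half ε>0))
    f : ∀ n → s n - L ◁ δ → ∣ s n - L ∣ < ε
    f n (p , q) = ≤-<-trans (⊔-lub q (≤-via p (solve 3 (λ δ v1 L → δ :- (:- (v1 :- L)) :=
      v1 :- L :- (:- δ)) R.refl δ (s n) L)))
                            (<-via (δ>0 ⊞ (≤.reflexive e))
                              (solve 2 (λ δ ε → ε :- δ := δ :+ ε :- (:0 :+ :2 :* δ)) R.refl δ ε))

  ⟶⇒⇝ : ∀ {s L} → s ⟶ L → s ⇝ L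
  ⟶⇒⇝ {s} {L} h ε ε>0 = ev-map f (h ε ε>0)
    where
    f : ∀ n → ∣ s n - L ∣ < ε → s n - L ◁ ε
    f n (p , _) = (≤-via (≤.trans (⊔-ub₂ _ _) p) (solve 3
      (λ v1 L ε → v1 :- L :- (:- ε) := ε :- (:- (v1 :- L))) R.refl (s n) L ε)) , ≤.trans (⊔-ub₁ _ _)
      p

  ⇝-const : ∀ L → (λ _ → L) ⇝ L
  ⇝-const L ε ε>0 = 0 , λ _ _ → (≤-via (proj₁ ε>0) (solve 2 (λ ε L → L :- L :- (:- ε) := ε :- :0)
    R.refl ε L)) , (≤-via (proj₁ ε>0) (solve 2 (λ ε L → ε :- (L :- L) := ε :- :0) R.refl ε L))

  ⇝-cong : ∀ {s t L} → Eventually (λ n → s n ≈ t n) → s ⇝ L → t ⇝ L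
  ⇝-cong e h ε ε>0 = ev-map (λ n (p , q) → ◁-cong (+-congʳ p) q) (e ∩ h ε ε>0)

  ⇝-resp : ∀ {s L M} → L ≈ M → s ⇝ L → s ⇝ M
  ⇝-resp e h ε ε>0 = ev-map (λ n → ◁-cong (+-congˡ (-‿cong e))) (h ε ε>0)

  ⇝-+ : ∀ {s t L M} → s ⇝ L → t ⇝ M → (λ n → s n + t n) ⇝ L + M
  ⇝-+ {s} {t} {L} {M} h k ε ε>0 =
    let δ , δ>0 , e = half ε>0 in ev-map (λ n (p , q) → ◁-cong
          (solve 4 (λ v1 L v2 M → v1 :- L :+ (v2 :- M) := v1 :+ v2 :- (L :+ M)) R.refl (s n) L (t n)
          M)
                        (◁-mono (≤-via (≤.reflexive e) (solve 2
                          (λ δ ε → ε :- (δ :+ δ) := ε :- :2 :* δ) R.refl δ ε)) (◁-+ p q)))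
                          (h δ δ>0 ∩ k δ δ>0)

  ⇝-squeeze : ∀ {s u L} → Eventually (λ n → s n - L ◁ u n) → u ⇝ 0# → s ⇝ L
  ⇝-squeeze {s} {u} {L} h k ε ε>0 =
    ev-map (λ n (p , _ , q) → ◁-mono (≤-via q (solve 2 (λ v1 ε → ε :- v1 := ε :- (v1 :- :0)) R.refl
      (u n) ε)) p) (h ∩ k ε ε>0)

  ⇝-* : ∀ {s t L M} → s ⇝ L → t ⇝ M → (λ n → s n * t n) ⇝ L * M
  ⇝-* {s} {t} {L} {M} h k ε ε>0 with ◁-bound L | ◁-bound M
  ... | a , a≥0 , L◁a | b , b≥0 , M◁b =
    ev-map (λ n (p , q) → ◁-cong (solve 4 (λ v1 L v2 M →
      (v1 :- L) :* (v2 :- M) :+ L :* (v2 :- M) :+ (v1 :- L) :* M := v1 :* v2 :- L :* M) R.refl (s n)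
      L (t n) M)
             (◁-mono small (◁-+ (◁-+ (◁-* p q) (◁-* L◁a q)) (◁-* p M◁b)))) (h δ δ>0 ∩ k δ δ>0)
    where
    -- With this denominator δ ≤ 1 and δ (1 + a + b) ≤ ε, which together bound δ² + a δ + δ b.
    d = 1# + a + b + ε
    d>0 : 0# < d
    d>0 = <-via (ε>0 ⊞ a≥0 ⊞ b≥0 ⊞ (proj₁ 0<1)) (solve 3
      (λ a b ε → :1 :+ a :+ b :+ ε :- :0 := ε :+ a :+ b :+ :1 :- (:0 :+ :0 :+ :0 :+ :0)) R.refl a b
      ε)
    δ = ε / d
    δ>0 = /-pos ε>0 d>0
    δ≤1 : δ ≤ 1#
    δ≤1 = /-≤ d>0 (≤-via (a≥0 ⊕ b≥0 ⊕ (proj₁ 0<1)) (solve 3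
      (λ a b ε → :1 :* (:1 :+ a :+ b :+ ε) :- ε := a :+ b :+ :1 :- (:0 :+ :0 :+ :0)) R.refl a b ε))
    small : δ * δ + a * δ + δ * b ≤ ε
    small = ≤-via ((≤.reflexive (/-cancel d>0)) ⊕ (*-nonneg (proj₁ δ>0) (≤-shift δ≤1)) ⊕
      (*-nonneg (proj₁ δ>0) (proj₁ ε>0))) (solve 4 (λ δ a b ε → ε :- (δ :* δ :+ a :* δ :+ δ :* b) :=
      ε :+ δ :* (:1 :- δ) :+ δ :* ε :- (δ :* (:1 :+ a :+ b :+ ε) :+ :0 :+ :0)) R.refl δ a b ε)

  ⇝-scale : ∀ {s L} c → s ⇝ L → (λ n → c * s n) ⇝ c * L
  ⇝-scale c h = ⇝-* (⇝-const c) h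

  ⇝-neg : ∀ {s L} → s ⇝ L → (λ n → - s n) ⇝ - L
  ⇝-neg {s} {L} h ε ε>0 = ev-map (λ n p → ◁-cong (solve 2
    (λ v1 L → (:- (v1 :- L)) := (:- v1) :- (:- L)) R.refl (s n) L) (◁-- p)) (h ε ε>0)

  ⇝-upper : ∀ {s L a} → s ⇝ L → L < a → Eventually (λ n → s n < a)
  ⇝-upper {s} {L} {a} h p =
    let δ , δ>0 , e = half (<-shift p) in ev-map (λ n (_ , q) →
          (<-via (δ>0 ⊞ q ⊞ (≤.reflexive e)) (solve 4 (λ v1 L δ a → a :- v1 :=
          δ :+ δ :+ (a :- L) :- (:0 :+ (v1 :- L) :+ :2 :* δ)) R.refl (s n) L δ a))) (h δ δ>0)

  ⇝-lower : ∀ {s L a} → s ⇝ L → a < L → Eventually (λ n → a < s n)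
  ⇝-lower {s} {L} {a} h p =
    let δ , δ>0 , e = half (<-shift p) in ev-map (λ n (q , _) →
          (<-via (δ>0 ⊞ q ⊞ (≤.reflexive e)) (solve 4 (λ δ v1 L a → v1 :- a :=
          δ :+ (v1 :- L) :+ (L :- a) :- (:0 :+ (:- δ) :+ :2 :* δ)) R.refl δ (s n) L a))) (h δ δ>0)

  -- Eventually s > L / 2, hence 1 / s ≤ 2 / L, and the difference (L - s) / (s L) of the inverses
  -- is at most 2 / L² times the distance of s from L.
  ⇝-inv : ∀ {s L} → s ⇝ L → 0# < L → (λ n → s n ⁻¹) ⇝ L ⁻¹
  ⇝-inv {s} {L} h L>0 = ⇝-squeeze
    (ev-map bound (⇝-lower h L/2<L))
    (⇝-resp (solve 1 (λ i → :2 :* i :* i :* (:- :0) := :0) R.refl i)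
      (⇝-cong (0 , λ n _ → R.refl) (⇝-scale (fromℕ 2 * i * i) (absolute h))))
    where
    i = L ⁻¹
    i>0 = inv-pos L>0
    δ = proj₁ (half L>0)
    δ>0 = proj₁ (proj₂ (half L>0))
    2δ≈L = proj₂ (proj₂ (half L>0))
    L/2<L : δ < L
    L/2<L = <-via (δ>0 ⊞ (≤.reflexive 2δ≈L)) (solve 2 (λ δ L → L :- δ := δ :+ L :- (:0 :+ :2 :* δ))
      R.refl δ L)
    absolute : s ⇝ L → (λ n → ∣ s n - L ∣) ⇝ - 0#
    absolute h ε ε>0 = ev-map (λ n (p , q) →
        (≤-by 1 ((≤.trans (⊔-ub₁ _ _ ⊕ ⊔-ub₂ _ _) (≤.refl)) ⊕ (1 ⊛ (proj₁ ε>0)))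
          (solve 4 (λ v1 L v2 ε → (con (+ 2)) :* (v2 :- (:- :0) :- (:- ε)) :=
          v2 :+ v2 :+ (con (+ 2)) :* ε :- (v1 :- L :+ (:- (v1 :- L)) :+ (con (+ 2)) :* :0)) R.refl
          (s n) L (∣ s n - L ∣) ε)) ,
        (≤-via (⊔-lub q (≤-via p (solve 3 (λ ε v1 L → ε :- (:- (v1 :- L)) := v1 :- L :- (:- ε))
          R.refl ε (s n) L))) (solve 2 (λ v1 ε → ε :- (v1 :- (:- :0)) := ε :- v1) R.refl
          (∣ s n - L ∣) ε))) (h ε ε>0)
    bound : ∀ n → δ < s n → s n ⁻¹ - i ◁ fromℕ 2 * i * i * ∣ s n - L ∣
    bound n p = ◁-cong eq (◁-mono le (◁-* (◁-* d◁ ((≤-via (1 ⊛ (proj₁ r>0))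
      (solve 1 (λ r → r :- (:- r) := (con (+ 2)) :* r :- (con (+ 2)) :* :0) R.refl r)) , ≤.refl
      {x = r})) ((≤-via (1 ⊛ (proj₁ i>0)) (solve 1 (λ i → i :- (:- i) :=
      (con (+ 2)) :* i :- (con (+ 2)) :* :0) R.refl i)) , ≤.refl {x = i})))
      where
      r = s n ⁻¹
      sn>0 = <-trans δ>0 p
      r>0 = inv-pos sn>0
      D = ∣ s n - L ∣
      d◁ : L - s n ◁ D
      d◁ = (≤-via (⊔-ub₁ _ _) (solve 3 (λ v1 L D → L :- v1 :- (:- D) := D :- (v1 :- L)) R.refl (s n)
        L D)) , (≤-via (⊔-ub₂ _ _) (solve 3 (λ v1 L D → D :- (L :- v1) := D :- (:- (v1 :- L)))
        R.refl (s n) L D))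
      D≥0 : 0# ≤ D
      D≥0 = ≤-by 1 ((⊔-ub₁ _ _) ⊕ (⊔-ub₂ _ _)) (solve 3 (λ v1 L D → (con (+ 2)) :* (D :- :0) :=
        D :+ D :- (v1 :- L :+ (:- (v1 :- L)))) R.refl (s n) L D)
      r≤2i : r ≤ fromℕ 2 * i
      r≤2i = cancel-≤ sn>0 (cancel-≤ L>0 (≤-via ((≤.reflexive (R.*-congˡ {L} (inv-cancel sn>0))) ⊕
        (≤.reflexive (R.sym (R.*-congˡ {fromℕ 2 * s n} (inv-cancel L>0)))) ⊕ (1 ⊛ (proj₁ p)) ⊕
        (≤.reflexive (R.sym 2δ≈L))) (solve 5 (λ v1 r L i δ →
        L :* (v1 :* (:2 :* i)) :- L :* (v1 :* r) := L :* :1 :+ :2 :* v1 :* (L :* i) :+ (con (+ 2))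
        :* v1 :+ :2 :* δ :- (L :* (v1 :* r) :+ :2 :* v1 :* :1 :+ (con (+ 2)) :* δ :+ L)) R.refl
        (s n) r L i δ)))
      eq : (L - s n) * r * i ≈ r - i
      eq = ≈-via ((R.*-congˡ {r} (inv-cancel L>0)) ⊕≈ (R.sym (R.*-congˡ {i} (inv-cancel sn>0))))
        (solve 4 (λ r L i v1 → r :- i :- (L :- v1) :* r :* i :=
        r :* :1 :+ i :* (v1 :* r) :- (r :* (L :* i) :+ i :* :1)) R.refl r L i (s n))
      le : D * r * i ≤ fromℕ 2 * i * i * D
      le = ≤-via (*-nonneg (*-nonneg D≥0 (proj₁ i>0)) (≤-shift r≤2i))
        (solve 3 (λ D i r → :2 :* i :* i :* D :- D :* r :* i := D :* i :* (:2 :* i :- r) :- :0)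
        R.refl D i r)

  ⇝-/ : ∀ {s t L M} → s ⇝ L → t ⇝ M → 0# < M → (λ n → s n / t n) ⇝ L / M
  ⇝-/ h k M>0 = ⇝-* h (⇝-inv k M>0)

  inv-∞ : ∀ {s : ℕ → Carrier} → (∀ M → Eventually (λ n → M < s n)) → (λ n → s n ⁻¹) ⇝ 0#
  inv-∞ {s} h ε ε>0 = ev-map f (h (ε ⁻¹))
    where
    e>0 = inv-pos ε>0
    f : ∀ n → ε ⁻¹ < s n → s n ⁻¹ - 0# ◁ ε
    f n p = (≤-via ((proj₁ (inv-pos sn>0)) ⊕ (proj₁ ε>0))
      (solve 2 (λ v1 ε → v1 :- :0 :- (:- ε) := v1 :+ ε :- (:0 :+ :0)) R.refl (s n ⁻¹) ε)) ,
      (≤-via le (solve 2 (λ v1 ε → ε :- (v1 :- :0) := ε :- v1) R.refl (s n ⁻¹) ε))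
      where
      sn>0 = <-trans e>0 p
      le : s n ⁻¹ ≤ ε
      le = cancel-≤ sn>0 (≤-via ((≤.reflexive (inv-cancel sn>0)) ⊕
        (≤.reflexive (R.sym (inv-cancel ε>0))) ⊕ (*-monoˡ (proj₁ ε>0) (proj₁ p)))
        (solve 4 (λ v1 v2 ε v3 → v1 :* ε :- v1 :* v2 := :1 :+ ε :* v3 :+ ε :* v1 :-
        (v1 :* v2 :+ :1 :+ ε :* v3)) R.refl (s n) (s n ⁻¹) ε (ε ⁻¹)))

  -- Consequences of completeness: Cauchy sequences and inverse values

  Cauchy : (ℕ → Carrier) → Set
  Cauchy s = ∀ ε → 0# < ε → ∃ λ N → ∀ m n → N ℕ.≤ m → N ℕ.≤ n → s m - s n ≤ ε

  -- Completeness speaks of sets, so the limit is taken as the supremum of the numbers that are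
  -- eventually below the sequence, its lower limit.
  cauchy-converges : ∀ {s} → Cauchy s → ∃ λ L → s ⇝ L
  cauchy-converges {s} cauchy = L , conv
    where
    S : Carrier → Set
    S y = Eventually (λ n → y ≤ s n)

    below : ∀ {ε N n} → (∀ m n → N ℕ.≤ m → N ℕ.≤ n → s m - s n ≤ ε) → N ℕ.≤ n → S (s n - ε)
    below {ε} {N} {n} h N≤n = N , λ m N≤m → (≤-via (h n m N≤n N≤m)
      (solve 3 (λ v1 v2 ε → v2 :- (v1 :- ε) := ε :- (v1 :- v2)) R.refl (s n) (s m) ε))

    above : ∀ {ε N n} → (∀ m n → N ℕ.≤ m → N ℕ.≤ n → s m - s n ≤ ε) → N ℕ.≤ n → ∀ y → S y → y ≤ s n
      + ε
    above {ε} {N} {n} h N≤n y (M , k) =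
      (≤-via ((k _ (ℕ.m≤m⊔n M N)) ⊕ (h (M ℕ.⊔ N) n (ℕ.m≤n⊔m M N) N≤n))
        (solve 4 (λ y v1 v2 ε → v2 :+ ε :- y := v1 :+ ε :- (y :+ (v1 :- v2))) R.refl y (s (M ℕ.⊔ N))
        (s n) ε))

    first = cauchy 1# 0<1
    sup = complete S (_ , below (proj₂ first) ℕ.≤-refl) (_ , above (proj₂ first) ℕ.≤-refl)
    L = proj₁ sup

    conv : s ⇝ L
    conv ε ε>0 = let N , h = cauchy ε ε>0 in N , λ n N≤n →
      (≤-via (proj₂ (proj₂ sup) _ (above h N≤n)) (solve 3
        (λ L v1 ε → v1 :- L :- (:- ε) := v1 :+ ε :- L) R.refl L (s n) ε)) ,
      (≤-via (proj₁ (proj₂ sup) _ (below h N≤n)) (solve 3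
        (λ v1 ε L → ε :- (v1 :- L) := L :- (v1 :- ε)) R.refl (s n) ε L))

  -- Stated for nonnegative arguments only, the heights that occur. The Lipschitz bound stands in
  -- for continuity, and strict growth makes the inverse well defined and continuous.
  module StrictlyIncreasing (P : Carrier → Carrier)
    (P-< : ∀ {x y} → 0# ≤ x → x < y → P x < P y)
    (P-lipschitz : ∀ {x y} → 0# ≤ x → x < y → P y - P x ≤ y - x)
    (P-cong : ∀ {x y} → x ≈ y → P x ≈ P y)
    where

    P-≤ : ∀ {x y} → 0# ≤ x → x ≤ y → P x ≤ P y
    P-≤ {x} {y} p q with y ≤⊎> x
    ... | inj₁ r = ≤.reflexive (P-cong (≤.antisym q r))
    ... | inj₂ r = proj₁ (P-< p r)

    P-cancel-≤ : ∀ {x y} → 0# ≤ y → P x ≤ P y → x ≤ y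
    P-cancel-≤ p q = ≮⇒≥ λ r → <⇒≱ (P-< p r) q

    P-injective : ∀ {x y} → 0# ≤ x → 0# ≤ y → P x ≈ P y → x ≈ y
    P-injective p q e = ≤.antisym (P-cancel-≤ q (≤.reflexive e))
      (P-cancel-≤ p (≤.reflexive (R.sym e)))

    -- Take the supremum s of the y ≤ b with P y ≤ r. The Lipschitz bound says that moving by the
    -- defect r - P s, up or down, cannot overshoot r; so a positive defect would put a larger point
    -- into the set (or force r > P b), and a negative one would give a smaller upper bound.
    P-surjective : ∀ {r b} → 0# ≤ b → P 0# ≤ r → r ≤ P b → ∃ λ y → 0# ≤ y × P y ≈ r
    P-surjective {r} {b} b≥0 P0≤r r≤Pb = s , s≥0 , ≤.antisym (≮⇒≥ not-above) (≮⇒≥ not-below)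
      where
      S : Carrier → Set
      S y = 0# ≤ y × y ≤ b × P y ≤ r

      sup = complete S (0# , ≤.refl , b≥0 , P0≤r) (b , λ _ h → proj₁ (proj₂ h))
      s = proj₁ sup
      ub = proj₁ (proj₂ sup)
      least′ = proj₂ (proj₂ sup)
      s≥0 = ub 0# (≤.refl , b≥0 , P0≤r)
      s≤b = least′ b λ _ h → proj₁ (proj₂ h)

      not-below : ¬ P s < r
      not-below p with (s + (r - P s)) ≤⊎> b
      ... | inj₁ q = (⊥-by (p ⊞ (ub _ ((≤-via (s≥0 ⊕ (proj₁ p))
        (solve 3 (λ s v1 r → s :+ (r :- v1) :- :0 := s :+ r :- (:0 :+ v1)) R.refl s (P s) r)) , q ,
                         (≤-via (P-lipschitz s≥0 lt) (solve 4
                           (λ v1 v2 s r → r :- v1 := s :+ (r :- v2) :- s :- (v1 :- v2)) R.refl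
                           (P (s + (r - P s))) (P s) s r)))))
                           (solve 3 (λ s r v1 → v1 :+ (s :+ (r :- v1)) := r :+ s) R.refl s r (P s)))
        where
        lt : s < s + (r - P s)
        lt = <-via p (solve 3 (λ v1 r s → s :+ (r :- v1) :- s := r :- v1) R.refl (P s) r s)
      ... | inj₂ q with b ≤⊎> s
      ...   | inj₁ b≤s = <⇒≱ p (≤.trans r≤Pb (P-≤ b≥0 b≤s))
      ...   | inj₂ s<b = ⊥-by (q ⊞ (P-lipschitz s≥0 s<b) ⊞ r≤Pb)
        (solve 5 (λ b s r v1 v2 → b :+ (v2 :- v1) :+ r := s :+ (r :- v1) :+ (b :- s) :+ v2) R.refl b
        s r (P s) (P b))

      not-above : ¬ r < P s
      not-above p = ⊥-by (p ⊞ (least′ (s - (P s - r)) (λ y h → ≮⇒≥ (bounded y h))))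
        (solve 3 (λ s v1 r → r :+ s := v1 :+ (s :- (v1 :- r))) R.refl s (P s) r)
        where
        bounded : ∀ y → S y → ¬ s - (P s - r) < y
        bounded y h@(y≥0 , _ , Py≤r) q with s ≤⊎> y
        ... | inj₁ s≤y = <⇒≱ p (≤.trans (P-≤ s≥0 s≤y) Py≤r)
        ... | inj₂ y<s = ⊥-by (q ⊞ (P-lipschitz y≥0 y<s) ⊞ Py≤r)
          (solve 5 (λ v1 v2 s y r → s :- (v1 :- r) :+ (v1 :- v2) :+ v2 := y :+ (s :- y) :+ r) R.refl
          (P s) (P y) s y r)

    P-reflects-⇝ : ∀ {s a} → 0# ≤ a → Eventually (λ n → 0# ≤ s n) → (λ n → P (s n)) ⇝ P a → s ⇝ a
    P-reflects-⇝ {s} {a} a≥0 s≥0 h ε ε>0 = ev-map (λ n (p , q) → p , q) (lower ∩ upper)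
      where
      upper : Eventually (λ n → s n - a ≤ ε)
      upper = ev-map (λ n p → ≮⇒≥ λ q → <⇒≱ p (P-≤ (≤-via (a≥0 ⊕ (proj₁ ε>0))
        (solve 2 (λ a ε → a :+ ε :- :0 := a :+ ε :- (:0 :+ :0)) R.refl a ε))
        (≤-via (proj₁ q) (solve 3 (λ ε v1 a → v1 :- (a :+ ε) := v1 :- a :- ε) R.refl ε (s n) a))))
        (⇝-upper h (P-< {a} {a + ε} a≥0 (<-via ε>0 (solve 2 (λ ε a → a :+ ε :- a := ε :- :0) R.refl
          ε a))))

      lower : Eventually (λ n → - ε ≤ s n - a)
      -- For a ≤ ε the point a - ε may leave the domain where P is known to increase; there
      -- nonnegativity of s already gives the bound.
      lower with a ≤⊎> ε
      ... | inj₁ a≤ε = ev-map (λ n p → (≤-via (p ⊕ a≤ε) (solve 3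
        (λ v1 a ε → v1 :- a :- (:- ε) := v1 :+ ε :- (:0 :+ a)) R.refl (s n) a ε))) s≥0
      ... | inj₂ ε<a = ev-map (λ n (s≥0 , p) → ≮⇒≥ λ q → <⇒≱ p
        (P-≤ s≥0 (≤-via (proj₁ q) (solve 3 (λ v1 a ε → a :- ε :- v1 := (:- ε) :- (v1 :- a)) R.refl
        (s n) a ε))))
        (s≥0 ∩ ⇝-lower h (P-< {a - ε} {a} (≤-via (proj₁ ε<a)
          (solve 2 (λ ε a → a :- ε :- :0 := a :- ε) R.refl ε a))
          (<-via ε>0 (solve 2 (λ ε a → a :- (a :- ε) := ε :- :0) R.refl ε a))))

    P-continuous : ∀ {s a} → 0# ≤ a → Eventually (λ n → 0# ≤ s n) → s ⇝ a → (λ n → P (s n)) ⇝ P a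
    P-continuous {s} {a} a≥0 s≥0 h ε ε>0 = ev-map (λ n (p , q) → close p q) (s≥0 ∩ h ε ε>0)
      where
      close : ∀ {x} → 0# ≤ x → x - a ◁ ε → P x - P a ◁ ε
      close {x} x≥0 (p , q) with x ≤⊎> a | a ≤⊎> x
      ... | inj₂ a<x | _ = (≤-via ((proj₁ (P-< a≥0 a<x)) ⊕ (proj₁ ε>0))
        (solve 3 (λ v1 v2 ε → v2 :- v1 :- (:- ε) := v2 :+ ε :- (v1 :+ :0)) R.refl (P a) (P x) ε)) ,
        ≤.trans (P-lipschitz a≥0 a<x) q
      ... | inj₁ _ | inj₂ x<a = (≤-via ((P-lipschitz x≥0 x<a) ⊕ p)
        (solve 5 (λ v1 v2 a x ε → v2 :- v1 :- (:- ε) := a :- x :+ (x :- a) :- (v1 :- v2 :+ (:- ε)))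
        R.refl (P a) (P x) a x ε)) ,
                                (≤-via ((proj₁ (P-< x≥0 x<a)) ⊕ (proj₁ ε>0))
                                  (solve 3 (λ v1 v2 ε → ε :- (v1 :- v2) := v2 :+ ε :- (v1 :+ :0))
                                  R.refl (P x) (P a) ε))
      ... | inj₁ x≤a | inj₁ a≤x = let e = P-cong (≤.antisym x≤a a≤x) in
        (≤-via ((≤.reflexive (R.sym e)) ⊕ (proj₁ ε>0)) (solve 3
          (λ v1 v2 ε → v1 :- v2 :- (:- ε) := v1 :+ ε :- (v2 :+ :0)) R.refl (P x) (P a) ε)) ,
          (≤-via ((≤.reflexive e) ⊕ (proj₁ ε>0)) (solve 3
          (λ v1 v2 ε → ε :- (v1 :- v2) := v2 :+ ε :- (v1 :+ :0)) R.refl (P x) (P a) ε))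

  -- Potentials along a descent

  -- `G i` is a primitive used between the heights i and i + 1, so only its increments matter. The
  -- constants `V i` glue the pieces into one continuous function with value 0 at 0.
  module Potential (G : ℕ → Carrier → Carrier)
    (G-cong : ∀ i {x y} → x ≈ y → G i x ≈ G i y)
    (G-increment : ∀ i {x y} → fromℕ i ≤ x → x < y → y ≤ fromℕ (suc i) →
                   G i x < G i y × G i y - G i x ≤ y - x)
    where

    V : ℕ → Carrier
    V zero    = 0#
    V (suc i) = V i + (G i (fromℕ (suc i)) - G i (fromℕ i))

    section : ℕ → Carrier → Carrier
    section i y = V i + (G i y - G i (fromℕ i))

    -- An integer height is counted as the top end of its section, in accordance with speed ⌈ y ⌉;
    -- the truncated subtraction assigns y = 0 to section 0.
    P : Carrier → Carrier
    P y = section (⌈ y ⌉ ∸ 1) y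

    section-cong : ∀ i {x y} → x ≈ y → section i x ≈ section i y
    section-cong i e = +-congˡ (+-congʳ (G-cong i e))

    P-cong : ∀ {x y} → x ≈ y → P x ≈ P y
    P-cong {x} {y} e = R.trans (section-cong (⌈ x ⌉ ∸ 1) e)
      (R.reflexive (≡.cong (λ k → section (k ∸ 1) y) (⌈⌉-cong e)))

    P-fromℕ : ∀ i → P (fromℕ i) ≈ V i
    P-fromℕ i = R.trans (R.reflexive (≡.cong (λ k → section (k ∸ 1) (fromℕ i)) (⌈fromℕ⌉ i)))
      (lemma i)
      where
      lemma : ∀ i → section (i ∸ 1) (fromℕ i) ≈ V i
      lemma zero    = solve 1 (λ v1 → :0 :+ (v1 :- v1) := :0) R.refl (G 0 0#)
      lemma (suc i) = R.refl

    -- Adjacent pieces agree at the common integer, so each formula may be used on its closed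
    -- section.
    P-section : ∀ i {y} → fromℕ i ≤ y → y ≤ fromℕ (suc i) → P y ≈ section i y
    P-section i {y} p q with y ≤⊎> fromℕ i
    ... | inj₁ r = R.trans (P-cong e) (R.trans (P-fromℕ i)
            (R.trans (solve 2 (λ v1 v2 → v1 := v1 :+ (v2 :- v2)) R.refl (V i) (G i (fromℕ i)))
              (section-cong i (R.sym e))))
      where
      e : y ≈ fromℕ i
      e = ≤.antisym r p
    ... | inj₂ r = R.reflexive (≡.cong (λ k → section (k ∸ 1) y) (⌈⌉-unique r q))

    P-0 : P 0# ≈ 0#
    P-0 = P-fromℕ 0

    section-increment : ∀ i {x y} → fromℕ i ≤ x → x < y → y ≤ fromℕ (suc i) → P y - P x ≈ G i y - G
      i x
    section-increment i {x} {y} p q r = 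
      (≈-via ((P-section i (≤.trans p (proj₁ q)) r) ⊕≈ (R.sym
        (P-section i p (≤.trans (proj₁ q) r)))) (solve 6
        (λ v1 v2 v3 v4 v5 v6 → v3 :- v6 :- (v1 :- v5) :=
        v2 :+ (v3 :- v4) :+ v5 :- (v1 :+ (v2 :+ (v6 :- v4)))) R.refl (P y) (V i) (G i y)
        (G i (fromℕ i)) (P x) (G i x)))

    private
      Increment : Carrier → Carrier → Set
      Increment x y = P x < P y × P y - P x ≤ y - x

      local : ∀ i {x y} → fromℕ i ≤ x → x < y → y ≤ fromℕ (suc i) → Increment x y
      local i {x} {y} p q r =
        (<-via ((proj₁ (G-increment i p q r)) ⊞ (≤.reflexive (R.sym e)))
          (solve 4 (λ v1 v2 v3 v4 → v1 :- v2 := v3 :+ (v1 :- v2) :- (v4 :+ (v3 :- v4))) R.refl (P y)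
          (P x) (G i y) (G i x))) ,
        (≤-via ((≤.reflexive e) ⊕ (proj₂ (G-increment i p q r)))
          (solve 6 (λ v1 v2 v3 v4 y x → y :- x :- (v1 :- v2) :=
          v3 :- v4 :+ (y :- x) :- (v1 :- v2 :+ (v3 :- v4))) R.refl (P y) (P x) (G i y) (G i x) y x))
        where e = section-increment i p q r

      join : ∀ {x y z} → Increment x y → Increment y z → Increment x z
      join {x} {y} {z} (p , p′) (q , q′) = <-trans p q ,
        (≤-via (p′ ⊕ q′) (solve 6 (λ v1 v2 y x v3 z → z :- x :- (v3 :- v2) :=
          y :- x :+ (z :- y) :- (v1 :- v2 :+ (v3 :- v1))) R.refl (P y) (P x) y x (P z) z))

      increment : ∀ j {x y} → 0# ≤ x → x < y → y ≤ fromℕ j → Increment x y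
      increment zero    p q r = ⊥-elim (<⇒≱ (≤-<-trans p q) r)
      increment (suc i) {x} {y} p q r with y ≤⊎> fromℕ i
      ... | inj₁ y≤i = increment i p q y≤i
      ... | inj₂ i<y with fromℕ i ≤⊎> x
      ...   | inj₁ i≤x = local i i≤x q r
      ...   | inj₂ x<i = join (increment i p x<i ≤.refl) (local i ≤.refl i<y r)

    P-< : ∀ {x y} → 0# ≤ x → x < y → P x < P y
    P-< {y = y} p q = proj₁ (increment ⌈ y ⌉ p q (⌈⌉-ub y))

    P-lipschitz : ∀ {x y} → 0# ≤ x → x < y → P y - P x ≤ y - x
    P-lipschitz {y = y} p q = proj₂ (increment ⌈ y ⌉ p q (⌈⌉-ub y))

    open StrictlyIncreasing P P-< P-lipschitz P-cong public

    P-nonneg : ∀ {x} → 0# ≤ x → 0# ≤ P x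
    P-nonneg p = ≤-resp P-0 R.refl (P-≤ ≤.refl p)

    -- The second error term telescopes; it pays for the steps that cross an integer height.
    P-step : ∀ {q y y′ w B} → 0# ≤ y′ → 0# < q → 0# < y → y′ ≈ y - q * fromℕ ⌈ y ⌉ → fromℕ ⌈ y ⌉ ≤
      B →
             0# ≤ w → w ≤ B →
             (∀ i {x} → fromℕ i ≤ x → x < y → y ≤ fromℕ (suc i) → y - x ≈ q * fromℕ (suc i) →
                G i y - G i x - q * w ◁ q * q * fromℕ (suc i)) →
             P y - P y′ - q * w ◁ q * q * B + q * B * (fromℕ ⌈ y ⌉ - fromℕ ⌈ y′ ⌉)
    P-step {q} {y} {y′} {w} {B} y′≥0 q>0 y>0 e ⌈y⌉≤B w≥0 w≤B law = go ⌈ y ⌉ ≡.refl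
      where
      Y = fromℕ ⌈ y ⌉
      q≥0 = proj₁ q>0
      Y>0 : 0# < Y
      Y>0 = <-≤-trans y>0 (⌈⌉-ub y)
      B≥0 = ≤.trans (proj₁ Y>0) ⌈y⌉≤B
      y′<y : y′ < y
      y′<y = <-via ((*-pos q>0 Y>0) ⊞ (≤.reflexive e)) (solve 4
        (λ y′ y q Y → y :- y′ := q :* Y :+ (y :- q :* Y) :- (:0 :+ y′)) R.refl y′ y q Y)

      go : ∀ j → j ≡ ⌈ y ⌉ → P y - P y′ - q * w ◁ q * q * B + q * B * (Y - fromℕ ⌈ y′ ⌉)
      go zero    eq = ⊥-elim (<⇒≱ Y>0 (≤.reflexive (fromℕ-cong (≡.sym eq))))
      go (suc i) eq with fromℕ i ≤⊎> y′
      ... | inj₁ i≤y′ = ◁-mono bound (◁-cong (+-congʳ (R.sym (section-increment i i≤y′ y′<y y≤i+1)))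
                          (law i i≤y′ y′<y y≤i+1 drop))
        where
        Y≈ : fromℕ (suc i) ≈ Y
        Y≈ = fromℕ-cong eq
        y≤i+1 : y ≤ fromℕ (suc i)
        y≤i+1 = ≤.trans (⌈⌉-ub y) (≤.reflexive (R.sym Y≈))
        drop : y - y′ ≈ q * fromℕ (suc i)
        drop = ≈-via ((R.sym e) ⊕≈ (R.sym (R.*-congˡ {q} Y≈)))
          (solve 5 (λ y′ y q Y v1 → q :* v1 :- (y :- y′) :=
          y′ :+ q :* v1 :- (y :- q :* Y :+ q :* Y)) R.refl y′ y q Y (fromℕ (suc i)))
        bound : q * q * fromℕ (suc i) ≤ q * q * B + q * B * (Y - fromℕ ⌈ y′ ⌉)
        bound = ≤-via ((*-monoˡ (*-nonneg q≥0 q≥0) (≤.trans (≤.reflexive Y≈) ⌈y⌉≤B)) ⊕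
          (*-nonneg (*-nonneg q≥0 B≥0) (≤-shift (fromℕ-mono (⌈⌉-mono (proj₁ y′<y))))))
          (solve 5 (λ q v1 B Y v2 → q :* q :* B :+ q :* B :* (Y :- v2) :- q :* q :* v1 :=
          q :* q :* B :+ q :* B :* (Y :- v2) :- (q :* q :* v1 :+ :0)) R.refl q (fromℕ (suc i)) B Y
          (fromℕ ⌈ y′ ⌉))
      -- An integer has been crossed, so ⌈ y′ ⌉ ≤ ⌈ y ⌉ - 1 and the telescoping term alone is at
      -- least q B. That dominates both q w and the increment of P, which is at most y - y′ = q ⌈ y
      -- ⌉.
      ... | inj₂ y′<i =
        (≤-via ((proj₁ (P-< y′≥0 y′<y)) ⊕ qw ⊕ bound) (solve 7
          (λ v1 v2 q w B Y v3 → v2 :- v1 :- q :* w :- (:- (q :* q :* B :+ q :* B :* (Y :- v3))) :=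
          v2 :+ q :* B :+ (q :* q :* B :+ q :* B :* (Y :- v3)) :- (v1 :+ q :* w :+ q :* B)) R.refl
          (P y′) (P y) q w B Y (fromℕ ⌈ y′ ⌉))) ,
        (≤-via ((P-lipschitz y′≥0 y′<y) ⊕ (≤.reflexive (R.sym e)) ⊕ (*-monoˡ q≥0 ⌈y⌉≤B) ⊕
          (*-nonneg q≥0 w≥0) ⊕ bound) (solve 9 (λ v1 v2 y y′ q Y B w v3 →
          q :* q :* B :+ q :* B :* (Y :- v3) :- (v1 :- v2 :- q :* w) :=
          y :- y′ :+ y′ :+ q :* B :+ q :* w :+ (q :* q :* B :+ q :* B :* (Y :- v3)) :-
          (v1 :- v2 :+ (y :- q :* Y) :+ q :* Y :+ :0 :+ q :* B)) R.refl (P y) (P y′) y y′ q Y B w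
          (fromℕ ⌈ y′ ⌉)))
        where
        qw : q * w ≤ q * B
        qw = *-monoˡ q≥0 w≤B
        gap : fromℕ ⌈ y′ ⌉ ≤ Y - 1#
        gap = ≤-via ((fromℕ-mono (⌈⌉-least i (proj₁ y′<i))) ⊕ (≤.reflexive (fromℕ-cong eq)))
          (solve 3 (λ v1 v2 Y → Y :- :1 :- v1 := v2 :+ Y :- (v1 :+ (:1 :+ v2))) R.refl
          (fromℕ ⌈ y′ ⌉) (fromℕ i) Y)
        bound : q * B ≤ q * q * B + q * B * (Y - fromℕ ⌈ y′ ⌉)
        bound = ≤-via ((*-nonneg (*-nonneg q≥0 q≥0) B≥0) ⊕
          (*-nonneg (*-nonneg q≥0 B≥0) (≤-shift gap))) (solve 4
          (λ q B Y v1 → q :* q :* B :+ q :* B :* (Y :- v1) :- q :* B :=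
          q :* q :* B :+ q :* B :* (Y :- :1 :- v1) :- (:0 :+ :0)) R.refl q B Y (fromℕ ⌈ y′ ⌉))

  -- y / (i+1), the time needed to descend from height y at speed i+1.
  time : ℕ → Carrier → Carrier
  time i y = y / fromℕ (suc i)

  private
    time-diff : ∀ i x y → (time i y - time i x) * fromℕ (suc i) ≈ y - x
    time-diff i x y = R.trans (solve 4 (λ y j x k → (y :* j :- x :* j) :* k := (y :- x) :* j :* k)
      R.refl y j x k) (/-cancel (fromℕ-pos i))
      where
      k = fromℕ (suc i)
      j = k ⁻¹

    time-increment : ∀ i {x y} → fromℕ i ≤ x → x < y → y ≤ fromℕ (suc i) →
                     time i x < time i y × time i y - time i x ≤ y - x
    time-increment i {x} {y} p q r = increasing ,
      cancel-≤ (fromℕ-pos i) (≤-via ((≤.reflexive (time-diff i x y)) ⊕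
        (*-nonneg (fromℕ-nonneg i) (≤-shift (proj₁ q))))
        (solve 5 (λ v1 v2 v3 y x → (:1 :+ v3) :* (y :- x) :- (:1 :+ v3) :* (v1 :- v2) :=
        y :- x :+ v3 :* (y :- x) :- ((v1 :- v2) :* (:1 :+ v3) :+ :0)) R.refl (time i y) (time i x)
        (fromℕ i) y x))
      where
      increasing : time i x < time i y
      increasing = cancel-< (fromℕ-pos i) (<-via (q ⊞ (≤.reflexive (R.sym (time-diff i x y))))
        (solve 5 (λ v1 v2 v3 y x → (:1 :+ v3) :* v1 :- (:1 :+ v3) :* v2 :=
        y :+ (v1 :- v2) :* (:1 :+ v3) :- (x :+ (y :- x))) R.refl (time i y) (time i x) (fromℕ i) y
        x))

  -- The area swept during that descent, up to a constant.
  area : ℕ → Carrier → Carrier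
  area i y = y * y / (fromℕ 2 * fromℕ (suc i))

  private
    double-pos : ∀ i → 0# < fromℕ 2 * fromℕ (suc i)
    double-pos i = *-pos (fromℕ-pos 1) (fromℕ-pos i)

    area-diff : ∀ i x y → (area i y - area i x) * (fromℕ 2 * fromℕ (suc i)) ≈ (y - x) * (y + x)
    area-diff i x y = R.trans (solve 4 (λ y j x k → (y :* y :* j :- x :* x :* j) :* k :=
      (y :- x) :* (y :+ x) :* j :* k) R.refl y j x k) (/-cancel (double-pos i))
      where
      k = fromℕ 2 * fromℕ (suc i)
      j = k ⁻¹

    -- The slope of `area i` between x and y is (x + y) / (2 (i + 1)), at most 1 because both
    -- heights are at most i + 1.
    area-increment : ∀ i {x y} → fromℕ i ≤ x → x < y → y ≤ fromℕ (suc i) →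
                     area i x < area i y × area i y - area i x ≤ y - x
    area-increment i {x} {y} p q r = increasing , 
      cancel-≤ (double-pos i) (≤-via ((≤.reflexive (area-diff i x y)) ⊕
        (*-nonneg (≤-shift (proj₁ q)) (≤-shift (r ⊕ ≤.trans (proj₁ q) r))))
        (solve 5 (λ v1 v2 v3 y x → :2 :* (:1 :+ v3) :* (y :- x) :- :2 :* (:1 :+ v3) :* (v1 :- v2) :=
        (y :- x) :* (y :+ x) :+ (y :- x) :* (:1 :+ v3 :+ (:1 :+ v3) :- (y :+ x)) :-
        ((v1 :- v2) :* (:2 :* (:1 :+ v3)) :+ :0)) R.refl (area i y) (area i x) (fromℕ i) y x))
      where
      x≥0 : 0# ≤ x
      x≥0 = ≤.trans (fromℕ-nonneg i) p
      increasing : area i x < area i y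
      increasing = cancel-< (double-pos i) (<-via ((*-pos (<-shift q)
        (≤-<-trans (≤-resp (solve 0 (:0 :+ :0 := :0) R.refl) R.refl (x≥0 ⊕ x≥0))
        (<-resp (R.+-comm _ _) R.refl (q ⊞ ≤.refl {x = x})))) ⊞
        (≤.reflexive (R.sym (area-diff i x y)))) (solve 5
        (λ v1 v2 v3 y x → :2 :* (:1 :+ v3) :* v1 :- :2 :* (:1 :+ v3) :* v2 :=
        (y :- x) :* (y :+ x) :+ (v1 :- v2) :* (:2 :* (:1 :+ v3)) :- (:0 :+ (y :- x) :* (y :+ x)))
        R.refl (area i y) (area i x) (fromℕ i) y x))

  module τ = Potential time (λ i e → R.*-congʳ e) time-increment
  module A = Potential area (λ i e → R.*-congʳ (R.*-cong e e)) area-increment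

  -- The difference is exactly 0: at speed i + 1 a drop of q (i + 1) takes time q. The error bound
  -- puts this into the form that `P-step` expects.
  time-law : ∀ q {y} i {x} → y - x ≈ q * fromℕ (suc i) → 0# ≤ q →
             time i y - time i x - q * 1# ◁ q * q * fromℕ (suc i)
  time-law q {y} i {x} e q≥0 = ◁-cong (R.sym zero≈) ((≤-via nn
    (solve 2 (λ q v1 → :0 :- (:- (q :* q :* (:1 :+ v1))) := q :* q :* (:1 :+ v1) :- :0) R.refl q
    (fromℕ i))) , nn)
    where
    nn : 0# ≤ q * q * fromℕ (suc i)
    nn = *-nonneg (*-nonneg q≥0 q≥0) (fromℕ-nonneg (suc i))
    zero≈ : time i y - time i x - q * 1# ≈ 0#
    zero≈ = cancel-≈ (fromℕ-pos i) (≈-via ((time-diff i x y) ⊕≈ e)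
      (solve 6 (λ v1 v2 v3 y x q → (:1 :+ v3) :* :0 :- (:1 :+ v3) :* (v1 :- v2 :- q :* :1) :=
      y :- x :+ q :* (:1 :+ v3) :- ((v1 :- v2) :* (:1 :+ v3) :+ (y :- x))) R.refl (time i y)
      (time i x) (fromℕ i) y x q))

  -- During time q the descent sweeps a trapezoid. It falls short of the rectangle q y by a triangle
  -- of area q² (i + 1) / 2.
  area-law : ∀ q {y} i {x} → y - x ≈ q * fromℕ (suc i) → 0# ≤ q →
             area i y - area i x - q * y ◁ q * q * fromℕ (suc i)
  area-law q {y} i {x} e q≥0 =
    (≤-by 1 ((≤.reflexive (R.sym h)) ⊕ nn) (solve 5 (λ v1 v2 q y v3 →
      (con (+ 2)) :* (v1 :- v2 :- q :* y :- (:- (q :* q :* (:1 :+ v3)))) :=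
      :2 :* (v1 :- v2 :- q :* y) :+ q :* q :* (:1 :+ v3) :- ((:- (q :* q :* (:1 :+ v3))) :+ :0))
      R.refl (area i y) (area i x) q y (fromℕ i))) ,
    (≤-by 1 ((≤.reflexive h) ⊕ (2 ⊛ nn)) (solve 5 (λ v1 v2 q y v3 →
      (con (+ 2)) :* (q :* q :* (:1 :+ v3) :- (v1 :- v2 :- q :* y)) :=
      (:- (q :* q :* (:1 :+ v3))) :+ (con (+ 3)) :* (q :* q :* (:1 :+ v3)) :-
      (:2 :* (v1 :- v2 :- q :* y) :+ (con (+ 3)) :* :0)) R.refl (area i y) (area i x) q y
      (fromℕ i)))
    where
    nn : 0# ≤ q * q * fromℕ (suc i)
    nn = *-nonneg (*-nonneg q≥0 q≥0) (fromℕ-nonneg (suc i))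
    h : fromℕ 2 * (area i y - area i x - q * y) ≈ - (q * q * fromℕ (suc i))
    h = cancel-≈ (fromℕ-pos i) (≈-via ((area-diff i x y) ⊕≈ (R.*-congʳ {y + x} e) ⊕≈
      (R.sym (R.*-congˡ {q * fromℕ (suc i)} e))) (solve 6
      (λ v1 v2 v3 y x q → (:1 :+ v3) :* (:- (q :* q :* (:1 :+ v3))) :- (:1 :+ v3) :*
      (:2 :* (v1 :- v2 :- q :* y)) := (y :- x) :* (y :+ x) :+ q :* (:1 :+ v3) :* (y :+ x) :+ q :*
      (:1 :+ v3) :* (y :- x) :- ((v1 :- v2) :* (:2 :* (:1 :+ v3)) :+ (y :- x) :* (y :+ x) :+ q :*
      (:1 :+ v3) :* (q :* (:1 :+ v3)))) R.refl (area i y) (area i x) (fromℕ i) y x q))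

  -- The scale equation and the limiting profile

  ∑-snoc : ∀ (g : ℕ → Carrier) n → ∑[ j < suc n ] g (toℕ j) ≈ (∑[ j < n ] g (toℕ j)) + g n
  ∑-snoc g zero    = R.+-comm _ _
  ∑-snoc g (suc n) = R.trans (R.+-congˡ (∑-snoc (g ∘ suc) n)) (R.sym (R.+-assoc _ _ _))

  ⊔-absorb : ∀ {x y} → y ≤ x → x ⊔ y ≈ x
  ⊔-absorb {x} {y} p = ≤.antisym (⊔-lub ≤.refl p) (⊔-ub₁ x y)

  ⊔-absorbˡ : ∀ {x y} → x ≤ y → x ⊔ y ≈ y
  ⊔-absorbˡ {x} {y} p = ≤.antisym (⊔-lub p ≤.refl) (⊔-ub₂ x y)

  -- The harmonic number H_Z, summed from its smallest term as in the scale equation. In this order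
  -- it unfolds definitionally into 1 / Z and H_(Z - 1).
  harmonic : ℕ → Carrier
  harmonic Z = ∑[ i < Z ] (1# / fromℕ (Z ∸ toℕ i))

  -- Section j contributes ((j + 1)² - j²) / (2 (j + 1)) = 1 - 1 / (2 (j + 1)); summing over j < k
  -- produces the harmonic number.
  area-V : ∀ k → fromℕ 2 * A.V k ≈ fromℕ 2 * fromℕ k - harmonic k
  area-V zero    = solve 0 (:2 :* :0 := :2 :* :0 :- :0) R.refl
  area-V (suc k) = cancel-≈ (fromℕ-pos k)
    (≈-via ((R.*-congˡ {fromℕ (suc k)} (area-V k)) ⊕≈ (area-diff k (fromℕ k) (fromℕ (suc k))) ⊕≈
      (inv-cancel (fromℕ-pos k))) (solve 6 (λ v1 v2 v3 v4 v5 v6 →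
      (:1 :+ v1) :* (:2 :* (:1 :+ v1) :- (:1 :* v6 :+ v3)) :- (:1 :+ v1) :*
      (:2 :* (v2 :+ (v4 :- v5))) := (:1 :+ v1) :* (:2 :* v1 :- v3) :+ (:1 :+ v1 :- v1) :*
      (:1 :+ v1 :+ v1) :+ :1 :- ((:1 :+ v1) :* (:2 :* v2) :+ (v4 :- v5) :* (:2 :* (:1 :+ v1)) :+
      (:1 :+ v1) :* v6)) R.refl (fromℕ k) (A.V k) (harmonic k) (area k (fromℕ (suc k)))
      (area k (fromℕ k)) (fromℕ (suc k) ⁻¹)))

  scaleRHS : ℕ → Carrier → Carrier
  scaleRHS Z z = (z ^ 2 + fromℕ Z ^ 2) / fromℕ Z - harmonic Z

  -- With Z = k + 1 and `area-V`, the right side is 2 k - H_k + (z² - k²) / Z. Here 2 k - k² / Z = Z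
  -- - 1 / Z, and the term 1 / Z completes H_k to H_Z. This is the origin of the scale equation.
  scaleRHS-section : ∀ k z → scaleRHS (suc k) z ≈ fromℕ 2 * A.section k z
  scaleRHS-section k z = cancel-≈ (fromℕ-pos k)
    (≈-via ((R.sym (R.*-congˡ {fromℕ (suc k)} (area-V k))) ⊕≈ (R.sym (area-diff k (fromℕ k) z)) ⊕≈
      (R.sym (inv-cancel (fromℕ-pos k))) ⊕≈ (R.*-congˡ {z ^ 2 + fromℕ (suc k) ^ 2}
      (inv-cancel (fromℕ-pos k)))) (solve 7 (λ v1 v2 v3 v4 v5 z v6 →
      (:1 :+ v1) :* (:2 :* (v2 :+ (v4 :- v5))) :- (:1 :+ v1) :*
      ((z :^ 2 :+ (:1 :+ v1) :^ 2) :* v6 :- (:1 :* v6 :+ v3)) :=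
      (:1 :+ v1) :* (:2 :* v2) :+ (v4 :- v5) :* (:2 :* (:1 :+ v1)) :+ (:1 :+ v1) :* v6 :+
      (z :^ 2 :+ (:1 :+ v1) :^ 2) :* :1 :- ((:1 :+ v1) :* (:2 :* v1 :- v3) :+ (z :- v1) :* (z :+ v1)
      :+ :1 :+ (z :^ 2 :+ (:1 :+ v1) :^ 2) :* ((:1 :+ v1) :* v6))) R.refl (fromℕ k) (A.V k)
      (harmonic k) (area k z) (area k (fromℕ k)) z (fromℕ (suc k) ⁻¹)))

  abstract
    ⌈⌉-pos : ∀ {z} → 0# < z → ∃ λ k → ⌈ z ⌉ ≡ suc k
    ⌈⌉-pos {z} z>0 = go ⌈ z ⌉ ≡.refl
      where
      go : ∀ j → j ≡ ⌈ z ⌉ → ∃ λ k → ⌈ z ⌉ ≡ suc k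
      go zero    e = ⊥-elim (<⇒≱ z>0 (≤.trans (⌈⌉-ub z) (≤.reflexive (fromℕ-cong (≡.sym e)))))
      go (suc k) e = k , ≡.sym e

  scaleRHS-area : ∀ {z} → 0# < z → scaleRHS ⌈ z ⌉ z ≈ fromℕ 2 * A.P z
  scaleRHS-area {z} z>0 = go (⌈⌉-pos z>0)
    where
    go : (∃ λ k → ⌈ z ⌉ ≡ suc k) → scaleRHS ⌈ z ⌉ z ≈ fromℕ 2 * A.P z
    go (k , e) = ≡.subst (λ j → scaleRHS j z ≈ fromℕ 2 * A.section (j ∸ 1) z) (≡.sym e)
      (scaleRHS-section k z)

  scale⇒area : ∀ {C z} → SatisfiesScaleEquation C z → A.P z ≈ C
  scale⇒area (z>0 , e) = cancel-≈ (fromℕ-pos 1) (R.sym (R.trans e (scaleRHS-area z>0)))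

  -- Each full section adds (2 j + 1) / (2 (j + 1)) ≥ 1 / 2. This supplies the upper end for solving
  -- `A.P z ≈ C`.
  area-unbounded : ∀ k → fromℕ k ≤ fromℕ 2 * A.P (fromℕ k)
  area-unbounded k = ≤.trans (bound k) (≤.reflexive (R.*-congˡ (R.sym (A.P-fromℕ k))))
    where
    bound : ∀ k → fromℕ k ≤ fromℕ 2 * A.V k
    bound zero    = ≤-via (≤.reflexive (R.refl {0#})) (solve 0 (:2 :* :0 :- :0 := :0 :- :0) R.refl)
    bound (suc k) = cancel-≤ (fromℕ-pos k)
      (≤-via ((*-monoˡ (fromℕ-nonneg (suc k)) (bound k)) ⊕
        (≤.reflexive (R.sym (area-diff k (fromℕ k) (fromℕ (suc k))))) ⊕ (fromℕ-nonneg k))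
        (solve 4 (λ v1 v2 v3 v4 → (:1 :+ v1) :* (:2 :* (v2 :+ (v3 :- v4))) :- (:1 :+ v1) :*
        (:1 :+ v1) := (:1 :+ v1) :* (:2 :* v2) :+ (v3 :- v4) :* (:2 :* (:1 :+ v1)) :+ v1 :-
        ((:1 :+ v1) :* v1 :+ (:1 :+ v1 :- v1) :* (:1 :+ v1 :+ v1) :+ :0)) R.refl (fromℕ k) (A.V k)
        (area k (fromℕ (suc k))) (area k (fromℕ k))))

  scale-solution : ∀ {C} → 0# < C → ∃! _≈_ (SatisfiesScaleEquation C)
  scale-solution {C} C>0 = z , (z>0 , R.trans (R.*-congˡ (R.sym Pz≈C)) (R.sym (scaleRHS-area z>0)))
    ,
      λ s → A.P-injective z≥0 (proj₁ (proj₁ s)) (R.trans Pz≈C (R.sym (scale⇒area s)))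
    where
    b = proj₁ (archimedean (fromℕ 2 * C))
    C≤Pb : C ≤ A.P (fromℕ b)
    C≤Pb = cancel-≤ (fromℕ-pos 1) (≤.trans (proj₂ (archimedean (fromℕ 2 * C))) (area-unbounded b))
    solution = A.P-surjective {C} {fromℕ b} (fromℕ-nonneg b)
      (≤.trans (≤.reflexive A.P-0) (proj₁ C>0)) C≤Pb
    z = proj₁ solution
    z≥0 = proj₁ (proj₂ solution)
    Pz≈C = proj₂ (proj₂ solution)
    z>0 : 0# < z
    z>0 = z≥0 , λ e → <⇒≉ C>0 (R.trans (R.sym Pz≈C) (R.trans (A.P-cong (R.sym e)) A.P-0))

  module Shape (C z : Carrier) (C>0 : 0# < C) (z>0 : 0# < z) where
    open Sections C z

    -- The factor from the horizontal coordinate to time: position x is reached after about x N / m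
    -- steps of duration q, and q N / m = N q² / (q m) tends to C / z.
    c : Carrier
    c = C / z

    private
      z≥0 = proj₁ z>0
      c>0 : 0# < c
      c>0 = /-pos C>0 z>0
      cz≈C : c * z ≈ C
      cz≈C = /-cancel z>0

    -- The descent time left at x. The inner maximum keeps it at most `τ.P z` for negative x, so
    -- that `descent` is total; the outer one ends the descent at height 0.
    remaining : Carrier → Carrier
    remaining x = (τ.P z - c * (x ⊔ 0#)) ⊔ 0#

    private
      remaining≤ : ∀ x → remaining x ≤ τ.P z
      remaining≤ x = ⊔-lub (≤-via (*-nonneg (proj₁ c>0) (⊔-ub₂ x 0#))
        (solve 3 (λ c v1 v2 → v2 :- (v2 :- c :* v1) := c :* v1 :- :0) R.refl c (x ⊔ 0#) (τ.P z)))
        (τ.P-nonneg z≥0)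

    abstract
      descent : ∀ x → ∃ λ y → 0# ≤ y × τ.P y ≈ remaining x
      descent x = τ.P-surjective z≥0 (≤.trans (≤.reflexive τ.P-0) (⊔-ub₂ _ 0#)) (remaining≤ x)

    height : Carrier → Carrier
    height x = proj₁ (descent x)

    height-nonneg : ∀ x → 0# ≤ height x
    height-nonneg x = proj₁ (proj₂ (descent x))

    height-remaining : ∀ x → τ.P (height x) ≈ remaining x
    height-remaining x = proj₂ (proj₂ (descent x))

    φ : Carrier → Carrier
    φ x = height x / z

    height-unique : ∀ {x y} → 0# ≤ x → 0# ≤ y → τ.P y ≈ τ.P z - c * x → height x ≈ y
    height-unique {x} {y} x≥0 y≥0 e = τ.P-injective (height-nonneg x) y≥0
      (R.trans (height-remaining x) (R.trans (⊔-absorb (≤.trans (τ.P-nonneg y≥0) (≤.reflexive e′)))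
        (R.sym e′)))
      where
      e′ : τ.P y ≈ τ.P z - c * (x ⊔ 0#)
      e′ = R.trans e (+-congˡ (-‿cong (R.*-congˡ (R.sym (⊔-absorb x≥0)))))

    private
      k = proj₁ (⌈⌉-pos z>0)
      Z≡ : Z ≡ suc k
      Z≡ = proj₂ (⌈⌉-pos z>0)

      c*z/C : ∀ w → c * (z / C * w) ≈ w
      c*z/C w = R.trans (solve 4 (λ c z v1 w → c :* (z :* v1 :* w) := c :* z :* v1 :* w) R.refl c z
        (C ⁻¹) w)
        (R.trans (R.*-congʳ (R.trans (R.*-congʳ cz≈C) (inv-cancel C>0)))
          (solve 1 (λ w → :1 :* w := w) R.refl w))

      -- The scaled heights at the section ends: z, then k, k - 1, ..., 0 with k = Z - 1. Sections
      -- change exactly where the speed ⌈ y ⌉ changes.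
      at : ℕ → Carrier
      at zero    = z
      at (suc i) = fromℕ (k ∸ i)

      top≤ : z ≤ fromℕ (suc k)
      top≤ = ≤.trans (⌈⌉-ub z) (≤.reflexive (fromℕ-cong Z≡))

      k<z : fromℕ k < z
      k<z = ≰⇒> λ q → ℕ.1+n≰n (≡.subst (ℕ._≤ k) Z≡ (⌈⌉-least k q))

      at-bounds : ∀ i → i ℕ.≤ k → fromℕ (k ∸ i) ≤ at i × at i ≤ fromℕ (suc (k ∸ i))
      at-bounds zero    p = proj₁ k<z , top≤
      at-bounds (suc i) p = fromℕ-mono (ℕ.∸-monoʳ-≤ k (ℕ.n≤1+n i)) , ≤.reflexive
        (fromℕ-cong (ℕ.+-∸-assoc 1 p))

      at-nonneg : ∀ i → i ℕ.≤ suc k → 0# ≤ at i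
      at-nonneg zero    _ = z≥0
      at-nonneg (suc i) _ = fromℕ-nonneg (k ∸ i)

      -- Section i is crossed at speed Z - i in time c · `width i`. The drop is z - k = 1 + z - Z in
      -- the top section and 1 in the others, which explains the numerators in `width`.
      at-descends : ∀ i → i ℕ.≤ k → at i - at (suc i) ≈ c * width i * fromℕ (suc (k ∸ i))
      at-descends zero p = R.sym (R.trans (R.*-congʳ (c*z/C _))
        (R.trans (R.reflexive (≡.cong (λ j → (1# + z - fromℕ j) / fromℕ j * fromℕ (suc k)) Z≡))
        (R.trans (/-cancel (fromℕ-pos k)) (solve 2 (λ z v1 → :1 :+ z :- (:1 :+ v1) := z :- v1)
          R.refl z (fromℕ k)))))
      at-descends (suc i) p = R.sym (R.trans (R.*-congʳ (c*z/C _))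
        (R.trans (R.reflexive (≡.cong (λ j → 1# / fromℕ j * fromℕ (suc (k ∸ suc i)))
          (≡.trans (≡.cong (_∸ suc i) Z≡) (ℕ.+-∸-assoc 1 p))))
        (R.trans (/-cancel (fromℕ-pos (k ∸ suc i)))
        (R.trans (solve 1 (λ v1 → :1 := :1 :+ v1 :- v1) R.refl (fromℕ (k ∸ suc i)))
                 (+-congʳ (fromℕ-cong (≡.sym (ℕ.+-∸-assoc 1 p))))))))

      τ-linear : ∀ j {x y} → fromℕ j ≤ x → x ≤ fromℕ (suc j) → fromℕ j ≤ y → y ≤ fromℕ (suc j) →
                 (τ.P y - τ.P x) * fromℕ (suc j) ≈ y - x
      τ-linear j {x} {y} p q p′ q′ = R.trans (R.*-congʳ (≈-via
        ((τ.P-section j p′ q′) ⊕≈ (R.sym (τ.P-section j p q)))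
        (solve 6 (λ v1 v2 v3 v4 v5 v6 → v3 :- v6 :- (v1 :- v5) :=
        v2 :+ (v3 :- v4) :+ v5 :- (v1 :+ (v2 :+ (v6 :- v4)))) R.refl (τ.P y) (τ.V j) (time j y)
        (time j (fromℕ j)) (τ.P x) (time j x)))) (time-diff j x y)

      start-suc : ∀ i → start (suc i) ≈ start i + width i
      start-suc i = ∑-snoc width i

      at-start : ∀ i → i ℕ.≤ suc k → τ.P (at i) ≈ τ.P z - c * start i
      at-start zero    p = solve 2 (λ v1 c → v1 := v1 :- c :* :0) R.refl (τ.P z) c
      at-start (suc i) (ℕ.s≤s p) = cancel-≈ (fromℕ-pos j)
        (≈-via ((R.sym (at-descends i p)) ⊕≈ (R.sym (τ-linear j {fromℕ j} {at i} ≤.refl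
          (≤-via (proj₁ 0<1) (solve 1 (λ v1 → :1 :+ v1 :- v1 := :1 :- :0) R.refl (fromℕ j)))
          (proj₁ b) (proj₂ b))) ⊕≈ (R.*-congˡ {fromℕ (suc j)} (at-start i (ℕ.m≤n⇒m≤1+n p))) ⊕≈
          (R.*-congˡ {fromℕ (suc j) * c} (start-suc i)))
          (solve 9 (λ v1 v2 c v3 v4 v5 v6 v7 v8 → (:1 :+ v2) :* (v6 :- c :* v8) :- (:1 :+ v2) :* v5
          := v1 :- v2 :+ (v4 :- v5) :* (:1 :+ v2) :+ (:1 :+ v2) :* (v6 :- c :* v7) :+ (:1 :+ v2) :*
          c :* (v7 :+ v3) :- (c :* v3 :* (:1 :+ v2) :+ (v1 :- v2) :+ (:1 :+ v2) :* v4 :+ (:1 :+ v2)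
          :* c :* v8)) R.refl (at i) (fromℕ j) c (width i) (τ.P (at i)) (τ.P (fromℕ j)) (τ.P z)
          (start i) (start (suc i))))
        where
        j = k ∸ i
        b = at-bounds i p

      at≤z : ∀ i → i ℕ.≤ suc k → at i ≤ z
      at≤z zero    p = ≤.refl
      at≤z (suc i) p = ≤.trans (fromℕ-mono (ℕ.m∸n≤m k i)) (proj₁ k<z)

      start-nonneg : ∀ i → i ℕ.≤ suc k → 0# ≤ start i
      start-nonneg i p = cancel-≤ c>0 (≤-via ((≤.reflexive (R.sym (at-start i p))) ⊕
        (τ.P-≤ (at-nonneg i p) (at≤z i p))) (solve 4 (λ v1 v2 c v3 → c :* v3 :- c :* :0 :=
        v1 :+ v2 :- (v2 :- c :* v3 :+ v1)) R.refl (τ.P (at i)) (τ.P z) c (start i)))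

      height-start : ∀ i → i ℕ.≤ suc k → height (start i) ≈ at i
      height-start i p = height-unique (start-nonneg i p) (at-nonneg i p) (at-start i p)

      slope-z : ∀ i → i ℕ.≤ k → slope i * z ≈ c * fromℕ (suc (k ∸ i))
      slope-z i p = cancel-≈ z>0
        (≈-via ((/-cancel {C * fromℕ (Z ∸ i)} (*-pos z>0 (*-pos z>0 0<1))) ⊕≈
          (R.*-congˡ {C} (fromℕ-cong (≡.trans (≡.cong (_∸ i) Z≡) (ℕ.+-∸-assoc 1 p)))) ⊕≈
          (R.sym (R.*-congʳ {fromℕ (suc (k ∸ i))} cz≈C)))
          (solve 6 (λ v1 z C v2 v3 c → z :* (c :* (:1 :+ v3)) :- z :* (v1 :* z) :=
          C :* v2 :+ C :* (:1 :+ v3) :+ c :* z :* (:1 :+ v3) :-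
          (v1 :* (z :* (z :* :1)) :+ C :* v2 :+ C :* (:1 :+ v3))) R.refl (slope i) z C
          (fromℕ (Z ∸ i)) (fromℕ (k ∸ i)) c))

      -- In a section τ is affine with slope 1 / (Z - i), so this affine candidate solves τ y = τ z
      -- - c x. The two bounds on x keep it inside the section, where that formula for τ is valid.
      height-section : ∀ i → i ℕ.≤ k → ∀ x → start i ≤ x → x ≤ start (suc i) →
                       height x ≈ at i - c * fromℕ (suc (k ∸ i)) * (x - start i)
      height-section i p x s≤x x≤s′ = height-unique
          (≤.trans (start-nonneg i (ℕ.m≤n⇒m≤1+n p)) s≤x) (≤.trans (fromℕ-nonneg j) j≤y)
          (cancel-≈ (fromℕ-pos j) (≈-via ((τ-linear j (proj₁ b) (proj₂ b) j≤y y≤) ⊕≈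
            (R.*-congˡ {fromℕ (suc j)} (at-start i (ℕ.m≤n⇒m≤1+n p))))
            (solve 8 (λ v1 v2 v3 v4 c x v5 v6 → (:1 :+ v3) :* (v6 :- c :* x) :- (:1 :+ v3) :* v1 :=
            v4 :- c :* (:1 :+ v3) :* (x :- v5) :- v4 :+ (:1 :+ v3) :* (v6 :- c :* v5) :-
            ((v1 :- v2) :* (:1 :+ v3) :+ (:1 :+ v3) :* v2)) R.refl (τ.P y) (τ.P (at i)) (fromℕ j)
            (at i) c x (start i) (τ.P z))))
        where
        j = k ∸ i
        b = at-bounds i p
        y = at i - c * fromℕ (suc j) * (x - start i)
        cj≥0 : 0# ≤ c * fromℕ (suc j)
        cj≥0 = *-nonneg (proj₁ c>0) (fromℕ-nonneg (suc j))
        j≤y : fromℕ j ≤ y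
        j≤y = ≤-via ((≤.reflexive (R.sym (at-descends i p))) ⊕
          (≤.reflexive (R.*-congˡ {c * fromℕ (suc j)} (start-suc i))) ⊕ (*-monoˡ cj≥0 x≤s′))
          (solve 7 (λ v1 v2 c v3 v4 v5 x → v1 :- c :* (:1 :+ v2) :* (x :- v5) :- v2 :=
          v1 :- v2 :+ c :* (:1 :+ v2) :* (v5 :+ v3) :+ c :* (:1 :+ v2) :* v4 :-
          (c :* v3 :* (:1 :+ v2) :+ c :* (:1 :+ v2) :* v4 :+ c :* (:1 :+ v2) :* x)) R.refl (at i)
          (fromℕ j) c (width i) (start (suc i)) (start i) x)
        y≤ : y ≤ fromℕ (suc j)
        y≤ = ≤-via ((proj₂ b) ⊕ (*-nonneg cj≥0 (≤-shift s≤x)))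
          (solve 5 (λ v1 v2 c x v3 → :1 :+ v2 :- (v1 :- c :* (:1 :+ v2) :* (x :- v3)) :=
          :1 :+ v2 :+ c :* (:1 :+ v2) :* (x :- v3) :- (v1 :+ :0)) R.refl (at i) (fromℕ j) c x
          (start i))

      φ-z : ∀ x → φ x * z ≈ height x
      φ-z x = /-cancel z>0

    piecewiseLinear : IsPiecewiseLinear φ
    piecewiseLinear = record
      { height-at-0 = cancel-≈ z>0 (≈-via ((φ-z 0#) ⊕≈ (height-start 0 ℕ.z≤n))
        (solve 3 (λ v1 z v2 → z :* :1 :- z :* v1 := v2 :+ z :- (v1 :* z :+ v2)) R.refl (φ 0#) z
        (height 0#)))
      ; on-section  = λ i i<Z → on-section i (ℕ.≤-pred (≡.subst (suc i ℕ.≤_) Z≡ i<Z))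
      ; afterwards  = λ x s≤x → afterwards x (≤.trans (≤.reflexive
        (R.reflexive (≡.cong start (≡.sym Z≡)))) s≤x)
      }
      where
      on-section : ∀ i → i ℕ.≤ k → ∀ x → start i ≤ x → x ≤ start (suc i) → φ x ≈ φ (start i) - slope
        i * (x - start i)
      on-section i p x s≤x x≤s′ = cancel-≈ z>0 (≈-via ((φ-z x) ⊕≈ (R.sym (φ-z (start i))) ⊕≈
        (height-section i p x s≤x x≤s′) ⊕≈ (R.sym (height-start i (ℕ.m≤n⇒m≤1+n p))) ⊕≈
        (R.*-congʳ {x - start i} (slope-z i p))) (solve 11
        (λ v1 z v2 v3 v4 v5 c v6 x v7 v8 → z :* (v3 :- v8 :* (x :- v7)) :- z :* v1 :=
        v2 :+ v3 :* z :+ (v5 :- c :* (:1 :+ v6) :* (x :- v7)) :+ v4 :+ c :* (:1 :+ v6) :* (x :- v7)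
        :- (v1 :* z :+ v4 :+ v2 :+ v5 :+ v8 :* z :* (x :- v7))) R.refl (φ x) z (height x)
        (φ (start i)) (height (start i)) (at i) c (fromℕ (k ∸ i)) x (start i) (slope i)))

      afterwards : ∀ x → start (suc k) ≤ x → φ x ≈ 0#
      afterwards x s≤x = R.trans (R.*-congʳ height≈0) (solve 1 (λ v1 → :0 :* v1 := :0) R.refl
        (z ⁻¹))
        where
        x≥0 : 0# ≤ x
        x≥0 = ≤.trans (start-nonneg (suc k) ℕ.≤-refl) s≤x
        at-end : τ.P (at (suc k)) ≈ 0#
        at-end = R.trans (τ.P-cong (fromℕ-cong (ℕ.n∸n≡0 k))) τ.P-0
        exhausted : τ.P z - c * (x ⊔ 0#) ≤ 0#
        exhausted = ≤-via ((≤.reflexive (R.sym (at-start (suc k) ℕ.≤-refl))) ⊕ (≤.reflexive at-end)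
          ⊕ (*-monoˡ (proj₁ c>0) (≤.trans s≤x (⊔-ub₁ x 0#))))
          (solve 5 (λ v1 v2 c v3 v4 → :0 :- (v2 :- c :* v4) :=
          v1 :+ :0 :+ c :* v4 :- (v2 :- c :* v3 :+ v1 :+ c :* v3)) R.refl (τ.P (at (suc k))) (τ.P z)
          c (start (suc k)) (x ⊔ 0#))
        height≈0 : height x ≈ 0#
        height≈0 = τ.P-injective (height-nonneg x) ≤.refl
          (R.trans (height-remaining x) (R.trans (⊔-absorbˡ exhausted) (R.sym τ.P-0)))

  -- Stable configurations for a fixed proportion

  module Proportion (q : Carrier) (q>0 : 0# < q) (q≤1 : q ≤ 1#) where
    q≥0 : 0# ≤ q
    q≥0 = proj₁ q>0

    picked-ub : ∀ h → q * fromℕ h ≤ fromℕ (picked q h)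
    picked-ub h = ⌈⌉-ub (q * fromℕ h)

    picked-lb : ∀ h → fromℕ (picked q h) ≤ q * fromℕ h + 1#
    picked-lb h = proj₁ (⌈⌉-lb (*-nonneg q≥0 (fromℕ-nonneg h)))

    picked-≤ : ∀ h → picked q h ℕ.≤ h
    picked-≤ h = ⌈⌉-least h (≤-via (*-nonneg (fromℕ-nonneg h) (≤-shift q≤1))
      (solve 2 (λ v1 q → v1 :- q :* v1 := v1 :* (:1 :- q) :- :0) R.refl (fromℕ h) q))

    picked-pos : ∀ h → 0 ℕ.< h → 0 ℕ.< picked q h
    picked-pos (suc h) _ = fromℕ-cancel-< (<-≤-trans (*-pos q>0 (fromℕ-pos h)) (picked-ub (suc h)))

    picked-mono : ∀ h → picked q h ℕ.≤ picked q (suc h)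
    picked-mono h = ⌈⌉-mono (*-monoˡ q≥0 (fromℕ-mono (ℕ.n≤1+n h)))

    picked-suc : ∀ h → picked q (suc h) ℕ.≤ suc (picked q h)
    picked-suc h = ⌈⌉-least (suc (picked q h))
      (≤-via ((picked-ub h) ⊕ q≤1) (solve 3 (λ q v1 v2 → :1 :+ v2 :- q :* (:1 :+ v1) :=
        v2 :+ :1 :- (q :* v1 :+ q)) R.refl q (fromℕ h) (fromℕ (picked q h))))

    open StableConfigurations (picked q) picked-≤ picked-pos picked-mono picked-suc public

    stable-exists : ∀ m → Stable q (N m)
    stable-exists m = partition m , sort-after-stable m

    fromℕ-f : ∀ h → fromℕ (f h) ≈ fromℕ h - fromℕ (picked q h)
    fromℕ-f h = fromℕ-∸ (picked-≤ h)

    largest-upper : ∀ n → proj₁ (largestStable q n) ℕ.≤ n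
    largest-upper zero    = ℕ.z≤n
    largest-upper (suc n) with lem {Stable q (suc n)}
    ... | yes _ = ℕ.≤-refl
    ... | no  _ = ℕ.m≤n⇒m≤1+n (largest-upper n)

    largest-maximal : ∀ n n′ → n′ ℕ.≤ n → Stable q n′ → n′ ℕ.≤ proj₁ (largestStable q n)
    largest-maximal zero    n′ p s = p
    largest-maximal (suc n) n′ p s with lem {Stable q (suc n)}
    ... | yes _ = p
    ... | no ¬s = largest-maximal n n′ (ℕ.≤-pred (ℕ.≤∧≢⇒< p λ { ≡.refl → ¬s s })) s

    parts-stable : ∀ {n} (s : Stable q n) → parts (proj₁ s) ≡ stable (part (parts (proj₁ s)) 0)
    parts-stable (p , e) = ≡.trans hs≡ (≡.cong stable (≡.sym
      (≡.trans (≡.cong (λ l → part l 0) hs≡) (part-stable 0 (picks (parts p))))))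
      where
      hs≡ : parts p ≡ stable (picks (parts p))
      hs≡ = stable-characterised (parts p) (sorted p) (positive p) e

    total-stable : ∀ {n} (s : Stable q n) → n ≡ N (part (parts (proj₁ s)) 0)
    total-stable s = ≡.trans (≡.sym (total (proj₁ s))) (≡.cong sum (parts-stable s))

    part-it : ∀ {n} (s : Stable q n) k → part (parts (proj₁ s)) k ≡ it k (part (parts (proj₁ s)) 0)
    part-it s k = ≡.trans (≡.cong (λ l → part l k) (parts-stable s)) (part-stable k _)

    -- Otherwise the stable configuration with top pile m + 1, which by `N-step` has at most ℓ + 1
    -- cards more, would still fit into n and contradict maximality.
    maximal-lower : ∀ n {n*} (s : Stable q n*) → (∀ n′ → n′ ℕ.≤ n → Stable q n′ → n′ ℕ.≤ n*) →
                    n ℕ.≤ n* ℕ.+ ℓ (part (parts (proj₁ s)) 0)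
    maximal-lower n {n*} s maximal = bound (part (parts (proj₁ s)) 0) (total-stable s)
      where
      bound : ∀ m → n* ≡ N m → n ℕ.≤ n* ℕ.+ ℓ m
      bound m ≡.refl = ℕ.≤-pred (ℕ.≤-trans n<N (proj₂ (N-step m)))
        where
        n<N : n ℕ.< N (suc m)
        n<N = ℕ.≰⇒> λ p → ℕ.<⇒≱ (proj₁ (N-step m)) (maximal (N (suc m)) p (stable-exists (suc m)))

    largest-lower : ∀ n → n ℕ.≤ proj₁ (largestStable q n) ℕ.+ ℓ
      (part (parts (proj₁ (proj₂ (largestStable q n)))) 0)
    largest-lower n = maximal-lower n (proj₂ (largestStable q n)) (largest-maximal n)

    -- The top pile is the sum of all picks. Each pick lies between q λᵢ and q λᵢ + 1, which yields
    -- this bound and the next one.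
    q*N≤ : ∀ m → q * fromℕ (N m) ≤ fromℕ m
    q*N≤ = f-rec _ (≤-via (≤.reflexive (R.refl {0#})) (solve 1 (λ q → :0 :- q :* :0 := :0 :- :0)
      R.refl q)) λ h ih →
      (≤-via ((≤.reflexive (R.*-congˡ {q} (R.trans (fromℕ-cong (N-suc h))
        (fromℕ-+ (suc h) (N (f (suc h))))))) ⊕ (picked-ub (suc h)) ⊕ (≤.reflexive (fromℕ-f (suc h)))
        ⊕ ih) (solve 6 (λ q v1 v2 v3 v4 v5 → :1 :+ v2 :- q :* v1 :=
        q :* (:1 :+ v2 :+ v3) :+ v4 :+ (:1 :+ v2 :- v4) :+ v5 :-
        (q :* v1 :+ q :* (:1 :+ v2) :+ v5 :+ q :* v3)) R.refl q (fromℕ (N (suc h))) (fromℕ h)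
        (fromℕ (N (f (suc h)))) (fromℕ (picked q (suc h))) (fromℕ (f (suc h)))))

    ≤q*N+ℓ : ∀ m → fromℕ m ≤ q * fromℕ (N m) + fromℕ (ℓ m)
    ≤q*N+ℓ = f-rec _ (≤-via (≤.reflexive (R.refl {0#})) (solve 1
      (λ q → q :* :0 :+ :0 :- :0 := :0 :- :0) R.refl q)) λ h ih →
      (≤-via ((≤.reflexive (R.sym (R.*-congˡ {q} (R.trans (fromℕ-cong (N-suc h))
        (fromℕ-+ (suc h) (N (f (suc h)))))))) ⊕ (≤.reflexive (R.sym (fromℕ-cong (ℓ-suc h)))) ⊕
        (picked-lb (suc h)) ⊕ (≤.reflexive (R.sym (fromℕ-f (suc h)))) ⊕ ih)
        (solve 8 (λ q v1 v2 v3 v4 v5 v6 v7 → q :* v1 :+ v4 :- (:1 :+ v2) :=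
        q :* v1 :+ v4 :+ (q :* (:1 :+ v2) :+ :1) :+ v7 :+ (q :* v3 :+ v5) :-
        (q :* (:1 :+ v2 :+ v3) :+ (:1 :+ v5) :+ v6 :+ (:1 :+ v2 :- v6) :+ v7)) R.refl q
        (fromℕ (N (suc h))) (fromℕ h) (fromℕ (N (f (suc h)))) (fromℕ (ℓ (suc h)))
        (fromℕ (ℓ (f (suc h)))) (fromℕ (picked q (suc h))) (fromℕ (f (suc h)))))

    ℓ-square : ∀ m → fromℕ (ℓ m) * fromℕ (ℓ m) ≤ fromℕ 2 * fromℕ (N m)
    ℓ-square m = ≤-via ((≤.reflexive (R.sym (fromℕ-* (ℓ m) (suc (ℓ m))))) ⊕
      (≤.reflexive (fromℕ-* 2 (N m))) ⊕ (fromℕ-mono (ℓ-bound m)) ⊕ (fromℕ-nonneg (ℓ m)))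
      (solve 4 (λ v1 v2 v3 v4 → :2 :* v4 :- v1 :* v1 := v2 :+ :2 :* v4 :+ v3 :+ v1 :-
      (v1 :* (:1 :+ v1) :+ v3 :+ v2 :+ :0)) R.refl (fromℕ (ℓ m)) (fromℕ (ℓ m ℕ.* suc (ℓ m)))
      (fromℕ (2 ℕ.* N m)) (fromℕ (N m)))

    1-q≥0 : 0# ≤ 1# - q
    1-q≥0 = ≤-shift q≤1

    ^-nonneg : ∀ {x} k → 0# ≤ x → 0# ≤ x ^ k
    ^-nonneg zero    p = proj₁ 0<1
    ^-nonneg (suc k) p = *-nonneg p (^-nonneg k p)

    it-upper : ∀ k m → fromℕ (it k m) ≤ (1# - q) ^ k * fromℕ m
    it-upper zero    m = ≤-via (≤.reflexive (R.refl {0#}))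
      (solve 1 (λ v1 → :1 :* v1 :- v1 := :0 :- :0) R.refl (fromℕ m))
    it-upper (suc k) m = ≤-via ((it-upper k (f m)) ⊕ (*-monoˡ (^-nonneg k 1-q≥0) fm≤))
      (solve 5 (λ v1 v2 v3 q v4 → (:1 :- q) :* v2 :* v4 :- v1 :=
      v2 :* v3 :+ v2 :* ((:1 :- q) :* v4) :- (v1 :+ v2 :* v3)) R.refl (fromℕ (it k (f m)))
      ((1# - q) ^ k) (fromℕ (f m)) q (fromℕ m))
      where
      fm≤ : fromℕ (f m) ≤ (1# - q) * fromℕ m
      fm≤ = ≤-via ((picked-ub m) ⊕ (≤.reflexive (fromℕ-f m)))
        (solve 4 (λ q v1 v2 v3 → (:1 :- q) :* v1 :- v3 := v2 :+ (v1 :- v2) :- (q :* v1 :+ v3))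
        R.refl q (fromℕ m) (fromℕ (picked q m)) (fromℕ (f m)))

    -- Adding 1 makes the estimate homogeneous: ⌈ q h ⌉ ≤ q h + 1 gives q (f h) + 1 ≥ (1 - q)(q h +
    -- 1), so the rounding errors of many steps never exceed 1 in total.
    it-lower : ∀ k m → (1# - q) ^ k * (q * fromℕ m + 1#) ≤ q * fromℕ (it k m) + 1#
    it-lower zero    m = ≤-via (≤.reflexive (R.refl {0#}))
      (solve 2 (λ q v1 → q :* v1 :+ :1 :- :1 :* (q :* v1 :+ :1) := :0 :- :0) R.refl q (fromℕ m))
    it-lower (suc k) m = ≤-via ((it-lower k (f m)) ⊕ (*-monoˡ (^-nonneg k 1-q≥0) ≤fm))
      (solve 5 (λ v1 q v2 v3 v4 → q :* v3 :+ :1 :- (:1 :- q) :* v1 :* (q :* v4 :+ :1) :=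
      q :* v3 :+ :1 :+ v1 :* (q :* v2 :+ :1) :- (v1 :* (q :* v2 :+ :1) :+ v1 :*
      ((:1 :- q) :* (q :* v4 :+ :1)))) R.refl ((1# - q) ^ k) q (fromℕ (f m)) (fromℕ (it k (f m)))
      (fromℕ m))
      where
      ≤fm : (1# - q) * (q * fromℕ m + 1#) ≤ q * fromℕ (f m) + 1#
      ≤fm = ≤-via ((*-monoˡ q≥0 (picked-lb m)) ⊕ (≤.reflexive (R.sym (R.*-congˡ {q} (fromℕ-f m)))))
        (solve 4 (λ q v1 v2 v3 → q :* v3 :+ :1 :- (:1 :- q) :* (q :* v2 :+ :1) :=
        q :* (q :* v2 :+ :1) :+ q :* v3 :- (q :* v1 :+ q :* (v2 :- v1))) R.refl q
        (fromℕ (picked q m)) (fromℕ m) (fromℕ (f m)))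

    f-slow : ∀ h → q * fromℕ h ≤ 1# → f h ≡ h ∸ 1
    f-slow zero    p = f-0
    f-slow (suc h) p = ≡.cong (suc h ∸_) (⌈⌉-unique {q * fromℕ (suc h)} {0}
      (*-pos q>0 (fromℕ-pos h)) (≤.trans p (≤-via (≤.reflexive (R.refl {0#}))
      (solve 0 ((con (+ 1)) :- :1 := :0 :- :0) R.refl))))

    slow-pred : ∀ m → q * fromℕ m ≤ 1# → q * fromℕ (m ∸ 1) ≤ 1#
    slow-pred m p = ≤.trans (*-monoˡ q≥0 (fromℕ-mono (ℕ.m∸n≤m m 1))) p

    it-slow : ∀ k m → q * fromℕ m ≤ 1# → it k m ≡ m ∸ k
    it-slow zero    m p = ≡.refl
    it-slow (suc k) m p = ≡.trans (≡.cong (it k) (f-slow m p))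
      (≡.trans (it-slow k (m ∸ 1) (slow-pred m p)) (ℕ.∸-+-assoc m 1 k))

    N-slow : ∀ m → q * fromℕ m ≤ 1# → fromℕ 2 * fromℕ (N m) ≈ fromℕ m * (fromℕ m + 1#)
    N-slow zero    p = solve 0 (:2 :* :0 := :0 :* (:0 :+ :1)) R.refl
    N-slow (suc h) p = ≈-via ((1 ⊛≈ N≈) ⊕≈ (N-slow h (slow-pred (suc h) p)))
      (solve 3 (λ v1 v2 v3 → (:1 :+ v2) :* (:1 :+ v2 :+ :1) :- :2 :* v1 :=
      (con (+ 2)) :* (:1 :+ v2 :+ v3) :+ v2 :* (v2 :+ :1) :- ((con (+ 2)) :* v1 :+ :2 :* v3)) R.refl
      (fromℕ (N (suc h))) (fromℕ h) (fromℕ (N h)))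
      where
      N≈ : fromℕ (N (suc h)) ≈ fromℕ (suc h) + fromℕ (N h)
      N≈ = R.trans (fromℕ-cong (≡.trans (N-suc h) (≡.cong (λ g → suc h ℕ.+ N g)
        (f-slow (suc h) p)))) (fromℕ-+ (suc h) (N h))

    scaled-f : ∀ h → q * fromℕ (f h) ≈ q * fromℕ h - q * fromℕ ⌈ q * fromℕ h ⌉
    scaled-f h = R.trans (R.*-congˡ (fromℕ-f h)) (solve 3
      (λ q v1 v2 → q :* (v1 :- v2) := q :* v1 :- q :* v2) R.refl q (fromℕ h) (fromℕ (picked q h)))

    scaled-nonneg : ∀ h → 0# ≤ q * fromℕ h
    scaled-nonneg h = *-nonneg q≥0 (fromℕ-nonneg h)

    -- `A.P-step` with weight q λᵢ, summed over all piles down to height 0. The ℓ errors q² B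
    -- accumulate, whereas the crossing errors telescope to q B ⌈ q m ⌉; for this the bound B is
    -- kept fixed along the descent.
    area-total : ∀ m {B} → fromℕ ⌈ q * fromℕ m ⌉ ≤ B →
      A.P (q * fromℕ m) - q * q * fromℕ (N m) ◁ fromℕ (ℓ m) * (q * q * B) + q * B * fromℕ ⌈ q *
        fromℕ m ⌉
    area-total = f-rec _ base step
      where
      Goal : ℕ → Set
      Goal m = ∀ {B} → fromℕ ⌈ q * fromℕ m ⌉ ≤ B →
        A.P (q * fromℕ m) - q * q * fromℕ (N m) ◁ fromℕ (ℓ m) * (q * q * B) + q * B * fromℕ ⌈ q *
          fromℕ m ⌉

      base : Goal 0
      base {B} p = ◁-cong (R.sym zero≈) ((≤-via nn (solve 3
        (λ q B v1 → :0 :- (:- (:0 :* (q :* q :* B) :+ q :* B :* v1)) :=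
        :0 :* (q :* q :* B) :+ q :* B :* v1 :- :0) R.refl q B (fromℕ ⌈ q * 0# ⌉))) , nn)
        where
        zero≈ : A.P (q * 0#) - q * q * 0# ≈ 0#
        zero≈ = ≈-via ((A.P-cong {q * 0#} {0#} (solve 1 (λ q → q :* :0 := :0) R.refl q)) ⊕≈ A.P-0)
          (solve 3 (λ v1 v2 q → :0 :- (v1 :- q :* q :* :0) := v2 :+ :0 :- (v1 :+ v2)) R.refl
          (A.P (q * 0#)) (A.P 0#) q)
        nn : 0# ≤ 0# * (q * q * B) + q * B * fromℕ ⌈ q * 0# ⌉
        nn = ≤-via (*-nonneg (*-nonneg q≥0 (≤.trans (fromℕ-nonneg ⌈ q * 0# ⌉) p))
          (fromℕ-nonneg ⌈ q * 0# ⌉)) (solve 3 (λ q B v1 →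
          :0 :* (q :* q :* B) :+ q :* B :* v1 :- :0 := q :* B :* v1 :- :0) R.refl q B
          (fromℕ ⌈ q * 0# ⌉))

      step : ∀ h → Goal (f (suc h)) → Goal (suc h)
      step h ih {B} p = ◁-cong
          (≈-via (R.*-congˡ {q * q} (R.trans (fromℕ-cong (N-suc h)) (fromℕ-+ (suc h) (N g))))
            (solve 6 (λ q v1 v2 v3 v4 v5 → v4 :- q :* q :* v1 :-
            (v4 :- v5 :- q :* (q :* (:1 :+ v2)) :+ (v5 :- q :* q :* v3)) :=
            q :* q :* (:1 :+ v2 :+ v3) :- q :* q :* v1) R.refl q (fromℕ (N (suc h))) (fromℕ h)
            (fromℕ (N g)) (A.P y) (A.P y′)))
          (◁-mono (≤-via (≤.reflexive (R.sym (R.*-congʳ {q * q * B} (fromℕ-cong (ℓ-suc h)))))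
            (solve 6 (λ v1 q B v2 Y Y′ → v1 :* (q :* q :* B) :+ q :* B :* Y :-
            (q :* q :* B :+ q :* B :* (Y :- Y′) :+ (v2 :* (q :* q :* B) :+ q :* B :* Y′)) :=
            v1 :* (q :* q :* B) :- (:1 :+ v2) :* (q :* q :* B)) R.refl (fromℕ (ℓ (suc h))) q B
            (fromℕ (ℓ g)) Y Y′))
            (◁-+ one (ih (≤.trans Y′≤Y p))))
        where
        g = f (suc h)
        y = q * fromℕ (suc h)
        y′ = q * fromℕ g
        Y = fromℕ ⌈ y ⌉
        Y′ = fromℕ ⌈ y′ ⌉
        Y′≤Y : Y′ ≤ Y
        Y′≤Y = fromℕ-mono (⌈⌉-mono (*-monoˡ q≥0 (fromℕ-mono (f-≤ (suc h)))))
        one : A.P y - A.P y′ - q * y ◁ q * q * B + q * B * (Y - Y′)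
        one = A.P-step (scaled-nonneg g) q>0 (*-pos q>0 (fromℕ-pos h)) (scaled-f (suc h)) p
          (scaled-nonneg (suc h)) (≤.trans (⌈⌉-ub y) p)
                (λ i _ _ _ e → area-law q i e q≥0)

    it-beyond : ∀ k m → ℓ m ℕ.≤ k → it k m ≡ 0
    it-beyond k       zero    p = it-0 k
    it-beyond zero    (suc h) p = ⊥-elim (ℕ.1+n≰n (ℕ.≤-trans (≡.subst (ℕ._≤ 0) (ℓ-suc h) p) ℕ.z≤n))
    it-beyond (suc k) (suc h) p = it-beyond k (f (suc h))
      (ℕ.≤-pred (≡.subst (ℕ._≤ suc k) (ℓ-suc h) p))

    -- The analogue of `area-total` with weight 1. The condition k ≤ ℓ m keeps the height positive
    -- before each of the k steps; at height 0 no time would elapse.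
    time-total : ∀ k m {B} → k ℕ.≤ ℓ m → fromℕ ⌈ q * fromℕ m ⌉ ≤ B →
      τ.P (q * fromℕ m) - τ.P (q * fromℕ (it k m)) - q * fromℕ k ◁ fromℕ k * (q * q * B) + q * B *
        fromℕ ⌈ q * fromℕ m ⌉
    time-total zero m {B} _ p = ◁-cong (solve 2 (λ v1 q → :0 := v1 :- v1 :- q :* :0) R.refl
      (τ.P (q * fromℕ m)) q)
        ((≤-via nn (solve 3 (λ q B Y → :0 :- (:- (:0 :* (q :* q :* B) :+ q :* B :* Y)) :=
          q :* B :* Y :- :0) R.refl q B Y)) , (≤-via nn (solve 3
          (λ q B Y → :0 :* (q :* q :* B) :+ q :* B :* Y :- :0 := q :* B :* Y :- :0) R.refl q B Y)))
      where
      Y = fromℕ ⌈ q * fromℕ m ⌉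
      nn : 0# ≤ q * B * Y
      nn = *-nonneg (*-nonneg q≥0 (≤.trans (fromℕ-nonneg ⌈ q * fromℕ m ⌉) p))
        (fromℕ-nonneg ⌈ q * fromℕ m ⌉)
    time-total (suc k) (suc h) {B} k< p = ◁-cong
        (solve 5 (λ v1 v2 q v3 v4 → v1 :- v2 :- q :* :1 :+ (v2 :- v3 :- q :* v4) :=
          v1 :- v3 :- q :* (:1 :+ v4)) R.refl (τ.P y) (τ.P y′) q
          (τ.P (q * fromℕ (it k (f (suc h))))) (fromℕ k))
        (◁-mono (≤-via (≤.reflexive (R.refl {0#})) (solve 5
          (λ q B Y Y′ v1 → (:1 :+ v1) :* (q :* q :* B) :+ q :* B :* Y :-
          (q :* q :* B :+ q :* B :* (Y :- Y′) :+ (v1 :* (q :* q :* B) :+ q :* B :* Y′)) := :0 :- :0)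
          R.refl q B Y Y′ (fromℕ k)))
          (◁-+ one (time-total k g (ℕ.≤-pred (≡.subst (suc k ℕ.≤_) (ℓ-suc h) k<))
            (≤.trans Y′≤Y p))))
      where
      g = f (suc h)
      y = q * fromℕ (suc h)
      y′ = q * fromℕ g
      Y = fromℕ ⌈ y ⌉
      Y′ = fromℕ ⌈ y′ ⌉
      Y′≤Y : Y′ ≤ Y
      Y′≤Y = fromℕ-mono (⌈⌉-mono (*-monoˡ q≥0 (fromℕ-mono (f-≤ (suc h)))))
      1≤B : 1# ≤ B
      1≤B = ≤.trans (≤-via (≤.reflexive (R.refl {0#})) (solve 0 (:1 :+ :0 :- :1 := :0 :- :0)
        R.refl)) (≤.trans (fromℕ-mono (picked-pos (suc h) (ℕ.s≤s ℕ.z≤n))) p)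
      one : τ.P y - τ.P y′ - q * 1# ◁ q * q * B + q * B * (Y - Y′)
      one = τ.P-step (scaled-nonneg g) q>0 (*-pos q>0 (fromℕ-pos h)) (scaled-f (suc h)) p
        (proj₁ 0<1) 1≤B
              (λ i _ _ _ e → time-law q i e q≥0)

  -- Powers (1 - q) ^ k and the exponential function

  module Powers where
    iv : ℕ → Carrier
    iv j = fromℕ (suc j) ⁻¹

    private
      iv-cancel : ∀ j → fromℕ (suc j) * iv j ≈ 1#
      iv-cancel j = inv-cancel (fromℕ-pos j)

      iv-scale : ∀ j x → fromℕ (suc j) * (x * iv j) ≈ x
      iv-scale j x = ≈-via (R.*-congˡ {x} (iv-cancel j))
        (solve 3 (λ x v1 v2 → x :- (:1 :+ v1) :* (x :* v2) := x :* :1 :- x :* ((:1 :+ v1) :* v2))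
        R.refl x (fromℕ j) (iv j))

    -- u ^ j / j !
    W : ℕ → Carrier → Carrier
    W zero    u = 1#
    W (suc j) u = W j u * u * iv j

    W-nonneg : ∀ j {u} → 0# ≤ u → 0# ≤ W j u
    W-nonneg zero    p = proj₁ 0<1
    W-nonneg (suc j) p = *-nonneg (*-nonneg (W-nonneg j p) p) (proj₁ (inv-pos (fromℕ-pos j)))

    W-mono : ∀ j {u v} → 0# ≤ u → u ≤ v → W j u ≤ W j v
    W-mono zero    p q = ≤.refl
    W-mono (suc j) {u} {v} p q = cancel-≤ (fromℕ-pos j)
      (≤-via ((≤.reflexive (iv-scale j (W j u * u))) ⊕ (≤.reflexive
        (R.sym (iv-scale j (W j v * v)))) ⊕ (*-monoˡ (W-nonneg j p) q) ⊕
        (*-monoˡ (≤.trans p q) (W-mono j p q))) (solve 6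
        (λ v1 v2 u v3 v4 v → (:1 :+ v1) :* (v4 :* v :* v3) :- (:1 :+ v1) :* (v2 :* u :* v3) :=
        v2 :* u :+ (:1 :+ v1) :* (v4 :* v :* v3) :+ v2 :* v :+ v :* v4 :-
        ((:1 :+ v1) :* (v2 :* u :* v3) :+ v4 :* v :+ v2 :* u :+ v :* v2)) R.refl (fromℕ j) (W j u) u
        (iv j) (W j v) v))

    -- The left side consists of the first two terms of the binomial expansion of (u + q) ^ (j + 1)
    -- / (j + 1)!.
    W-shift : ∀ j {u q} → 0# ≤ u → 0# ≤ q → W (suc j) u + q * W j u ≤ W (suc j) (u + q)
    W-shift zero {u} {q} p r = ≤-via (≤.reflexive (R.sym (R.*-congˡ {q} (iv-scale 0 1#))))
      (solve 3 (λ v1 q u → :1 :* (u :+ q) :* v1 :- (:1 :* u :* v1 :+ q :* :1) :=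
      q :* ((:1 :+ :0) :* (:1 :* v1)) :- q :* :1) R.refl (iv 0) q u)
    W-shift (suc j) {u} {q} p r = cancel-≤ (fromℕ-pos (suc j))
      (≤-via ((≤.reflexive (iv-scale (suc j) (w₁ * u))) ⊕
        (≤.reflexive (R.sym (iv-scale (suc j) (w₂ * (u + q))))) ⊕
        (≤.reflexive (R.*-congˡ {q} (iv-scale j (w₀ * u)))) ⊕
        (*-nonneg (*-nonneg r r) (W-nonneg j p)) ⊕ (*-monoˡ
        (≤-resp (solve 0 (:0 :+ :0 := :0) R.refl) R.refl (p ⊕ r)) (W-shift j p r)))
        (solve 7 (λ v1 w₁ u v2 w₂ q w₀ → (:1 :+ (:1 :+ v1)) :* (w₂ :* (u :+ q) :* v2) :-
        (:1 :+ (:1 :+ v1)) :* (w₁ :* u :* v2 :+ q :* w₁) :=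
        w₁ :* u :+ (:1 :+ (:1 :+ v1)) :* (w₂ :* (u :+ q) :* v2) :+ q :* (w₀ :* u) :+ q :* q :* w₀ :+
        (u :+ q) :* w₂ :- ((:1 :+ (:1 :+ v1)) :* (w₁ :* u :* v2) :+ w₂ :* (u :+ q) :+ q :*
        ((:1 :+ v1) :* w₁) :+ :0 :+ (u :+ q) :* (w₁ :+ q :* w₀))) R.refl (fromℕ j) w₁ u (iv (suc j))
        w₂ q w₀))
      where
      w₀ = W j u
      w₁ = W (suc j) u
      w₂ = W (suc j) (u + q)

    -- From index M₀ ≥ X on, the factors X / (M + 1) are at most 1, so the terms stay below K. One
    -- more factor then gives at most K X / (M + 1), which is below ε once M ≥ K X / ε.
    W→0 : ∀ {X} → 0# ≤ X → (λ M → W M X) ⇝ 0#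
    W→0 {X} X≥0 ε ε>0 = suc (M₀ ℕ.+ M₁) , bound
      where
      M₀ = proj₁ (archimedean X)
      K = W M₀ X
      K≥0 = W-nonneg M₀ X≥0
      M₁ = proj₁ (archimedean (K * X / ε))

      bounded : ∀ d → W (d ℕ.+ M₀) X ≤ K
      bounded zero    = ≤.refl
      bounded (suc d) = ≤.trans (cancel-≤ (fromℕ-pos M)
          (≤-via ((≤.reflexive (iv-scale M (W M X * X))) ⊕ (*-monoˡ (W-nonneg M X≥0) X≤))
            (solve 4 (λ v1 v2 X v3 → (:1 :+ v1) :* v2 :- (:1 :+ v1) :* (v2 :* X :* v3) :=
            v2 :* X :+ v2 :* (:1 :+ v1) :- ((:1 :+ v1) :* (v2 :* X :* v3) :+ v2 :* X)) R.refl
            (fromℕ M) (W M X) X (iv M)))) (bounded d)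
        where
        M = d ℕ.+ M₀
        X≤ : X ≤ fromℕ (suc M)
        X≤ = ≤.trans (proj₂ (archimedean X)) (fromℕ-mono (ℕ.m≤n⇒m≤1+n (ℕ.m≤n+m M₀ d)))

      small : ∀ M → M₀ ℕ.+ M₁ ℕ.≤ M → W (suc M) X ≤ ε
      small M p = cancel-≤ (fromℕ-pos M)
        (≤-via ((≤.reflexive (iv-scale M (W M X * X))) ⊕ (*-monoˡ X≥0 W≤K) ⊕
          (≤.reflexive (R.sym (/-cancel {K * X} ε>0))) ⊕
          (*-monoˡ (proj₁ ε>0) (≤.trans (proj₂ (archimedean (K * X / ε)))
          (fromℕ-mono (ℕ.≤-trans (ℕ.m≤n+m M₁ M₀) p)))) ⊕ (proj₁ ε>0))
          (solve 7 (λ v1 v2 X v3 K v4 ε → (:1 :+ v1) :* ε :- (:1 :+ v1) :* (v2 :* X :* v3) :=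
          v2 :* X :+ X :* K :+ v4 :* ε :+ ε :* v1 :+ ε :-
          ((:1 :+ v1) :* (v2 :* X :* v3) :+ X :* v2 :+ K :* X :+ ε :* v4 :+ :0)) R.refl (fromℕ M)
          (W M X) X (iv M) K (K * X / ε) ε))
        where
        W≤K : W M X ≤ K
        W≤K = ≡.subst (λ m → W m X ≤ K) (ℕ.m∸n+n≡m (ℕ.≤-trans (ℕ.m≤m+n M₀ M₁) p)) (bounded (M ∸ M₀))

      bound : ∀ M → suc (M₀ ℕ.+ M₁) ℕ.≤ M → W M X - 0# ◁ ε
      bound (suc M) (ℕ.s≤s p) = (≤-via ((W-nonneg (suc M) X≥0) ⊕ (proj₁ ε>0))
        (solve 2 (λ v1 ε → v1 :- :0 :- (:- ε) := v1 :+ ε :- (:0 :+ :0)) R.refl (W (suc M) X) ε)) ,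
                                (≤-via (small M p) (solve 2 (λ v1 ε → ε :- (v1 :- :0) := ε :- v1)
                                  R.refl (W (suc M) X) ε))

    -- The terms (k choose j) (- q) ^ j of the binomial expansion of (1 - q) ^ k.
    D : Carrier → ℕ → ℕ → Carrier
    D q zero    k = 1#
    D q (suc j) k = D q j k * (fromℕ j * q - q * fromℕ k) * iv j

    partial : Carrier → ℕ → ℕ → Carrier
    partial q zero    k = 0#
    partial q (suc M) k = partial q M k + D q M k

    pascal : ∀ q j k → D q (suc j) (suc k) ≈ D q (suc j) k - q * D q j k
    pascal q zero k = ≈-via (R.sym (R.*-congˡ {q} (iv-scale 0 1#)))
      (solve 3 (λ v1 q v2 → :1 :* (:0 :* q :- q :* v2) :* v1 :- q :* :1 :- :1 :*
      (:0 :* q :- q :* (:1 :+ v2)) :* v1 := q :* ((:1 :+ :0) :* (:1 :* v1)) :- q :* :1) R.refl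
      (iv 0) q (fromℕ k))
    pascal q (suc i) k = cancel-≈ (fromℕ-pos (suc i))
      (≈-via ((iv-scale (suc i) (D q (suc i) (suc k) * (fromℕ (suc i) * q - q * fromℕ (suc k)))) ⊕≈
        (R.sym (iv-scale (suc i) (D q (suc i) k * (fromℕ (suc i) * q - q * fromℕ k)))) ⊕≈
        (R.*-congʳ {fromℕ (suc i) * q - q * fromℕ (suc k)} (pascal q i k)) ⊕≈
        (R.*-congˡ {q} (iv-scale i (d₀ * (fromℕ i * q - q * fromℕ k)))))
        (solve 7 (λ v1 d₁′ q v2 v3 d₁ d₀ → (:1 :+ (:1 :+ v1)) :*
        (d₁ :* ((:1 :+ v1) :* q :- q :* v2) :* v3 :- q :* d₁) :- (:1 :+ (:1 :+ v1)) :*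
        (d₁′ :* ((:1 :+ v1) :* q :- q :* (:1 :+ v2)) :* v3) :=
        d₁′ :* ((:1 :+ v1) :* q :- q :* (:1 :+ v2)) :+ (:1 :+ (:1 :+ v1)) :*
        (d₁ :* ((:1 :+ v1) :* q :- q :* v2) :* v3) :+ (d₁ :- q :* d₀) :*
        ((:1 :+ v1) :* q :- q :* (:1 :+ v2)) :+ q :* (d₀ :* (v1 :* q :- q :* v2)) :-
        ((:1 :+ (:1 :+ v1)) :* (d₁′ :* ((:1 :+ v1) :* q :- q :* (:1 :+ v2)) :* v3) :+ d₁ :*
        ((:1 :+ v1) :* q :- q :* v2) :+ d₁′ :* ((:1 :+ v1) :* q :- q :* (:1 :+ v2)) :+ q :*
        ((:1 :+ v1) :* d₁))) R.refl (fromℕ i) d₁′ q (fromℕ k) (iv (suc i)) d₁ d₀))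
      where
      d₀ = D q i k
      d₁ = D q (suc i) k
      d₁′ = D q (suc i) (suc k)

    D-0 : ∀ q j → D q (suc j) 0 ≈ 0#
    D-0 q zero    = solve 2 (λ q v1 → :1 :* (:0 :* q :- q :* :0) :* v1 := :0) R.refl q (iv 0)
    D-0 q (suc j) = R.trans (R.*-congʳ (R.*-congʳ (D-0 q j)))
      (solve 3 (λ v1 q v2 → :0 :* ((:1 :+ v1) :* q :- q :* :0) :* v2 := :0) R.refl (fromℕ j) q
      (iv (suc j)))

    partial-0 : ∀ q M → partial q (suc M) 0 ≈ 1#
    partial-0 q zero    = solve 0 (:0 :+ :1 := :1) R.refl
    partial-0 q (suc M) = R.trans (R.+-cong (partial-0 q M) (D-0 q M))
      (solve 0 (:1 :+ :0 := :1) R.refl)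

    -- Pascal's rule summed over the degrees. It mirrors (1 - q) ^ (k + 1) = (1 - q) ^ k - q (1 - q)
    -- ^ k, with one degree lost in the second term.
    partial-suc : ∀ q M k → partial q (suc M) (suc k) ≈ partial q (suc M) k - q * partial q M k
    partial-suc q zero    k = solve 1 (λ q → :0 :+ :1 := :0 :+ :1 :- q :* :0) R.refl q
    partial-suc q (suc M) k = ≈-via ((partial-suc q M k) ⊕≈ (pascal q M k))
      (solve 7 (λ p₁′ p₁ q v1 d₁′ d₁ v2 → p₁ :+ d₁ :- q :* (v1 :+ v2) :- (p₁′ :+ d₁′) :=
      p₁ :- q :* v1 :+ (d₁ :- q :* v2) :- (p₁′ :+ d₁′)) R.refl p₁′ p₁ q (partial q M k) d₁′ d₁
      (D q M k))
      where
      p₁ = partial q (suc M) k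
      p₁′ = partial q (suc M) (suc k)
      d₁ = D q (suc M) k
      d₁′ = D q (suc M) (suc k)

    power-bounds : ∀ {q} → 0# ≤ q → q ≤ 1# → ∀ k → 0# ≤ (1# - q) ^ k × (1# - q) ^ k ≤ 1#
    power-bounds q≥0 q≤1 zero    = proj₁ 0<1 , ≤.refl
    power-bounds {q} q≥0 q≤1 (suc k) = let lo , hi = power-bounds q≥0 q≤1 k in
      *-nonneg (≤-shift q≤1) lo ,
      (≤-via (hi ⊕ (*-nonneg q≥0 lo)) (solve 2 (λ v1 q → :1 :- (:1 :- q) :* v1 :=
        :1 :+ q :* v1 :- (v1 :+ :0)) R.refl ((1# - q) ^ k) q))

    -- By `partial-suc` the remainders satisfy R (M + 1, k + 1) = R (M + 1, k) - q R (M, k), and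
    -- `W-shift` says that the bounds add up accordingly. The result is a Taylor bound obtained
    -- without derivatives.
    binomial-remainder : ∀ {q} → 0# ≤ q → q ≤ 1# → ∀ M k → (1# - q) ^ k - partial q M k ◁ W M
      (q * fromℕ k)
    binomial-remainder {q} q≥0 q≤1 zero k = let lo , hi = power-bounds q≥0 q≤1 k in
      (≤-via (lo ⊕ (proj₁ 0<1)) (solve 1 (λ v1 → v1 :- :0 :- (:- :1) := v1 :+ :1 :- (:0 :+ :0))
        R.refl ((1# - q) ^ k))) , (≤-via hi (solve 1 (λ v1 → :1 :- (v1 :- :0) := :1 :- v1) R.refl
        ((1# - q) ^ k)))
    binomial-remainder {q} q≥0 q≤1 (suc M) zero =
      (≤-via ((≤.reflexive (partial-0 q M)) ⊕ w≥0) (solve 2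
        (λ p₁ w → :1 :- p₁ :- (:- w) := :1 :+ w :- (p₁ :+ :0)) R.refl p₁ w)) ,
        (≤-via ((≤.reflexive (R.sym (partial-0 q M))) ⊕ w≥0)
        (solve 2 (λ p₁ w → w :- (:1 :- p₁) := p₁ :+ w :- (:1 :+ :0)) R.refl p₁ w))
      where
      p₁ = partial q (suc M) 0
      w = W (suc M) (q * 0#)
      w≥0 : 0# ≤ w
      w≥0 = W-nonneg (suc M) (*-nonneg q≥0 ≤.refl)
    binomial-remainder {q} q≥0 q≤1 (suc M) (suc k) = ◁-cong
      (≈-via (partial-suc q M k) (solve 5 (λ v1 v2 q v3 v4 →
        (:1 :- q) :* v4 :- v1 :- (v4 :- v2 :+ (:- (q :* (v4 :- v3)))) := v2 :- q :* v3 :- v1) R.refl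
        (partial q (suc M) (suc k)) (partial q (suc M) k) q (partial q M k) ((1# - q) ^ k)))
      (◁-mono (≤.trans (W-shift M u≥0 q≥0) (W-mono (suc M)
        (≤-via (u≥0 ⊕ q≥0) (solve 2 (λ q v1 → q :* v1 :+ q :- :0 := q :* v1 :+ q :- (:0 :+ :0))
        R.refl q (fromℕ k))) (≤-via (≤.reflexive (R.refl {0#}))
        (solve 2 (λ q v1 → q :* (:1 :+ v1) :- (q :* v1 :+ q) := :0 :- :0) R.refl q (fromℕ k)))))
        (◁-+ (binomial-remainder q≥0 q≤1 (suc M) k) (◁--
          (◁-* ((≤-via (1 ⊛ q≥0) (solve 1 (λ q → q :- (:- q) :=
          (con (+ 2)) :* q :- (con (+ 2)) :* :0) R.refl q)) , ≤.refl {x = q})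
          (binomial-remainder q≥0 q≤1 M k)))))
      where
      u≥0 : 0# ≤ q * fromℕ k
      u≥0 = *-nonneg q≥0 (fromℕ-nonneg k)

    -- Exhibiting any limit rules out the default branch; the value is then the limit that excluded
    -- middle happened to select.
    lim-spec : ∀ {s L} → s ⟶ L → s ⟶ lim s
    lim-spec {s} {L} h with lem {∃ λ L → s ⟶ L}
    ... | yes (_ , k) = k
    ... | no ¬k = ⊥-elim (¬k (L , h))

    -- The termwise limit of `D` as q → 0 and q k → x, that is (- x) ^ j / j !. Keeping the
    -- recursive shape of `D` makes the convergence follow factor by factor.
    d : Carrier → ℕ → Carrier
    d x zero    = 1#
    d x (suc j) = d x j * (fromℕ j * 0# - x) * iv j

    S : Carrier → ℕ → Carrier
    S x zero    = 0#
    S x (suc M) = S x M + d x M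

    !-pos : ∀ j → 0# < fromℕ (j !)
    !-pos zero    = fromℕ-pos 0
    !-pos (suc j) = <-resp R.refl (R.sym (fromℕ-* (suc j) (j !))) (*-pos (fromℕ-pos j) (!-pos j))

    d-power : ∀ x j → d x j * fromℕ (j !) ≈ (- x) ^ j
    d-power x zero    = solve 0 (:1 :* (:1 :+ :0) := :1) R.refl
    d-power x (suc j) = ≈-via ((R.*-congˡ {d x (suc j)} (fromℕ-* (suc j) (j !))) ⊕≈
      (R.*-congˡ {fromℕ (j !)} (iv-scale j (d x j * (fromℕ j * 0# - x)))) ⊕≈
      (R.*-congˡ { - x} (d-power x j))) (solve 7 (λ d₁ v1 v2 v3 v4 x v5 →
      (:- x) :* v5 :- d₁ :* v1 := d₁ :* ((:1 :+ v2) :* v3) :+ v3 :* (v4 :* (v2 :* :0 :- x)) :+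
      (:- x) :* v5 :- (d₁ :* v1 :+ v3 :* ((:1 :+ v2) :* d₁) :+ (:- x) :* (v4 :* v3))) R.refl d₁
      (fromℕ (suc j !)) (fromℕ j) (fromℕ (j !)) (d x j) x ((- x) ^ j))
      where d₁ = d x (suc j)

    S-series : ∀ x M → S x M ≈ ∑[ k < M ] ((- x) ^ toℕ k / fromℕ (toℕ k !))
    S-series x zero    = R.refl
    S-series x (suc M) = R.trans (R.+-cong (S-series x M) (≈-/ (!-pos M) (d-power x M)))
      (R.sym (∑-snoc (λ k → (- x) ^ k / fromℕ (k !)) M))

    module Exponential (q : ℕ → Carrier) (k : ℕ → ℕ) (x : Carrier)
      (q≥0 : ∀ n → 0# ≤ q n) (q≤1 : ∀ n → q n ≤ 1#) (q→0 : q ⇝ 0#)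
      (qk→x : (λ n → q n * fromℕ (k n)) ⇝ x) (x≥0 : 0# ≤ x)
      where

      private
        -- Eventually q k < X, so the remainder bound `W M X` no longer depends on n.
        X = x + 1#
        X≥0 : 0# ≤ X
        X≥0 = ≤-via (x≥0 ⊕ (proj₁ 0<1)) (solve 1 (λ x → x :+ :1 :- :0 := x :+ :1 :- (:0 :+ :0))
          R.refl x)
        e : ℕ → Carrier
        e n = (1# - q n) ^ k n

      D→d : ∀ j → (λ n → D (q n) j (k n)) ⇝ d x j
      D→d zero    = ⇝-const 1#
      D→d (suc j) = ⇝-* (⇝-* (D→d j) (⇝-+ (⇝-scale (fromℕ j) q→0) (⇝-neg qk→x))) (⇝-const (iv j))

      partial→S : ∀ M → (λ n → partial (q n) M (k n)) ⇝ S x M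
      partial→S zero    = ⇝-const 0#
      partial→S (suc M) = ⇝-+ (partial→S M) (D→d M)

      remainder : ∀ M → Eventually (λ n → e n - partial (q n) M (k n) ◁ W M X)
      remainder M = ev-map (λ n u<X → ◁-mono (W-mono M (*-nonneg (q≥0 n) (fromℕ-nonneg (k n)))
        (proj₁ u<X)) (binomial-remainder (q≥0 n) (q≤1 n) M (k n)))
        (⇝-upper qk→x (<-via 0<1 (solve 1 (λ x → x :+ :1 :- x := :1 :- :0) R.refl x)))

      -- Both partial sums are limits of truncations that lie within `W M X` and `W M′ X` of the
      -- same power `e n`. Thus the powers themselves show that the exponential series is Cauchy.
      tail-bound : ∀ M M′ → S x M - S x M′ ≤ W M X + W M′ X
      tail-bound M M′ = ≮⇒≥ λ lt →
        let N , h = ⇝-lower (⇝-+ (partial→S M) (⇝-neg (partial→S M′))) lt ∩ remainder M ∩ remainder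
              M′
            r , (r₁ , _) , (_ , r₂) = h N ℕ.≤-refl
        in (⊥-by (r ⊞ r₁ ⊞ r₂) (solve 5 (λ v1 v2 v3 v4 v5 → v1 :+ v2 :+ (:- v1) :+ (v5 :- v4) :=
          v3 :+ (:- v4) :+ (v5 :- v3) :+ v2) R.refl (W M X) (W M′ X) (partial (q N) M (k N))
          (partial (q N) M′ (k N)) (e N)))

      S-cauchy : Cauchy (S x)
      S-cauchy ε ε>0 =
        let δ , δ>0 , 2δ = half ε>0
            N , h = W→0 X≥0 δ δ>0
        in N , λ m n N≤m N≤n →
             (≤-via ((tail-bound m n) ⊕ (proj₂ (h m N≤m)) ⊕ (proj₂ (h n N≤n)) ⊕ (≤.reflexive 2δ))
               (solve 6 (λ v1 v2 v3 v4 δ ε → ε :- (v1 :- v2) :=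
               v3 :+ v4 :+ δ :+ δ :+ ε :- (v1 :- v2 :+ (v3 :- :0) :+ (v4 :- :0) :+ :2 :* δ)) R.refl
               (S x m) (S x n) (W m X) (W n X) δ ε))

      S→exp : S x ⇝ exp (- x)
      S→exp = ⇝-cong (0 , λ M _ → R.sym (S-series x M)) (⟶⇒⇝ (lim-spec (⇝⇒⟶
        (⇝-cong (0 , λ M _ → S-series x M) (proj₂ (cauchy-converges S-cauchy))))))

      power→exp : e ⇝ exp (- x)
      power→exp ε ε>0 =
        let δ , δ>0 , 2δ = half ε>0
            η , η>0 , 2η = half δ>0
            -- M is fixed before n. The remainder, the truncation and the tail of the series then
            -- cost at most η = ε / 4 each.
            M , h = W→0 X≥0 η η>0 ∩ S→exp η η>0
            (_ , w) , s = h M ℕ.≤-refl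
        in ev-map (λ n (a , b) → ◁-cong (solve 4 (λ v1 v2 v3 v4 →
          v1 :- v2 :+ (v2 :- v3 :+ (v3 :- v4)) := v1 :- v4) R.refl (e n) (partial (q n) M (k n))
          (S x M) (exp (- x)))
               (◁-mono (≤-via (w ⊕ (proj₁ η>0) ⊕ (1 ⊛ (≤.reflexive 2η)) ⊕ (≤.reflexive 2δ))
                 (solve 4 (λ v1 η δ ε → ε :- (v1 :+ (η :+ η)) :=
                 η :+ η :+ (con (+ 2)) :* δ :+ ε :- (v1 :- :0 :+ :0 :+ (con (+ 2)) :* (:2 :* η) :+
                 :2 :* δ)) R.refl (W M X) η δ ε))
                 (◁-+ a (◁-+ b s))))
             (remainder M ∩ partial→S M η η>0)

  open Powers using (module Exponential)

  -- The three regimes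

  ⊔0-lipschitz : ∀ {a b ε} → a - b ◁ ε → a ⊔ 0# - (b ⊔ 0#) ◁ ε
  ⊔0-lipschitz {a} {b} {ε} (p , q) =
      (≤-via (below {b} {a} (≤-via p (solve 3 (λ ε a b → a :+ ε :- b := a :- b :- (:- ε)) R.refl ε a
        b)) ε≥0) (solve 3 (λ v1 v2 ε → v2 :- v1 :- (:- ε) := v2 :+ ε :- v1) R.refl (b ⊔ 0#) (a ⊔ 0#)
        ε)) ,
      (≤-via (below {a} {b} (≤-via q (solve 3 (λ a b ε → b :+ ε :- a := ε :- (a :- b)) R.refl a b
        ε)) ε≥0) (solve 3 (λ v1 v2 ε → ε :- (v1 :- v2) := v2 :+ ε :- v1) R.refl (a ⊔ 0#) (b ⊔ 0#)
        ε))
    where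
    ε≥0 : 0# ≤ ε
    ε≥0 = ≤-by 1 (p ⊕ q) (solve 3 (λ ε a b → (con (+ 2)) :* (ε :- :0) :=
      a :- b :+ ε :- ((:- ε) :+ (a :- b))) R.refl ε a b)
    below : ∀ {x y} → x ≤ y + ε → 0# ≤ ε → x ⊔ 0# ≤ y ⊔ 0# + ε
    below {x} {y} p q = ⊔-lub (≤-via (p ⊕ (⊔-ub₁ y 0#)) (solve 4
      (λ x y ε v1 → v1 :+ ε :- x := y :+ ε :+ v1 :- (x :+ y)) R.refl x y ε (y ⊔ 0#)))
                              (≤-via (q ⊕ (⊔-ub₂ y 0#)) (solve 2
                                (λ ε v1 → v1 :+ ε :- :0 := ε :+ v1 :- (:0 :+ :0)) R.refl ε
                                (y ⊔ 0#)))

  ⇝-⊔0 : ∀ {s L} → s ⇝ L → (λ n → s n ⊔ 0#) ⇝ L ⊔ 0#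
  ⇝-⊔0 h ε ε>0 = ev-map (λ n → ⊔0-lipschitz) (h ε ε>0)

  fromℕ-∸-⊔ : ∀ m k → fromℕ (m ∸ k) ≈ (fromℕ m - fromℕ k) ⊔ 0#
  fromℕ-∸-⊔ m k with ℕ.≤-total k m
  ... | inj₁ k≤m = R.trans (fromℕ-∸ k≤m) (R.sym (⊔-absorb (≤-shift (fromℕ-mono k≤m))))
  ... | inj₂ m≤k = R.trans (fromℕ-cong (ℕ.m≤n⇒m∸n≡0 m≤k))
    (R.sym (⊔-absorbˡ (≤-via (fromℕ-mono m≤k) (solve 2 (λ v1 v2 → :0 :- (v1 :- v2) := v2 :- v1)
      R.refl (fromℕ m) (fromℕ k)))))

  -- Turns the bound on (ℓ q)² from `l²q²≤` into one on ℓ q without a square root.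
  ≤-square : ∀ t → t ≤ t * t + 1#
  ≤-square t = ≤-by 3 ((square-nonneg (fromℕ 2 * t - 1#)) ⊕ (2 ⊛ (proj₁ 0<1)))
    (solve 1 (λ t → (con (+ 4)) :* (t :* t :+ :1 :- t) :=
    (:2 :* t :- :1) :* (:2 :* t :- :1) :+ (con (+ 3)) :* :1 :- (:0 :+ (con (+ 3)) :* :0)) R.refl t)

  module Scaling (q : ℕ → Carrier) (q-bounds : ∀ n → 0# < q n × q n ≤ 1#) (q→0 : q ⇝ 0#) where

    q>0 : ∀ n → 0# < q n
    q>0 n = proj₁ (q-bounds n)
    q≥0 : ∀ n → 0# ≤ q n
    q≥0 n = proj₁ (q>0 n)
    q≤1 : ∀ n → q n ≤ 1#
    q≤1 n = proj₂ (q-bounds n)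
    module At (n : ℕ) = Proportion (q n) (q>0 n) (q≤1 n)

    n* : ℕ → ℕ
    n* n = proj₁ (largestStable (q n) n)

    conf : ∀ n → Stable (q n) (n* n)
    conf n = proj₂ (largestStable (q n) n)

    λ₁ : ℕ → ℕ
    λ₁ n = part (parts (proj₁ (conf n))) 0

    N m l : ℕ → Carrier
    N n = fromℕ (n* n)
    m n = fromℕ (λ₁ n)
    l n = fromℕ (At.ℓ n (λ₁ n))

    N≈ : ∀ n → N n ≈ fromℕ (At.N n (λ₁ n))
    N≈ n = fromℕ-cong (At.total-stable n (conf n))

    N≤n : ∀ n → N n ≤ fromℕ n
    N≤n n = fromℕ-mono (At.largest-upper n n)

    n≤N+l : ∀ n → fromℕ n ≤ N n + l n
    n≤N+l n = ≤.trans (fromℕ-mono (At.largest-lower n n))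
      (≤.reflexive (fromℕ-+ (n* n) (At.ℓ n (λ₁ n))))

    qN≤m : ∀ n → q n * N n ≤ m n
    qN≤m n = ≤.trans (≤.reflexive (R.*-congˡ (N≈ n))) (At.q*N≤ n (λ₁ n))

    m≤qN+l : ∀ n → m n ≤ q n * N n + l n
    m≤qN+l n = ≤.trans (At.≤q*N+ℓ n (λ₁ n)) (+-monoˡ-≤ (l n)
      (≤.reflexive (R.*-congˡ (R.sym (N≈ n)))))

    l²≤2N : ∀ n → l n * l n ≤ fromℕ 2 * N n
    l²≤2N n = ≤.trans (At.ℓ-square n (λ₁ n)) (≤.reflexive (R.*-congˡ (R.sym (N≈ n))))

    l≤N : ∀ n → l n ≤ N n
    l≤N n = fromℕ-mono (ℕ.≤-trans (ℓ≤N (At.ℓ n (λ₁ n)) (At.ℓ-bound n (λ₁ n)))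
      (ℕ.≤-reflexive (≡.sym (At.total-stable n (conf n)))))
      where
      ℓ≤N : ∀ ℓ {N} → ℓ ℕ.* suc ℓ ℕ.≤ 2 ℕ.* N → ℓ ℕ.≤ N
      ℓ≤N zero    p = ℕ.z≤n
      ℓ≤N (suc ℓ) p = ℕ.*-cancelˡ-≤ 2 (ℕ.≤-trans (ℕ.*-monoˡ-≤ (suc ℓ) (ℕ.s≤s (ℕ.s≤s (ℕ.z≤n {ℓ}))))
        (ℕ.≤-trans (ℕ.≤-reflexive (ℕ.*-comm (suc (suc ℓ)) (suc ℓ))) p))

    -- A crude comparison that suffices wherever n must be replaced by N in a divergence to
    -- infinity.
    n≤2N : ∀ n → fromℕ n ≤ fromℕ 2 * N n
    n≤2N n = ≤-via ((n≤N+l n) ⊕ (l≤N n)) (solve 3 (λ v1 v2 v3 → :2 :* v2 :- v1 :=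
      v2 :+ v3 :+ v2 :- (v1 :+ v3)) R.refl (fromℕ n) (N n) (l n))

    N→∞ : ∀ M → Eventually (λ n → M < N n)
    N→∞ M = suc k , λ n p → cancel-< (fromℕ-pos 1)
        (<-≤-trans (≤-<-trans (proj₂ (archimedean (fromℕ 2 * M))) (fromℕ-mono-< p)) (n≤2N n))
      where k = proj₁ (archimedean (fromℕ 2 * M))

    m>0 : Eventually (λ n → 0# < m n)
    m>0 = ev-map (λ n N>0 → <-≤-trans (*-pos (q>0 n) N>0) (qN≤m n)) (N→∞ 0#)

    nq² : ℕ → Carrier
    nq² n = fromℕ n * q n ^ 2

    Nq² : ℕ → Carrier
    Nq² n = N n * (q n * q n)

    Nq²≤ : ∀ n → Nq² n ≤ nq² n
    Nq²≤ n = ≤-via (*-monoˡ (*-nonneg (q≥0 n) (q≥0 n)) (N≤n n))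
      (solve 3 (λ v1 v2 v3 → v3 :* v1 :^ 2 :- v2 :* (v1 :* v1) := v1 :* v1 :* v3 :- v1 :* v1 :* v2)
      R.refl (q n) (N n) (fromℕ n))

    l²q²≤ : ∀ n → (l n * q n) * (l n * q n) ≤ fromℕ 2 * Nq² n
    l²q²≤ n = ≤-via (*-monoˡ (*-nonneg (q≥0 n) (q≥0 n)) (l²≤2N n))
      (solve 3 (λ v1 v2 v3 → :2 :* (v3 :* (v1 :* v1)) :- v2 :* v1 :* (v2 :* v1) :=
      v1 :* v1 :* (:2 :* v3) :- v1 :* v1 :* (v2 :* v2)) R.refl (q n) (l n) (N n))

    qm≤ : ∀ n → q n * m n ≤ Nq² n + l n * q n
    qm≤ n = ≤-via (*-monoˡ (q≥0 n) (m≤qN+l n)) (solve 4 (λ v1 v2 v3 v4 →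
      v3 :* (v1 :* v1) :+ v4 :* v1 :- v1 :* v2 := v1 :* (v1 :* v3 :+ v4) :- v1 :* v2) R.refl (q n)
      (m n) (N n) (l n))

    index : Carrier → ℕ → ℕ
    index x n = ⌊ x * N n / m n ⌋

    profile : Carrier → ℕ → Carrier
    profile x n = fromℕ (At.it n (index x n) (λ₁ n)) / m n

    profile-∂ : ∀ x n → profile x n ≈ ∂ (proj₁ (conf n)) x
    profile-∂ x n = R.reflexive (≡.cong (λ h → fromℕ h / m n)
      (≡.sym (At.part-it n (conf n) (index x n))))

    index-bounds : ∀ {x} n → 0# ≤ x → 0# < m n → fromℕ (index x n) ≤ x * N n / m n × x * N n / m n ≤
      fromℕ (index x n) + 1#
    index-bounds {x} n x≥0 m>0 = ⌊⌋-lb (*-nonneg (*-nonneg x≥0 (fromℕ-nonneg (n* n)))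
      (proj₁ (inv-pos m>0))) ,
      ≤.trans (proj₁ (⌊⌋-ub (x * N n / m n))) (≤.reflexive (R.+-comm 1# (fromℕ (index x n))))

    -- The floor changes x N / m by at most 1, hence the product with q by at most q → 0. The
    -- hypothesis on s is free of division, so that each regime can bring its own expression for q x
    -- N / m.
    q-index : ∀ {x s L} → 0# ≤ x → Eventually (λ n → s n * m n ≈ x * N n * q n) → s ⇝ L →
      (λ n → q n * fromℕ (index x n)) ⇝ L
    q-index {x} {s} {L} x≥0 e h = ⇝-resp (solve 1 (λ L → L :+ :0 := L) R.refl L)
      (⇝-cong (0 , λ n _ → (solve 2 (λ v1 v2 → v1 :+ (v2 :- v1) := v2) R.refl (s n)
      (q n * fromℕ (index x n))))
        (⇝-+ h (⇝-squeeze (ev-map (λ n (e , p) → bound n e p) (e ∩ m>0)) q→0)))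
      where
      bound : ∀ n → s n * m n ≈ x * N n * q n → 0# < m n → q n * fromℕ (index x n) - s n - 0# ◁ q n
      bound n e m>0 = (≤-via ((*-monoˡ (q≥0 n) (proj₂ b)) ⊕ (≤.reflexive e′))
        (solve 4 (λ v1 t v2 v3 → v1 :* v2 :- v3 :- :0 :- (:- v1) :=
        v1 :* (v2 :+ :1) :+ v1 :* t :- (v1 :* t :+ v3)) R.refl (q n) t (fromℕ (index x n)) (s n))) ,
                      (≤-via ((*-monoˡ (q≥0 n) (proj₁ b)) ⊕ (≤.reflexive (R.sym e′)) ⊕ (q≥0 n))
                        (solve 4 (λ v1 v2 t v3 → v1 :- (v1 :* v2 :- v3 :- :0) :=
                        v1 :* t :+ v3 :+ v1 :- (v1 :* v2 :+ v1 :* t :+ :0)) R.refl (q n)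
                        (fromℕ (index x n)) t (s n)))
        where
        b = index-bounds n x≥0 m>0
        t = x * N n / m n
        e′ : s n ≈ q n * t
        e′ = cancel-≈ m>0 (≈-via (e ⊕≈ (R.sym (R.*-congˡ {q n} (/-cancel {x * N n} m>0))))
          (solve 6 (λ v1 v2 x v3 v4 t → v2 :* (v4 :* t) :- v2 :* v1 :=
          x :* v3 :* v4 :+ v4 :* (t :* v2) :- (v1 :* v2 :+ v4 :* (x :* v3))) R.refl (s n) (m n) x
          (N n) (q n) t))

    -- n q² → 0: one card from every pile

    slow : nq² ⇝ 0# → Eventually (λ n → q n * m n ≤ 1#)
    -- With t = ℓ q one has q m ≤ N q² + t ≤ N q² + t² + 1/4 ≤ 3 N q² + 1/4, so n q² < 1/8 yields q
    -- m ≤ 5/8.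
    slow h = ev-map bound (⇝-upper h (inv-pos (fromℕ-pos 7)))
      where
      bound : ∀ n → nq² n < fromℕ 8 ⁻¹ → q n * m n ≤ 1#
      bound n p = ≤-by 7 ((7 ⊛ (qm≤ n)) ⊕ (7 ⊛ (l²q²≤ n)) ⊕ (23 ⊛ (Nq²≤ n)) ⊕ (23 ⊛ (proj₁ p)) ⊕
        (2 ⊛ (≤.reflexive (inv-cancel (fromℕ-pos 7)))) ⊕ (1 ⊛ (square-nonneg (fromℕ 2 * t - 1#))) ⊕
        (2 ⊛ (proj₁ 0<1))) (solve 6 (λ v1 v2 v3 t v4 v5 → (con (+ 8)) :* (:1 :- v1 :* v2) :=
        (con (+ 8)) :* (v3 :+ t) :+ (con (+ 8)) :* (:2 :* v3) :+ (con (+ 24)) :* v4 :+ (con (+ 24))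
        :* v5 :+ (con (+ 3)) :* :1 :+ (con (+ 2)) :* ((:2 :* t :- :1) :* (:2 :* t :- :1)) :+
        (con (+ 3)) :* :1 :- ((con (+ 8)) :* (v1 :* v2) :+ (con (+ 8)) :* (t :* t) :+ (con (+ 24))
        :* v3 :+ (con (+ 24)) :* v4 :+ (con (+ 3)) :* ((con (+ 8)) :* v5) :+ (con (+ 2)) :* :0 :+
        (con (+ 3)) :* :0)) R.refl (q n) (m n) (Nq² n) t (nq² n) (fromℕ 8 ⁻¹))
        where t = l n * q n

    triangular : nq² ⇝ 0# → ∀ x → 0# < x → profile x ⇝ triangle x
    triangular h x x>0 = ⇝-cong (ev-map (λ n (p , m>0) → R.sym (eq n p m>0)) (slow h ∩ m>0))
      (⇝-⊔0 (⇝-+ (⇝-const 1#) (⇝-neg ratio)))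
      where
      N-quadratic : ∀ n → q n * m n ≤ 1# → fromℕ 2 * N n ≈ m n * (m n + 1#)
      N-quadratic n p = R.trans (R.*-congˡ (N≈ n)) (At.N-slow n (λ₁ n) p)

      k : ℕ → Carrier
      k n = fromℕ (index x n)

      m→∞ : ∀ M → Eventually (λ n → M < m n)
      m→∞ M = ev-map (λ n (p , r) → ≰⇒> λ m≤M → contra n p r
        (≤.trans m≤M (proj₂ (proj₂ (proj₂ b))))) (slow h ∩ N→∞ (a * (a + 1#)))
        where
        b = ◁-bound M
        a = proj₁ b
        contra : ∀ n → q n * m n ≤ 1# → a * (a + 1#) < N n → m n ≤ a → ⊥
        contra n p r m≤a = ⊥-by ((1 ⊛< r) ⊞ (≤.reflexive (N-quadratic n p)) ⊞
          (*-monoˡ (fromℕ-nonneg (λ₁ n)) m≤a) ⊞ (*-monoˡ (proj₁ (proj₂ b)) m≤a) ⊞ m≤a ⊞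
          (*-nonneg (proj₁ (proj₂ b)) (proj₁ (proj₂ b))) ⊞ (proj₁ (proj₂ b)))
          (solve 3 (λ v1 v2 a → (con (+ 2)) :* (a :* (a :+ :1)) :+ :2 :* v1 :+ v2 :* v2 :+ a :* v2
          :+ v2 :+ :0 :+ :0 := (con (+ 2)) :* v1 :+ v2 :* (v2 :+ :1) :+ v2 :* a :+ a :* a :+ a :+ a
          :* a :+ a) R.refl (N n) (m n) a)

      -- Since 2 N = m (m + 1), the index is the floor of x (m + 1) / 2. Divided by m it deviates
      -- from x / 2 by at most (x + 1) / m.
      ratio : (λ n → k n / m n) ⇝ x / fromℕ 2
      ratio = ⇝-squeeze (ev-map (λ n (p , m>0) → bound n p m>0) (slow h ∩ m>0))
        (⇝-resp (solve 1 (λ x → (x :+ :1) :* :0 := :0) R.refl x) (⇝-scale (x + 1#) (inv-∞ m→∞)))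
        where
        bound : ∀ n → q n * m n ≤ 1# → 0# < m n → k n / m n - x / fromℕ 2 ◁ (x + 1#) * m n ⁻¹
        bound n p m>0 = cancel-≤ (*-pos (fromℕ-pos 1) m>0)
          (≤-via ((1 ⊛ (≤.reflexive (R.sym ic))) ⊕ (1 ⊛ (≤.reflexive (R.sym (R.*-congˡ {k n} ic))))
          ⊕ (1 ⊛ (≤.reflexive (R.sym (R.*-congˡ {x} ic)))) ⊕ (≤.reflexive (R.*-congˡ {m n} hc)) ⊕
          (≤.reflexive (R.sym t≈)) ⊕ (1 ⊛ (proj₂ b)) ⊕ (2 ⊛ (proj₁ x>0)))
          (solve 6 (λ v1 i v2 x y t → :2 :* v1 :* (v2 :* i :- y) :- :2 :* v1 :*
          (:- ((x :+ :1) :* i)) := (con (+ 2)) :* (v1 :* i) :+ (con (+ 2)) :* (v2 :* (v1 :* i)) :+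
          (con (+ 2)) :* (x :* (v1 :* i)) :+ v1 :* x :+ :2 :* t :+ (con (+ 2)) :* (v2 :+ :1) :+
          (con (+ 3)) :* x :- ((con (+ 2)) :* :1 :+ (con (+ 2)) :* (v2 :* :1) :+ (con (+ 2)) :*
          (x :* :1) :+ v1 :* (y :* :2) :+ x :* (v1 :+ :1) :+ (con (+ 2)) :* t :+ (con (+ 3)) :* :0))
          R.refl (m n) i (k n) x y t)) ,
                        cancel-≤ (*-pos (fromℕ-pos 1) m>0)
                          (≤-via ((1 ⊛ (≤.reflexive (R.sym ic))) ⊕
                          (1 ⊛ (≤.reflexive (R.*-congˡ {k n} ic))) ⊕
                          (1 ⊛ (≤.reflexive (R.sym (R.*-congˡ {x} ic)))) ⊕
                          (≤.reflexive (R.sym (R.*-congˡ {m n} hc))) ⊕ (≤.reflexive t≈) ⊕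
                          (1 ⊛ (proj₁ b)) ⊕ (proj₁ x>0) ⊕ (1 ⊛ (proj₁ 0<1)))
                          (solve 6 (λ v1 i v2 x y t → :2 :* v1 :* ((x :+ :1) :* i) :- :2 :* v1 :*
                          (v2 :* i :- y) := (con (+ 2)) :* (v1 :* i) :+ (con (+ 2)) :* (v2 :* :1) :+
                          (con (+ 2)) :* (x :* (v1 :* i)) :+ v1 :* (y :* :2) :+ x :* (v1 :+ :1) :+
                          (con (+ 2)) :* t :+ x :+ (con (+ 2)) :* :1 :-
                          ((con (+ 2)) :* :1 :+ (con (+ 2)) :* (v2 :* (v1 :* i)) :+ (con (+ 2)) :*
                          (x :* :1) :+ v1 :* x :+ :2 :* t :+ (con (+ 2)) :* v2 :+ :0 :+ (con (+ 2))
                          :* :0)) R.refl (m n) i (k n) x y t))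
          where
          i = m n ⁻¹
          ic = inv-cancel m>0
          y = x / fromℕ 2
          hc = /-cancel {x} (fromℕ-pos 1)
          t = x * N n / m n
          b = index-bounds n (proj₁ x>0) m>0
          t≈ : fromℕ 2 * t ≈ x * (m n + 1#)
          t≈ = cancel-≈ m>0 (≈-via ((1 ⊛≈ (/-cancel {x * N n} m>0)) ⊕≈
            (R.*-congˡ {x} (N-quadratic n p))) (solve 4 (λ t v1 x v2 →
            v1 :* (x :* (v1 :+ :1)) :- v1 :* (:2 :* t) :=
            (con (+ 2)) :* (x :* v2) :+ x :* (v1 :* (v1 :+ :1)) :-
            ((con (+ 2)) :* (t :* v1) :+ x :* (:2 :* v2))) R.refl t (m n) x (N n)))

      eq : ∀ n → q n * m n ≤ 1# → 0# < m n → profile x n ≈ (1# - k n / m n) ⊔ 0#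
      eq n p m>0 = R.trans (R.*-congʳ (R.trans (fromℕ-cong (At.it-slow n (index x n) (λ₁ n) p))
        (fromℕ-∸-⊔ (λ₁ n) (index x n)))) divide
        where
        i = m n ⁻¹
        ic = inv-cancel m>0
        divide : ((m n - k n) ⊔ 0#) * i ≈ (1# - k n * i) ⊔ 0#
        divide with m n ≤⊎> k n
        ... | inj₁ m≤k = R.trans (R.*-congʳ (⊔-absorbˡ (≤-via m≤k
          (solve 2 (λ v1 v2 → :0 :- (v1 :- v2) := v2 :- v1) R.refl (m n) (k n)))))
              (R.trans (solve 1 (λ i → :0 :* i := :0) R.refl i)
                (R.sym (⊔-absorbˡ (≤-via ((≤.reflexive (R.sym ic)) ⊕
                (*-monoˡ (proj₁ (inv-pos m>0)) m≤k)) (solve 3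
                (λ v1 i v2 → :0 :- (:1 :- v2 :* i) := v1 :* i :+ i :* v2 :- (:1 :+ i :* v1)) R.refl
                (m n) i (k n))))))
        ... | inj₂ k<m = R.trans (R.*-congʳ (⊔-absorb (≤-shift (proj₁ k<m))))
              (R.trans (≈-via ic (solve 3 (λ v1 i v2 → :1 :- v2 :* i :- (v1 :- v2) :* i :=
                :1 :- v1 :* i) R.refl (m n) i (k n)))
                (R.sym (⊔-absorb (≤-via ((≤.reflexive ic) ⊕
                  (*-monoˡ (proj₁ (inv-pos m>0)) (proj₁ k<m)))
                  (solve 3 (λ v1 i v2 → :1 :- v2 :* i :- :0 :=
                  :1 :+ i :* v1 :- (v1 :* i :+ i :* v2)) R.refl (m n) i (k n))))))

    -- n q² → ∞: geometric decay of the piles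

    exponential : (∀ M → Eventually (λ n → M < nq² n)) → ∀ x → 0# < x → profile x ⇝ exp (- x)
    exponential h x x>0 = ⇝-resp (solve 1 (λ v1 → v1 :+ :0 := v1) R.refl (exp (- x)))
        (⇝-cong (0 , λ n _ → (solve 2 (λ v1 v2 → v1 :+ (v2 :- v1) := v2) R.refl (e n)
          (profile x n)))
          (⇝-+ (Exponential.power→exp q (index x) x q≥0 q≤1 q→0 qk→x (proj₁ x>0))
            (⇝-squeeze (ev-map close m>0) v→0)))
      where
      e : ℕ → Carrier
      e n = (1# - q n) ^ index x n

      v : ℕ → Carrier
      v n = (q n * m n) ⁻¹

      -- From q N ≤ m and n ≤ 2 N follows 2 q m ≥ 2 N q² ≥ n q².
      v→0 : v ⇝ 0#
      v→0 = inv-∞ λ M → ev-map (λ n p → (<-by 1 (p ⊞ (*-monoˡ (*-nonneg (q≥0 n) (q≥0 n)) (n≤2N n)) ⊞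
        (1 ⊛ (*-monoˡ (q≥0 n) (qN≤m n)))) (solve 5 (λ M v1 v2 v3 v4 →
        (con (+ 2)) :* (v2 :* v4 :- M) := v1 :* v2 :^ 2 :+ v2 :* v2 :* (:2 :* v3) :+ (con (+ 2)) :*
        (v2 :* v4) :- (:2 :* M :+ v2 :* v2 :* v1 :+ (con (+ 2)) :* (v2 :* (v2 :* v3)))) R.refl M
        (fromℕ n) (q n) (N n) (m n)))) (h (fromℕ 2 * M))

      -- Compared through squares: ℓ² ≤ 2 N and q N ≤ m give (ℓ / m)² ≤ 2 N / m² ≤ 2 / (q m) = 2 v.
      l/m→0 : (λ n → l n / m n) ⇝ 0#
      l/m→0 ε ε>0 = ev-map (λ n (p , m>0) → bound n (proj₂ p) m>0)
        (⇝-scale (fromℕ 2) v→0 (ε * ε) (*-pos ε>0 ε>0) ∩ m>0)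
        where
        bound : ∀ n → fromℕ 2 * v n - fromℕ 2 * 0# ≤ ε * ε → 0# < m n → l n / m n - 0# ◁ ε
        bound n p m>0 = (≤-via (t≥0 ⊕ (proj₁ ε>0)) (solve 2
          (λ t ε → t :- :0 :- (:- ε) := t :+ ε :- (:0 :+ :0)) R.refl t ε)) ,
          (≤-via (≮⇒≥ large) (solve 2 (λ t ε → ε :- (t :- :0) := ε :- t) R.refl t ε))
          where
          i = m n ⁻¹
          i≥0 = proj₁ (inv-pos m>0)
          ic = inv-cancel m>0
          qm>0 = *-pos (q>0 n) m>0
          vc = inv-cancel qm>0
          t = l n / m n
          t≥0 : 0# ≤ t
          t≥0 = *-nonneg (fromℕ-nonneg (At.ℓ n (λ₁ n))) i≥0
          v≈ : N n * i * i ≤ v n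
          v≈ = cancel-≤ qm>0 (≤-via ((≤.reflexive (R.sym vc)) ⊕
            (≤.reflexive (R.*-congˡ {q n * N n * i} ic)) ⊕ (*-monoˡ i≥0 (qN≤m n)) ⊕
            (≤.reflexive ic)) (solve 5 (λ v1 v2 v3 v4 i →
            v1 :* v2 :* v3 :- v1 :* v2 :* (v4 :* i :* i) :=
            v1 :* v2 :* v3 :+ v1 :* v4 :* i :* :1 :+ i :* v2 :+ :1 :-
            (:1 :+ v1 :* v4 :* i :* (v2 :* i) :+ i :* (v1 :* v4) :+ v2 :* i)) R.refl (q n) (m n)
            (v n) (N n) i))
          large : ¬ ε < t
          large ε<t = ⊥-by ((*-monoˡ-< ε>0 ε<t) ⊞ (*-monoˡ (*-nonneg i≥0 i≥0) (l²≤2N n)) ⊞ (1 ⊛ v≈)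
            ⊞ p ⊞ (*-monoˡ t≥0 (proj₁ ε<t))) (solve 5 (λ i v1 v2 v3 ε →
            ε :* ε :+ i :* i :* (v1 :* v1) :+ (con (+ 2)) :* (v2 :* i :* i) :+
            (:2 :* v3 :- :2 :* :0) :+ v1 :* i :* ε := ε :* (v1 :* i) :+ i :* i :* (:2 :* v2) :+
            (con (+ 2)) :* v3 :+ ε :* ε :+ v1 :* i :* (v1 :* i)) R.refl i (l n) (N n) (v n) ε)

      qN/m→1 : (λ n → q n * N n / m n) ⇝ 1#
      qN/m→1 = ⇝-squeeze (ev-map bound m>0) l/m→0
        where
        bound : ∀ n → 0# < m n → q n * N n / m n - 1# ◁ l n / m n
        bound n m>0 = (≤-via ((≤.reflexive (R.sym ic)) ⊕ (*-monoˡ i≥0 (m≤qN+l n)))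
          (solve 5 (λ v1 i v2 v3 v4 → v2 :* v3 :* i :- :1 :- (:- (v4 :* i)) :=
          v1 :* i :+ i :* (v2 :* v3 :+ v4) :- (:1 :+ i :* v1)) R.refl (m n) i (q n) (N n) (l n))) ,
                      (≤-via ((≤.reflexive ic) ⊕ (*-monoˡ i≥0 (qN≤m n)) ⊕
                        (*-nonneg i≥0 (fromℕ-nonneg (At.ℓ n (λ₁ n)))))
                        (solve 5 (λ v1 i v2 v3 v4 → v4 :* i :- (v2 :* v3 :* i :- :1) :=
                        :1 :+ i :* v1 :+ i :* v4 :- (v1 :* i :+ i :* (v2 :* v3) :+ :0)) R.refl (m n)
                        i (q n) (N n) (l n)))
          where
          i = m n ⁻¹
          i≥0 = proj₁ (inv-pos m>0)
          ic = inv-cancel m>0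

      qk→x : (λ n → q n * fromℕ (index x n)) ⇝ x
      qk→x = q-index (proj₁ x>0) (ev-map (λ n m>0 → (≈-via
        (R.*-congˡ {x} (/-cancel {q n * N n} m>0)) (solve 5
        (λ v1 v2 v3 v4 x → x :* v4 :* v3 :- x :* v1 :* v2 := x :* (v3 :* v4) :- x :* (v1 :* v2))
        R.refl (q n * N n / m n) (m n) (q n) (N n) x))) m>0)
        (⇝-resp (solve 1 (λ x → x :* :1 := x) R.refl x) (⇝-scale x qN/m→1))

      -- Dividing `it-lower` by q m gives at least e (1 + v) - v ≥ e - v, and `it-upper` gives at
      -- most e.
      close : ∀ n → 0# < m n → profile x n - e n - 0# ◁ v n
      close n m>0 = cancel-≤ qm>0 (≤-via ((≤.reflexive (R.sym vc)) ⊕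
        (≤.reflexive (R.sym (R.*-congˡ {q n * a} ic))) ⊕ (At.it-lower n (index x n) (λ₁ n)) ⊕ e≥0)
        (solve 6 (λ v1 v2 v3 a i v4 → v1 :* v2 :* (a :* i :- v4 :- :0) :- v1 :* v2 :* (:- v3) :=
        v1 :* v2 :* v3 :+ v1 :* a :* (v2 :* i) :+ (v1 :* a :+ :1) :+ v4 :-
        (:1 :+ v1 :* a :* :1 :+ v4 :* (v1 :* v2 :+ :1) :+ :0)) R.refl (q n) (m n) (v n) a i (e n)))
        ,
                    cancel-≤ m>0 (≤-via ((≤.reflexive (R.*-congˡ {a} ic)) ⊕
                      (At.it-upper n (index x n) (λ₁ n)) ⊕
                      (*-nonneg (proj₁ m>0) (proj₁ (inv-pos qm>0))))
                      (solve 5 (λ a v1 i v2 v3 → v1 :* v3 :- v1 :* (a :* i :- v2 :- :0) :=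
                      a :* :1 :+ v2 :* v1 :+ v1 :* v3 :- (a :* (v1 :* i) :+ a :+ :0)) R.refl a (m n)
                      i (e n) (v n)))
        where
        i = m n ⁻¹
        ic = inv-cancel m>0
        qm>0 = *-pos (q>0 n) m>0
        vc = inv-cancel qm>0
        a = fromℕ (At.it n (index x n) (λ₁ n))
        e≥0 : 0# ≤ e n
        e≥0 = At.^-nonneg n (index x n) (≤-shift (q≤1 n))

    -- n q² → C: tracking area and time

    module Critical (C z : Carrier) (C>0 : 0# < C) (nq²→C : nq² ⇝ C)
      (scale : SatisfiesScaleEquation C z) where
      private
        z>0 = proj₁ scale
      open Shape C z C>0 z>0

      private
        -- Bounds valid once n q² < C + 1. L bounds t = ℓ q, by t ≤ t² + 1 and t² ≤ 2 N q²; B bounds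
        -- ⌈ q m ⌉, by q m ≤ N q² + ℓ q and 1 for rounding; E q bounds the errors of `area-total`
        -- and `time-total`.
        L B E : Carrier
        L = fromℕ 2 * (C + 1#) + 1#
        B = C + 1# + L + 1#
        E = L * B + B * B

        Bounded : ℕ → Set
        Bounded n = l n * q n ≤ L × fromℕ ⌈ q n * m n ⌉ ≤ B

        bounded : Eventually Bounded
        bounded = ev-map f (⇝-upper {a = C + 1#} nq²→C (<-via 0<1
          (solve 1 (λ C → C :+ :1 :- C := :1 :- :0) R.refl C)))
          where
          f : ∀ n → nq² n < C + 1# → Bounded n
          f n p = lq≤ , ≤.trans (proj₁ (⌈⌉-lb (*-nonneg (q≥0 n) (fromℕ-nonneg (λ₁ n)))))
                   (≤-via ((qm≤ n) ⊕ lq≤ ⊕ (Nq²≤ n) ⊕ (proj₁ p))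
                     (solve 7 (λ v1 v2 v3 v4 L v5 C → C :+ :1 :+ L :+ :1 :- (v1 :* v2 :+ :1) :=
                     v3 :+ v4 :* v1 :+ L :+ v5 :+ (C :+ :1) :- (v1 :* v2 :+ v4 :* v1 :+ v3 :+ v5))
                     R.refl (q n) (m n) (Nq² n) (l n) L (nq² n) C))
            where
            lq≤ : l n * q n ≤ L
            lq≤ = ≤-via ((≤-square (l n * q n)) ⊕ (l²q²≤ n) ⊕ (1 ⊛ (Nq²≤ n)) ⊕ (1 ⊛ (proj₁ p)))
              (solve 5 (λ v1 v2 v3 v4 C → :2 :* (C :+ :1) :+ :1 :- v1 :* v2 :=
              v1 :* v2 :* (v1 :* v2) :+ :1 :+ :2 :* v3 :+ (con (+ 2)) :* v4 :+ (con (+ 2)) :*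
              (C :+ :1) :- (v1 :* v2 :+ v1 :* v2 :* (v1 :* v2) :+ (con (+ 2)) :* v3 :+ (con (+ 2))
              :* v4)) R.refl (l n) (q n) (Nq² n) (nq² n) C)

        -- The discarded cards number at most ℓ, and ℓ q² ≤ L q.
        Nq²→C : Nq² ⇝ C
        Nq²→C = ⇝-resp (solve 1 (λ C → C :+ :0 := C) R.refl C)
          (⇝-cong (0 , λ n _ → (solve 2 (λ v1 v2 → v1 :+ (v2 :- v1) := v2) R.refl (nq² n) (Nq² n)))
            (⇝-+ nq²→C (⇝-squeeze (ev-map f bounded) (⇝-resp
              (solve 1 (λ L → L :* :0 := :0) R.refl L) (⇝-scale L q→0)))))
          where
          f : ∀ n → Bounded n → Nq² n - nq² n - 0# ◁ L * q n
          f n (b , _) = (≤-via ((*-monoˡ (q≥0 n) b) ⊕ (*-monoˡ (*-nonneg (q≥0 n) (q≥0 n))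
            (n≤N+l n))) (solve 5 (λ v1 v2 L v3 v4 → v4 :* (v1 :* v1) :- v3 :* v1 :^
            2 :- :0 :- (:- (L :* v1)) := v1 :* L :+ v1 :* v1 :* (v4 :+ v2) :-
            (v1 :* (v2 :* v1) :+ v1 :* v1 :* v3)) R.refl (q n) (l n) L (fromℕ n) (N n))) ,
                        (≤-via ((Nq²≤ n) ⊕ (*-monoˡ (q≥0 n) b) ⊕
                          (*-nonneg (q≥0 n) (*-nonneg (fromℕ-nonneg (At.ℓ n (λ₁ n))) (q≥0 n))))
                          (solve 5 (λ v1 v2 v3 v4 L → L :* v3 :- (v1 :- v2 :- :0) :=
                          v2 :+ v3 :* L :+ v3 :* (v4 :* v3) :- (v1 :+ v3 :* (v4 :* v3) :+ :0))
                          R.refl (Nq² n) (nq² n) (q n) (l n) L))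

        Eq→0 : (λ n → E * q n) ⇝ 0#
        Eq→0 = ⇝-resp (solve 1 (λ E → E :* :0 := :0) R.refl E) (⇝-scale E q→0)

        qm≥0 : ∀ n → 0# ≤ q n * m n
        qm≥0 n = *-nonneg (q≥0 n) (fromℕ-nonneg (λ₁ n))

        B≥0 : 0# ≤ B
        B≥0 = ≤-via ((2 ⊛ (proj₁ C>0)) ⊕ (4 ⊛ (proj₁ 0<1)))
          (solve 1 (λ C → C :+ :1 :+ (:2 :* (C :+ :1) :+ :1) :+ :1 :- :0 :=
          (con (+ 3)) :* C :+ (con (+ 5)) :* :1 :- ((con (+ 3)) :* :0 :+ (con (+ 5)) :* :0)) R.refl
          C)

        error : ∀ n {k} → Bounded n → k * q n ≤ L → k * (q n * q n * B) + q n * B * fromℕ ⌈ q n * m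
          n ⌉ ≤ E * q n
        error n {k} (_ , b) p = ≤-via ((*-monoˡ (*-nonneg (q≥0 n) B≥0) p) ⊕
          (*-monoˡ (*-nonneg (q≥0 n) B≥0) b)) (solve 5 (λ v1 B k L v2 →
          (L :* B :+ B :* B) :* v1 :- (k :* (v1 :* v1 :* B) :+ v1 :* B :* v2) :=
          v1 :* B :* L :+ v1 :* B :* B :- (v1 :* B :* (k :* v1) :+ v1 :* B :* v2)) R.refl (q n) B k
          L (fromℕ ⌈ q n * m n ⌉))

        qm→z : (λ n → q n * m n) ⇝ z
        qm→z = A.P-reflects-⇝ (proj₁ z>0) (0 , λ n _ → qm≥0 n)
          (⇝-resp (R.trans (solve 1 (λ C → C :+ :0 := C) R.refl C) (R.sym (scale⇒area scale)))
            (⇝-cong (0 , λ n _ → (solve 2 (λ v1 v2 → v1 :+ (v2 :- v1) := v2) R.refl (Nq² n)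
              (A.P (q n * m n))))
              (⇝-+ Nq²→C (⇝-squeeze (ev-map f bounded) Eq→0))))
          where
          f : ∀ n → Bounded n → A.P (q n * m n) - Nq² n - 0# ◁ E * q n
          f n b = ◁-cong (≈-via (R.*-congˡ {q n * q n} (N≈ n))
            (solve 4 (λ v1 v2 v3 v4 → v4 :- v2 :* (v1 :* v1) :- :0 :- (v4 :- v1 :* v1 :* v3) :=
            v1 :* v1 :* v3 :- v1 :* v1 :* v2) R.refl (q n) (N n) (fromℕ (At.N n (λ₁ n)))
            (A.P (q n * m n))))
                   (◁-mono (error n b (proj₁ b)) (At.area-total n (λ₁ n) (proj₂ b)))

      module _ (x : Carrier) (x>0 : 0# < x) where
        private
          x≥0 = proj₁ x>0

          k a : ℕ → Carrier
          k n = fromℕ (index x n)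
          a n = fromℕ (At.it n (index x n) (λ₁ n))

          qa≥0 : ∀ n → 0# ≤ q n * a n
          qa≥0 n = *-nonneg (q≥0 n) (fromℕ-nonneg (At.it n (index x n) (λ₁ n)))

          qk→cx : (λ n → q n * k n) ⇝ c * x
          qk→cx = q-index x≥0 (ev-map (λ n m>0 → eq n m>0) m>0)
              (⇝-resp (solve 3 (λ x C v1 → x :* (C :* v1) := C :* v1 :* x) R.refl x C (z ⁻¹))
                (⇝-scale x (⇝-/ Nq²→C qm→z z>0)))
            where
            eq : ∀ n → 0# < m n → x * (Nq² n / (q n * m n)) * m n ≈ x * N n * q n
            eq n m>0 = cancel-≈ (q>0 n) (≈-via (R.*-congˡ {x}
              (/-cancel {Nq² n} (*-pos (q>0 n) m>0))) (solve 5
              (λ x v1 v2 v3 v4 → v2 :* (x :* v4 :* v2) :- v2 :* (x :* v1 :* v3) :=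
              x :* (v4 :* (v2 :* v2)) :- x :* (v1 :* (v2 :* v3))) R.refl x (Nq² n / (q n * m n))
              (q n) (m n) (N n)))

          predicted : ℕ → Carrier
          predicted n = τ.P (q n * m n) - q n * k n

          -- Up to step ℓ this is `time-total`; the cut at 0 costs nothing because τ of the actual
          -- height is nonnegative and the maximum with 0 does not increase distances.
          near : ∀ n → Bounded n → τ.P (q n * a n) - (predicted n ⊔ 0#) ◁ E * q n
          near n b = by-cases (ℕ.≤-total (index x n) (At.ℓ n (λ₁ n)))
            where
            by-cases : index x n ℕ.≤ At.ℓ n (λ₁ n) ⊎ At.ℓ n (λ₁ n) ℕ.≤ index x n →
                       τ.P (q n * a n) - (predicted n ⊔ 0#) ◁ E * q n
            by-cases (inj₁ k≤ℓ) = ◁-cong (+-congʳ (⊔-absorb (τ.P-nonneg (qa≥0 n))))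
                (⊔0-lipschitz (◁-cong (solve 4 (λ v1 v2 v3 v4 → (:- (v1 :- v2 :- v3 :* v4)) :=
                  v2 :- (v1 :- v3 :* v4)) R.refl (τ.P (q n * m n)) (τ.P (q n * a n)) (q n) (k n))
                  (◁-- (◁-mono (error n b kq≤L) (At.time-total n (index x n) (λ₁ n) k≤ℓ
                    (proj₂ b))))))
              where
              kq≤L : k n * q n ≤ L
              kq≤L = ≤-via ((*-monoˡ (q≥0 n) (fromℕ-mono k≤ℓ)) ⊕ (proj₁ b))
                (solve 4 (λ v1 v2 v3 L → L :- v2 :* v1 := v1 :* v3 :+ L :- (v1 :* v2 :+ v3 :* v1))
                R.refl (q n) (k n) (l n) L)
            -- Past the last pile the true height is 0, and the prediction must be shown to be at
            -- most E q. The complete descent takes time ℓ q up to this error, and ℓ ≤ k.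
            by-cases (inj₂ ℓ≤k) = (≤-via ((≤.reflexive (R.sym τa≈0)) ⊕ (⊔-lub p≤ Eq≥0))
              (solve 4 (λ v1 v2 E v3 → v1 :- v2 :- (:- (E :* v3)) := v1 :+ E :* v3 :- (:0 :+ v2))
              R.refl (τ.P (q n * a n)) (predicted n ⊔ 0#) E (q n))) ,
                             (≤-via ((≤.reflexive τa≈0) ⊕ (⊔-ub₂ (predicted n) 0#) ⊕ Eq≥0)
                               (solve 4 (λ v1 v2 E v3 → E :* v3 :- (v1 :- v2) :=
                               :0 :+ v2 :+ E :* v3 :- (v1 :+ :0 :+ :0)) R.refl (τ.P (q n * a n))
                               (predicted n ⊔ 0#) E (q n)))
              where
              zero-height : ∀ {h} → h ≡ 0 → τ.P (q n * fromℕ h) ≈ 0#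
              zero-height ≡.refl = R.trans (τ.P-cong (solve 1 (λ v1 → v1 :* :0 := :0) R.refl (q n)))
                τ.P-0
              τa≈0 : τ.P (q n * a n) ≈ 0#
              τa≈0 = zero-height (At.it-beyond n (index x n) (λ₁ n) ℓ≤k)
              p≤ : predicted n ≤ E * q n
              p≤ = ≤-via ((proj₂ (At.time-total n (At.ℓ n (λ₁ n)) (λ₁ n) ℕ.≤-refl (proj₂ b))) ⊕
                (error n b (proj₁ b)) ⊕ (≤.reflexive (zero-height
                (At.it-beyond n (At.ℓ n (λ₁ n)) (λ₁ n) ℕ.≤-refl))) ⊕
                (*-monoˡ (q≥0 n) (fromℕ-mono ℓ≤k))) (solve 7
                (λ v1 τℓ v2 v3 v4 E v5 → E :* v2 :- (v1 :- v2 :* v5) :=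
                v4 :+ E :* v2 :+ :0 :+ v2 :* v5 :- (v1 :- τℓ :- v2 :* v3 :+ v4 :+ τℓ :+ v2 :* v3))
                R.refl (τ.P (q n * m n)) τℓ (q n) (l n) bnd E (k n))
                where
                τℓ = τ.P (q n * fromℕ (At.it n (At.ℓ n (λ₁ n)) (λ₁ n)))
                bnd = l n * (q n * q n * B) + q n * B * fromℕ ⌈ q n * m n ⌉
              Eq≥0 : 0# ≤ E * q n
              Eq≥0 = *-nonneg (≤-via ((*-nonneg L≥0 B≥0) ⊕ (*-nonneg B≥0 B≥0))
                (solve 2 (λ L B → L :* B :+ B :* B :- :0 := L :* B :+ B :* B :- (:0 :+ :0)) R.refl L
                B)) (q≥0 n)
                where
                L≥0 : 0# ≤ L
                L≥0 = ≤-via ((1 ⊛ (proj₁ C>0)) ⊕ (2 ⊛ (proj₁ 0<1)))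
                  (solve 1 (λ C → :2 :* (C :+ :1) :+ :1 :- :0 :=
                  (con (+ 2)) :* C :+ (con (+ 3)) :* :1 :- ((con (+ 2)) :* :0 :+ (con (+ 3)) :* :0))
                  R.refl C)

          qa→height : (λ n → q n * a n) ⇝ height x
          qa→height = τ.P-reflects-⇝ (height-nonneg x) (0 , λ n _ → qa≥0 n)
            (⇝-resp (R.trans (solve 1 (λ v1 → v1 :+ :0 := v1) R.refl r)
              (R.sym (height-remaining x)))
              (⇝-cong (0 , λ n _ → (solve 2 (λ v1 v2 → v1 :+ (v2 :- v1) := v2) R.refl
                (predicted n ⊔ 0#) (τ.P (q n * a n))))
                (⇝-+ predicted→r (⇝-squeeze (ev-map (λ n b → ◁-cong
                  (solve 2 (λ v1 v2 → v1 :- v2 := v1 :- v2 :- :0) R.refl (τ.P (q n * a n))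
                  (predicted n ⊔ 0#)) (near n b)) bounded) Eq→0))))
            where
            r = remaining x
            predicted→r : (λ n → predicted n ⊔ 0#) ⇝ r
            predicted→r = ⇝-⊔0 (⇝-+ (τ.P-continuous (proj₁ z>0) (0 , λ n _ → qm≥0 n) qm→z)
              (⇝-neg (⇝-resp (R.*-congˡ (R.sym (⊔-absorb x≥0))) qk→cx)))

        piecewise : profile x ⇝ φ x
        piecewise = ⇝-cong (ev-map eq m>0) (⇝-/ qa→height qm→z z>0)
          where
          eq : ∀ n → 0# < m n → q n * a n / (q n * m n) ≈ a n / m n
          eq n m>0 = ≈-/ m>0 (cancel-≈ (q>0 n) (≈-via (/-cancel {q n * a n} (*-pos (q>0 n) m>0))
            (solve 4 (λ v1 v2 v3 v4 → v2 :* v4 :- v2 :* (v1 :* v3) := v2 :* v4 :- v1 :* (v2 :* v3))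
            R.refl (q n * a n / (q n * m n)) (q n) (m n) (a n))))

    limit-shape : ∀ {φ : Carrier → Carrier} → (∀ x → 0# < x → profile x ⇝ φ x) → ∀ x → 0# < x →
      (λ n → ∂ (proj₁ (conf n)) x) ⇝ φ x
    limit-shape {φ} h x x>0 = ⇝-cong {profile x} {λ n → ∂ (proj₁ (conf n)) x} {φ x}
      (0 , λ n _ → profile-∂ x n) (h x x>0)

theorem5 : (lem : ExcludedMiddle 0ℓ) (ℝ : CompleteOrderedField) →
    let open Solitaire lem ℝ in
    (q : ℕ → Carrier) →
    (∀ n → 1 ℕ.≤ n → 0# < q n × q n ≤ 1#) →
    q ⟶ 0# →
    let nq² = λ n → fromℕ n * q n ^ 2 in
    (nq² ⟶ 0# → IsLimitShape q triangle) ×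
    (nq² ⟶∞ → IsLimitShape q (λ x → exp (- x))) ×
    (∀ C → 0# < C → nq² ⟶ C →
    ∃! _≈_ (SatisfiesScaleEquation C) ×
    (∀ z → SatisfiesScaleEquation C z →
    ∃ λ φ → Sections.IsPiecewiseLinear C z φ × IsLimitShape q φ))
theorem5 lem ℝ q q-bounds q⟶0 =
    (λ h → transfer (S.triangular (shift (⟶⇒⇝ h)))) ,
    (λ h → transfer (S.exponential λ M → unshift (λ x → M < x) (h M))) ,
    (λ C C>0 h → scale-solution C>0 , λ z scale →
      Shape.φ C z C>0 (proj₁ scale) , Shape.piecewiseLinear C z C>0 (proj₁ scale) ,
      transfer (S.Critical.piecewise C z C>0 (shift (⟶⇒⇝ h)) scale))
  where
  open Solitaire lem ℝ
  open Development lem ℝ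

  -- The value q 0 is unconstrained, so it is replaced by 1#.
  q′ : ℕ → Carrier
  q′ zero    = 1#
  q′ (suc n) = q (suc n)

  q′-bounds : ∀ n → 0# < q′ n × q′ n ≤ 1#
  q′-bounds zero    = 0<1 , IsTotalOrder.refl isTotalOrder
  q′-bounds (suc n) = q-bounds (suc n) (ℕ.s≤s ℕ.z≤n)

  from-one : {P : ℕ → Set} → (∀ n → P (suc n)) → Eventually P
  from-one p = 1 , λ { (suc n) _ → p n }

  q′→0 : q′ ⇝ 0#
  q′→0 = ⇝-cong (from-one λ _ → R.refl) (⟶⇒⇝ q⟶0)

  module S = Scaling q′ q′-bounds q′→0

  shift : ∀ {L} → (λ n → fromℕ n * q n ^ 2) ⇝ L → (λ n → fromℕ n * q′ n ^ 2) ⇝ L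
  shift = ⇝-cong (from-one λ _ → R.refl)

  unshift : (P : Carrier → Set) → Eventually (λ n → P (fromℕ n * q n ^ 2)) →
            Eventually (λ n → P (fromℕ n * q′ n ^ 2))
  -- The threshold `suc N` excludes n = 0, where q and `q′` may differ.
  unshift P (N , p) = suc N , λ { (suc n) N<n → p (suc n) (ℕ.<⇒≤ N<n) }

  transfer : ∀ {φ} → (∀ x → 0# < x → S.profile x ⇝ φ x) → IsLimitShape q φ
  transfer h x x>0 = ⇝⇒⟶ (⇝-cong (from-one λ _ → R.refl) (S.limit-shape h x x>0))
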